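{- For every integer $s\ge 1$ there exists an integer $k\ge 2$ such that, for every claw-free matroid $M=(E,G)$ with $\omega(M)\le s$, there is a flat $F$ of $G$ of codimension at most $k$ such that $M|F$ is isomorphic to an iterated lift-join $(\cdots((M_1\otimes M_2)\otimes M_3)\cdots)\otimes M_{2s+1}$ of $2s+1$ even-plane matroids $M_1,\dots,M_{2s+1}$.
   Context: A matroid is a pair $M=(E,G)$ where $G$ is the set of nonzero vectors of a finite-dimensional $\mathbb F_2$-vector space $V(G)=G\cup\{0\}\cong\mathbb F_2^n$ and $E\subseteq G$; $n\ge0$ is the dimension of $M$ (dimension $0$ allowed). Isomorphism of matroids is given by linear isomorphisms of the ambient spaces mapping ground sets onto each other. A flat of $G$ is a set $F\subseteq G$ with $F\cup\{0\}$ a subspace; its dimension is that of the subspace, and its codimension is $\dim(G)-\dim(F)$. Planes are $3$-dimensional flats. $M|F=(E\cap F,F)$. A claw is $(B,G)$ with $\dim G=3$, $B$ a basis; $M$ is claw-free if no induced restriction $M|F$ is isomorphic to a claw. $\omega(M)$ is the largest dimension of a flat contained in $E$. $M$ is even-plane if $|E\cap P|$ is even for all planes $P$ of $G$. Lift-join: $M_1\otimes M_2=(E_1\cup(E_2+V(G_1)),G_1\oplus G_2)$ for $M_i=(E_i,G_i)$, where $G_1\oplus G_2$ is the set of nonzero vectors of $V(G_1)\oplus V(G_2)$ with each $V(G_i)$ identified with its copy, and $X+Y=\{x+y\}$. -}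

module Defs where

open import Data.Bool using (Bool; true; false; _xor_; _∧_; _∨_; not)
open import Data.Nat using (ℕ; zero; suc; _+_; _*_; _≤_)
open import Data.Nat.Divisibility using (_∣_)
open import Data.Vec using (Vec; []; _∷_; replicate; zipWith; splitAt; _++_)
open import Data.List using (List; []; _∷_; map; filter; length) renaming (_++_ to _++ₗ_)
open import Data.Product using (Σ; ∃; ∃-syntax; _×_; _,_)
open import Relation.Binary.PropositionalEquality using (_≡_)
open import Relation.Nullary using (¬_)
open import Function.Definitions using (Injective; Bijective)
open import Data.Bool.Properties using (T?)

-- The F₂-vector space F₂ⁿ (vectors as Vec Bool n; true = 1).

Vector : ℕ → Set
Vector n = Vec Bool n

0v : {n : ℕ} → Vector n
0v {n} = replicate n false

infixl 6 _+v_
_+v_ : {n : ℕ} → Vector n → Vector n → Vector n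
_+v_ = zipWith _xor_

isZero : {n : ℕ} → Vector n → Bool
isZero [] = true
isZero (b ∷ v) = not b ∧ isZero v

allVecs : (n : ℕ) → List (Vector n)
allVecs zero = [] ∷ []
allVecs (suc n) = map (false ∷_) (allVecs n) ++ₗ map (true ∷_) (allVecs n)

-- F₂-linear maps (additivity is linearity over F₂)
Linear : {m n : ℕ} → (Vector m → Vector n) → Set
Linear f = ∀ x y → f (x +v y) ≡ f x +v f y

-- Matroids.  A matroid of dimension n is presented, up to isomorphism,
-- with G = F₂ⁿ \ {0}; the ground set E ⊆ G is given by its (decidable)
-- indicator function.  Well-formedness says 0 ∉ E.

record Matroid : Set where
  constructor mat
  field
    dim : ℕ
    E   : Vector dim → Bool
open Matroid public

WF : Matroid → Set
WF M = E M 0v ≡ false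

_≅_ : Matroid → Matroid → Set
M ≅ N = Σ (Vector (dim M) → Vector (dim N)) λ ψ →
          Linear ψ × Bijective _≡_ _≡_ ψ × (∀ x → E N (ψ x) ≡ E M x)

-- Flats.  A flat of G = F₂ⁿ\{0} of dimension d is the set of nonzero
-- vectors of a d-dimensional subspace, i.e. of the image of an injective
-- linear map φ : F₂ᵈ → F₂ⁿ.  We represent flats by such parametrisations.

record Flat (d n : ℕ) : Set where
  constructor flat
  field
    emb    : Vector d → Vector n
    linear : Linear emb
    inj    : Injective _≡_ _≡_ emb
open Flat public

-- The induced restriction M|F, transported along the parametrisation of F
-- (a matroid isomorphic to (E ∩ F, F)).
restrict : (M : Matroid) {d : ℕ} → Flat d (dim M) → Matroid
restrict M {d} F = mat d (λ x → E M (emb F x))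

claw : Matroid
claw = mat 3 c
  where
  c : Vector 3 → Bool
  c (true  ∷ false ∷ false ∷ []) = true
  c (false ∷ true  ∷ false ∷ []) = true
  c (false ∷ false ∷ true  ∷ []) = true
  c _ = false

ClawFree : Matroid → Set
ClawFree M = (F : Flat 3 (dim M)) → ¬ (restrict M F ≅ claw)

FlatInE : (M : Matroid) {d : ℕ} → Flat d (dim M) → Set
FlatInE M F = ∀ x → isZero x ≡ false → E M (emb F x) ≡ true

OmegaLe : Matroid → ℕ → Set
OmegaLe M s = ∀ d (F : Flat d (dim M)) → FlatInE M F → d ≤ s

countIn : (M : Matroid) → Flat 3 (dim M) → ℕ
countIn M P = length (filter (λ x → T? (E M (emb P x))) (allVecs 3))

EvenPlane : Matroid → Set
EvenPlane M = (P : Flat 3 (dim M)) → 2 ∣ countIn M P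

-- Lift-join.  V(G₁ ⊕ G₂) = F₂^(n₁+n₂), a vector u ++ v with u ∈ V(G₁),
-- v ∈ V(G₂).  E = E₁ ∪ (E₂ + V(G₁)):  u ++ v ∈ E iff (v = 0 and u ∈ E₁)
-- or v ∈ E₂.

liftJoinE : {n₁ n₂ : ℕ} → (Vector n₁ → Bool) → (Vector n₂ → Bool) →
            Vector (n₁ + n₂) → Bool
liftJoinE {n₁} E₁ E₂ x with splitAt n₁ x
... | u , v , _ = (isZero v ∧ E₁ u) ∨ E₂ v

infixl 5 _⊗_
_⊗_ : Matroid → Matroid → Matroid
M₁ ⊗ M₂ = mat (dim M₁ + dim M₂) (liftJoinE (E M₁) (E M₂))

iterLiftJoin : {m : ℕ} → Vec Matroid (suc m) → Matroid
iterLiftJoin (M ∷ Ms) = go M Ms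
  where
  go : {k : ℕ} → Matroid → Vec Matroid k → Matroid
  go acc [] = acc
  go acc (N ∷ Ns) = go (acc ⊗ N) Ns

{-# OPTIONS --safe #-}
module Submission where

-- Induction on s.  With f the indicator function of the ground set E, it suffices that
-- every claw-free M with ω(M) ≤ s is even-plane on a subspace containing E, or a lift-join
-- of two nonempty matroids (whose ω add up), or that flats of E inside some subspace U, of
-- bounded codimension in a subspace containing E, are never maximal, so that ω drops on U.
-- Each s ≥ 1 then needs at most 2s factors.
--
-- If no plane meets E in exactly five points, then for every x ∈ E the set H x of all v
-- with f (v) ≠ f (v + x) is a subspace.  If these have codimension at most 1 in the span
-- of E, the third derivative of f vanishes there; otherwise a suitable U of codimension 2
-- exists.
--
-- Otherwise there are zeros p, q of f with p + q ∈ E and x + ⟨p, q⟩ ⊆ E.  Enlarge ⟨p, q⟩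
-- to a maximal subspace W with x + W ⊆ E spanned by zeros that are connected through
-- pairs with sum in E.  Either M is a lift-join whose lower factor lies in W, or one finds
-- one of a few explicit patterns of f on a subspace T of dimension 4 or 5.  Given T,
-- a maximality argument on the cosets of T that miss E reduces to the case that every
-- triangle of zeros of f meets a subspace U with f (u + t) = f (t) for u ∈ U, 0 ≠ t ∈ T.
-- A complement of U then contains no triangle of zeros and has bounded dimension by
-- a Ramsey argument, and flats of E inside U extend by an element of T.

open import Defs
open import Data.Nat using (ℕ; _+_; _*_; _≤_; suc)
open import Data.Vec using (Vec)
open import Data.Vec.Relation.Unary.All using (All)
open import Data.Product using (Σ; ∃-syntax; _×_)
open import Data.Bool using (Bool; true; false; _xor_; _∧_; _∨_; not)
open import Data.Bool.Properties using (∨-identityʳ; ∨-zeroʳ; T?; xor-assoc; xor-comm; xor-same)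
open import Data.Empty using (⊥; ⊥-elim)
open import Data.Fin using (Fin; zero; suc; combine; remQuot; funToFin; finToFun) renaming (_<_ to _<ᶠ_)
open import Data.Fin.Properties using (combine-remQuot; remQuot-combine; injective⇒≤; pigeonhole; finToFun-funToFin; <⇒≢)
open import Data.List using (List; []; _∷_; filter; foldr; length) renaming (map to mapₗ; _++_ to _++ₗ_)
open import Data.List.Membership.Propositional using (_∈_; find; lose)
open import Data.List.Membership.Propositional.Properties using (∈-++⁺ˡ; ∈-++⁺ʳ; ∈-map⁺; ∈-map⁻; ∈-filter⁺; ∈-filter⁻)
open import Data.List.Relation.Unary.Any as Any using (here; there)
open import Data.Maybe using (Maybe; just; nothing)
open import Data.Nat using (zero; _∸_; _^_; _<_; _/_; _%_; _≡ᵇ_; z≤n; s≤s; s≤s⁻¹)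
open import Data.Nat.Divisibility using (_∣_; divides; _∣0)
open import Data.Nat.Properties using (_≤?_; 1+n≰n; +-assoc; +-cancelʳ-≤; +-cancelˡ-≤; +-comm; +-identityʳ; +-mono-≤; +-monoʳ-≤; +-monoˡ-≤; +-suc; *-distribˡ-+; *-suc; <⇒≤; <⇒≱; ^-monoʳ-<; m+[n∸m]≡n; m^n>0; m≤m*n; m≤m+n; m≤n+m; m≤n⇒m<n∨m≡n; m≤n⇒∃[o]m+o≡n; n≤1+n; ≤-refl; ≤-reflexive; ≤-trans; ≰⇒>)
open import Data.Product using (_,_; proj₁; proj₂)
open import Data.Sum using (_⊎_; inj₁; inj₂; fromInj₁)
open import Data.Unit using (⊤; tt)
open import Data.Vec using ([]; _∷_; _++_; drop; fromList; head; lookup; map; splitAt; take)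
open import Data.Vec.Properties using (++-injectiveʳ; ++-injectiveˡ; drop-zipWith; take++drop≡id; take-zipWith; ∷-injectiveʳ)
open import Data.Vec.Relation.Unary.All using ([]; _∷_)
open import Data.Vec.Relation.Unary.All.Properties using (++⁺)
open import Function using (_∘_; id)
open import Relation.Binary.PropositionalEquality
open import Relation.Nullary using (¬_; Dec; yes; no; contradiction; ¬?; _×-dec_; _→-dec_; _⊎-dec_)
open ≡-Reasoning


-- Vectors over F₂

-- Claw-freeness is used for arbitrary, possibly dependent vectors, so it pulls back along every
-- linear map. Each local statement thus lives on a coordinate space of dimension at most 7, where a
-- finite case tree certifies it. The Ramsey step rests on one observation: a zero r cannot
-- translate a triangle of zeros into E, since the three translates would have zero pairwise sums
-- and total r. The patterns on T contain four zeros with all pairwise sums in E. Translation by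
-- each of them keeps some triangle point at zero, and four translations against three points force
-- a triangle point around which f repeats the pattern. Connectivity of the zeros spanning W matters
-- because the values of f at translates by the two ends of an edge are tied together. Along a tree
-- of edges this reaches all of W, which is the union of the sums of evenly many and of oddly many
-- of these zeros. A subspace containing E costs no codimension, because f is then a lift-join with
-- an empty upper factor. These empty factors account for 2s instead of s; the remaining places up
-- to 2s + 1 are filled with empty matroids of dimension 0.

+v-assoc : ∀ {n} (u v w : Vector n) → (u +v v) +v w ≡ u +v (v +v w)
+v-assoc [] [] [] = refl
+v-assoc (a ∷ u) (b ∷ v) (c ∷ w) = cong₂ _∷_ (xor-assoc a b c) (+v-assoc u v w)

+v-comm : ∀ {n} (u v : Vector n) → u +v v ≡ v +v u
+v-comm [] [] = refl
+v-comm (a ∷ u) (b ∷ v) = cong₂ _∷_ (xor-comm a b) (+v-comm u v)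

+v-self : ∀ {n} (v : Vector n) → v +v v ≡ 0v
+v-self [] = refl
+v-self (b ∷ v) = cong₂ _∷_ (xor-same b) (+v-self v)

+v-identityˡ : ∀ {n} (v : Vector n) → 0v +v v ≡ v
+v-identityˡ [] = refl
+v-identityˡ (b ∷ v) = cong (b ∷_) (+v-identityˡ v)

+v-identityʳ : ∀ {n} (v : Vector n) → v +v 0v ≡ v
+v-identityʳ v = trans (+v-comm v 0v) (+v-identityˡ v)

+v-swap : ∀ {n} (a b c d : Vector n) → (a +v b) +v (c +v d) ≡ (a +v c) +v (b +v d)
+v-swap a b c d = begin
  (a +v b) +v (c +v d) ≡⟨ +v-assoc a b (c +v d) ⟩
  a +v (b +v (c +v d)) ≡⟨ cong (a +v_) (+v-assoc b c d) ⟨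
  a +v ((b +v c) +v d) ≡⟨ cong (λ z → a +v (z +v d)) (+v-comm b c) ⟩
  a +v ((c +v b) +v d) ≡⟨ cong (a +v_) (+v-assoc c b d) ⟩
  a +v (c +v (b +v d)) ≡⟨ +v-assoc a c (b +v d) ⟨
  (a +v c) +v (b +v d) ∎

lin : ∀ {n m} → Vec (Vector n) m → Vector m → Vector n
lin [] [] = 0v
lin (v ∷ vs) (false ∷ c) = lin vs c
lin (v ∷ vs) (true ∷ c) = v +v lin vs c

lin-linear : ∀ {n m} (vs : Vec (Vector n) m) → Linear (lin vs)
lin-linear [] [] [] = sym (+v-self 0v)
lin-linear (v ∷ vs) (false ∷ c) (false ∷ d) = lin-linear vs c d
lin-linear (v ∷ vs) (false ∷ c) (true ∷ d) = begin
  v +v lin vs (c +v d) ≡⟨ cong (v +v_) (lin-linear vs c d) ⟩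
  v +v (lin vs c +v lin vs d) ≡⟨ +v-assoc v (lin vs c) (lin vs d) ⟨
  (v +v lin vs c) +v lin vs d ≡⟨ cong (_+v lin vs d) (+v-comm v (lin vs c)) ⟩
  (lin vs c +v v) +v lin vs d ≡⟨ +v-assoc (lin vs c) v (lin vs d) ⟩
  lin vs c +v (v +v lin vs d) ∎
lin-linear (v ∷ vs) (true ∷ c) (false ∷ d) = begin
  v +v lin vs (c +v d) ≡⟨ cong (v +v_) (lin-linear vs c d) ⟩
  v +v (lin vs c +v lin vs d) ≡⟨ +v-assoc v (lin vs c) (lin vs d) ⟨
  (v +v lin vs c) +v lin vs d ∎
lin-linear (v ∷ vs) (true ∷ c) (true ∷ d) = begin
  lin vs (c +v d) ≡⟨ lin-linear vs c d ⟩
  lin vs c +v lin vs d ≡⟨ +v-identityˡ _ ⟨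
  0v +v (lin vs c +v lin vs d) ≡⟨ cong (_+v (lin vs c +v lin vs d)) (+v-self v) ⟨
  (v +v v) +v (lin vs c +v lin vs d) ≡⟨ +v-swap v v (lin vs c) (lin vs d) ⟩
  (v +v lin vs c) +v (v +v lin vs d) ∎

linear-0 : ∀ {m n} (φ : Vector m → Vector n) → Linear φ → φ 0v ≡ 0v
linear-0 φ L = begin
  φ 0v ≡⟨ cong φ (+v-self 0v) ⟨
  φ (0v +v 0v) ≡⟨ L 0v 0v ⟩
  φ 0v +v φ 0v ≡⟨ +v-self (φ 0v) ⟩
  0v ∎

linear-lin : ∀ {m n k} (φ : Vector m → Vector n) → Linear φ → (vs : Vec (Vector m) k) →
             ∀ c → φ (lin vs c) ≡ lin (map φ vs) c
linear-lin φ L [] [] = linear-0 φ L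
linear-lin φ L (v ∷ vs) (false ∷ c) = linear-lin φ L vs c
linear-lin φ L (v ∷ vs) (true ∷ c) = trans (L v (lin vs c)) (cong (φ v +v_) (linear-lin φ L vs c))

∘-linear : ∀ {l m n} {φ : Vector m → Vector n} {χ : Vector l → Vector m} →
           Linear φ → Linear χ → Linear (φ ∘ χ)
∘-linear {φ = φ} {χ} Lφ Lχ x y = trans (cong φ (Lχ x y)) (Lφ (χ x) (χ y))

-- A solver for linear identities over F₂

data Expr (m : ℕ) : Set where
  var : Fin m → Expr m
  _⊕_ : Expr m → Expr m → Expr m
  𝟘 : Expr m

infixl 6 _⊕_

⟦_⟧ : ∀ {n m} → Expr m → Vec (Vector n) m → Vector n
⟦ var i ⟧ vs = lookup vs i
⟦ d ⊕ e ⟧ vs = ⟦ d ⟧ vs +v ⟦ e ⟧ vs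
⟦ 𝟘 ⟧ vs = 0v

unit : ∀ {m} → Fin m → Vector m
unit zero = true ∷ 0v
unit (suc i) = false ∷ unit i

norm : ∀ {m} → Expr m → Vector m
norm (var i) = unit i
norm (d ⊕ e) = norm d +v norm e
norm 𝟘 = 0v

lin-0 : ∀ {n m} (vs : Vec (Vector n) m) → lin vs 0v ≡ 0v
lin-0 vs = linear-0 (lin vs) (lin-linear vs)

lin-unit : ∀ {n m} (vs : Vec (Vector n) m) i → lin vs (unit i) ≡ lookup vs i
lin-unit (v ∷ vs) zero = trans (cong (v +v_) (lin-0 vs)) (+v-identityʳ v)
lin-unit (v ∷ vs) (suc i) = lin-unit vs i

norm-correct : ∀ {n m} (vs : Vec (Vector n) m) e → lin vs (norm e) ≡ ⟦ e ⟧ vs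
norm-correct vs (var i) = lin-unit vs i
norm-correct vs (d ⊕ e) = trans (lin-linear vs (norm d) (norm e))
                                (cong₂ _+v_ (norm-correct vs d) (norm-correct vs e))
norm-correct vs 𝟘 = lin-0 vs

-- Only the parity of each variable matters, so two formal sums agree under every substitution once
-- their coefficient vectors agree, which `refl` settles for closed expressions.
solve : ∀ {n m} (vs : Vec (Vector n) m) (d e : Expr m) → norm d ≡ norm e → ⟦ d ⟧ vs ≡ ⟦ e ⟧ vs
solve vs d e eq = trans (sym (norm-correct vs d)) (trans (cong (lin vs) eq) (norm-correct vs e))

v₀ : ∀ {m} → Expr (suc m)
v₀ = var zero

v₁ : ∀ {m} → Expr (suc (suc m))
v₁ = var (suc zero)

v₂ : ∀ {m} → Expr (suc (suc (suc m)))
v₂ = var (suc (suc zero))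

v₃ : ∀ {m} → Expr (suc (suc (suc (suc m))))
v₃ = var (suc (suc (suc zero)))

v₄ : ∀ {m} → Expr (suc (suc (suc (suc (suc m)))))
v₄ = var (suc (suc (suc (suc zero))))

v₅ : ∀ {m} → Expr (suc (suc (suc (suc (suc (suc m))))))
v₅ = var (suc (suc (suc (suc (suc zero)))))

cancel : ∀ {n} (u v : Vector n) → (u +v v) +v v ≡ u
cancel u v = solve (u ∷ v ∷ []) (v₀ ⊕ v₁ ⊕ v₁) v₀ refl

cancelˡ : ∀ {n} (u v : Vector n) → u +v (u +v v) ≡ v
cancelˡ u v = solve (u ∷ v ∷ []) (v₀ ⊕ (v₀ ⊕ v₁)) v₁ refl

+v≡0⇒≡ : ∀ {n} (u v : Vector n) → u +v v ≡ 0v → u ≡ v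
+v≡0⇒≡ u v eq = trans (sym (cancel u v)) (trans (cong (_+v v) eq) (+v-identityˡ v))

isZero-0v : ∀ n → isZero (0v {n}) ≡ true
isZero-0v zero = refl
isZero-0v (suc n) = isZero-0v n

isZero⇒≡ : ∀ {n} (v : Vector n) → isZero v ≡ true → v ≡ 0v
isZero⇒≡ [] _ = refl
isZero⇒≡ (false ∷ v) eq = cong (false ∷_) (isZero⇒≡ v eq)

≢⇒isZero : ∀ {n} (v : Vector n) → ¬ v ≡ 0v → isZero v ≡ false
≢⇒isZero v v≢0 with isZero v in eq
... | true = ⊥-elim (v≢0 (isZero⇒≡ v eq))
... | false = refl

isZero⇒≢ : ∀ {n} (v : Vector n) → isZero v ≡ false → ¬ v ≡ 0v
isZero⇒≢ {n} v nz refl with trans (sym nz) (isZero-0v n)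
... | ()

++-+v : ∀ {m n} (u u′ : Vector m) (w w′ : Vector n) → (u ++ w) +v (u′ ++ w′) ≡ (u +v u′) ++ (w +v w′)
++-+v [] [] w w′ = refl
++-+v (b ∷ u) (c ∷ u′) w w′ = cong ((b xor c) ∷_) (++-+v u u′ w w′)

false≢true : ∀ {A : Set} {b : Bool} → b ≡ false → b ≡ true → A
false≢true refl ()

-- Exhaustive search over finite vector spaces

all? : ∀ {n} {P : Vector n → Set} → (∀ v → Dec (P v)) → Dec (∀ v → P v)
all? {zero} P? with P? []
... | yes p = yes λ { [] → p }
... | no ¬p = no λ h → ¬p (h [])
all? {suc n} P? with all? (P? ∘ (false ∷_)) | all? (P? ∘ (true ∷_))
... | yes p | yes q = yes λ { (false ∷ v) → p v ; (true ∷ v) → q v }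
... | no ¬p | _ = no λ h → ¬p (λ v → h (false ∷ v))
... | _ | no ¬q = no λ h → ¬q (λ v → h (true ∷ v))

any? : ∀ {n} {P : Vector n → Set} → (∀ v → Dec (P v)) → Dec (∃[ v ] P v)
any? {zero} P? with P? []
... | yes p = yes ([] , p)
... | no ¬p = no λ { ([] , p) → ¬p p }
any? {suc n} P? with any? (P? ∘ (false ∷_)) | any? (P? ∘ (true ∷_))
... | yes (v , p) | _ = yes (false ∷ v , p)
... | _ | yes (v , p) = yes (true ∷ v , p)
... | no ¬p | no ¬q = no λ { (false ∷ v , p) → ¬p (v , p) ; (true ∷ v , p) → ¬q (v , p) }

anyVec? : ∀ {n d} {P : Vec (Vector n) d → Set} → (∀ vs → Dec (P vs)) → Dec (∃[ vs ] P vs)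
anyVec? {d = zero} P? with P? []
... | yes p = yes ([] , p)
... | no ¬p = no λ { ([] , p) → ¬p p }
anyVec? {d = suc d} P? with any? (λ v → anyVec? (λ vs → P? (v ∷ vs)))
... | yes (v , vs , p) = yes (v ∷ vs , p)
... | no ¬p = no λ { (v ∷ vs , p) → ¬p (v , vs , p) }

_≟b_ : (a b : Bool) → Dec (a ≡ b)
false ≟b false = yes refl
false ≟b true = no λ ()
true ≟b false = no λ ()
true ≟b true = yes refl

-- Certified local arguments

-- For independent x, y, z this excludes the claw with basis x, y, z. Dependent triples are
-- included, where it follows from `f 0v ≡ false`; hence it is preserved by composition with any
-- linear map.
CF : ∀ {n} → (Vector n → Bool) → Set
CF f = ∀ x y z → f x ≡ true → f y ≡ true → f z ≡ true →
       f (x +v y) ≡ false → f (y +v z) ≡ false → f (x +v z) ≡ false → f (x +v y +v z) ≡ true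

-- No plane meets the ground set in exactly five points: such a plane has
-- complement {p, q}, and its ground set is {p + q} ∪ (x + ⟨p, q⟩).
No5 : ∀ {n} → (Vector n → Bool) → Set
No5 f = ∀ x p q → f p ≡ false → f q ≡ false → f (p +v q) ≡ true →
        f x ≡ true → f (x +v p) ≡ true → f (x +v q) ≡ true → f (x +v p +v q) ≡ false

CF-∘ : ∀ {m n} (f : Vector n → Bool) (φ : Vector m → Vector n) → Linear φ → CF f → CF (f ∘ φ)
CF-∘ f φ L cf x y z fx fy fz fxy fyz fxz =
  trans (cong f (trans (L (x +v y) z) (cong (_+v φ z) (L x y))))
        (cf (φ x) (φ y) (φ z) fx fy fz (trans (cong f (sym (L x y))) fxy)
            (trans (cong f (sym (L y z))) fyz) (trans (cong f (sym (L x z))) fxz))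

No5-∘ : ∀ {m n} (f : Vector n → Bool) (φ : Vector m → Vector n) → Linear φ → No5 f → No5 (f ∘ φ)
No5-∘ f φ L n5 x p q fp fq fpq fx fxp fxq =
  trans (cong f (trans (L (x +v p) q) (cong (_+v φ q) (L x p))))
        (n5 (φ x) (φ p) (φ q) fp fq (trans (cong f (sym (L p q))) fpq) fx
            (trans (cong f (sym (L x p))) fxp) (trans (cong f (sym (L x q))) fxq))

-- Certificates for statements about the values of f on the span of a few
-- vectors: decision trees whose leaves are violated instances of CF (basis) or of
-- No5 (five), or partial valuations satisfying a disjunct of the goal (goal).
-- The coordinate vector of a linear combination is encoded in binary, and the trees
-- below were found by a computer search.
data Tree : Set where
  split : ℕ → Tree → Tree → Tree
  basis : ℕ → ℕ → ℕ → Tree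
  five : ℕ → ℕ → ℕ → Tree
  goal : Tree

bits : (m : ℕ) → ℕ → Vector m
bits zero _ = []
bits (suc m) k = (k % 2 ≡ᵇ 1) ∷ bits m (k / 2)

-- Partial valuations are binary tries indexed by coordinates, so look-up and update recurse on the
-- vector and the checker runs by evaluation.
Val : ℕ → Set
Val zero = Maybe Bool
Val (suc m) = Val m × Val m

get : ∀ {m} → Val m → Vector m → Maybe Bool
get a [] = a
get (a , b) (false ∷ i) = get a i
get (a , b) (true ∷ i) = get b i

set : ∀ {m} → Val m → Vector m → Bool → Val m
set a [] c = just c
set (a , b) (false ∷ i) c = set a i c , b
set (a , b) (true ∷ i) c = a , set b i c

∅ : ∀ {m} → Val m
∅ {zero} = nothing
∅ {suc m} = ∅ , ∅

Agrees : ∀ {m} → (Vector m → Bool) → Val m → Set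
Agrees g a = ∀ i {b} → get a i ≡ just b → g i ≡ b

agrees-∅ : ∀ {m} (g : Vector m → Bool) → Agrees g ∅
agrees-∅ {suc m} g (false ∷ i) = agrees-∅ (g ∘ (false ∷_)) i
agrees-∅ {suc m} g (true ∷ i) = agrees-∅ (g ∘ (true ∷_)) i

agrees-set : ∀ {m} (g : Vector m → Bool) a i {b} → g i ≡ b → Agrees g a → Agrees g (set a i b)
agrees-set g a [] gi ag [] refl = gi
agrees-set g (a , b) (false ∷ i) gi ag (false ∷ j) =
  agrees-set (g ∘ (false ∷_)) a i gi (ag ∘ (false ∷_)) j
agrees-set g (a , b) (false ∷ i) gi ag (true ∷ j) = ag (true ∷ j)
agrees-set g (a , b) (true ∷ i) gi ag (false ∷ j) = ag (false ∷ j)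
agrees-set g (a , b) (true ∷ i) gi ag (true ∷ j) =
  agrees-set (g ∘ (true ∷_)) b i gi (ag ∘ (true ∷_)) j

hasValue : Maybe Bool → Bool → Bool
hasValue (just true) true = true
hasValue (just false) false = true
hasValue _ _ = false

hasValue-sound : ∀ c b → hasValue c b ≡ true → c ≡ just b
hasValue-sound (just true) true _ = refl
hasValue-sound (just false) false _ = refl
hasValue-sound (just true) false ()
hasValue-sound (just false) true ()

Lits : Set → Set
Lits I = List (I × Bool)

module _ {I : Set} (g : I → Bool) where

  -- The singleton case is separate so that a list of literals unfolds to a plain nested pair
  -- without a trailing unit; callers can pass and match ordinary tuples.
  Holds : Lits I → Set
  Holds [] = ⊤
  Holds ((i , b) ∷ []) = g i ≡ b
  Holds ((i , b) ∷ ls@(_ ∷ _)) = (g i ≡ b) × Holds ls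

  HoldsSome : List (Lits I) → Set
  HoldsSome [] = ⊥
  HoldsSome (ls ∷ []) = Holds ls
  HoldsSome (ls ∷ gs@(_ ∷ _)) = Holds ls ⊎ HoldsSome gs

  holds-head : ∀ {i b} ls → Holds ((i , b) ∷ ls) → g i ≡ b
  holds-head [] h = h
  holds-head (_ ∷ _) (h , _) = h

  holds-tail : ∀ {i b} ls → Holds ((i , b) ∷ ls) → Holds ls
  holds-tail [] _ = tt
  holds-tail (_ ∷ _) (_ , h) = h

  holds-∷ : ∀ {i b} ls → g i ≡ b → Holds ls → Holds ((i , b) ∷ ls)
  holds-∷ [] p _ = p
  holds-∷ (_ ∷ _) p h = p , h

  holds-++ : ∀ ls ms → Holds ls → Holds ms → Holds (ls ++ₗ ms)
  holds-++ [] ms _ h = h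
  holds-++ ((i , b) ∷ ls) ms h k = holds-∷ (ls ++ₗ ms) (holds-head ls h) (holds-++ ls ms (holds-tail ls h) k)

  holds-++ˡ : ∀ ls ms → Holds (ls ++ₗ ms) → Holds ls
  holds-++ˡ [] ms _ = tt
  holds-++ˡ ((i , b) ∷ ls) ms h =
    holds-∷ ls (holds-head (ls ++ₗ ms) h) (holds-++ˡ ls ms (holds-tail (ls ++ₗ ms) h))

  holds-++ʳ : ∀ ls ms → Holds (ls ++ₗ ms) → Holds ms
  holds-++ʳ [] ms h = h
  holds-++ʳ ((i , b) ∷ ls) ms h = holds-++ʳ ls ms (holds-tail (ls ++ₗ ms) h)

  holdsSome-here : ∀ ls gs → Holds ls → HoldsSome (ls ∷ gs)
  holdsSome-here ls [] h = h
  holdsSome-here ls (_ ∷ _) h = inj₁ h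

  holdsSome-there : ∀ ls gs → HoldsSome gs → HoldsSome (ls ∷ gs)
  holdsSome-there ls (_ ∷ _) h = inj₂ h

every : ∀ {I : Set} {k} → (Vector k → I × Bool) → Lits I
every {k = zero} h = h [] ∷ []
every {k = suc k} h = every (h ∘ (false ∷_)) ++ₗ every (h ∘ (true ∷_))

holds-every : ∀ {I : Set} (g : I → Bool) {k} (h : Vector k → I × Bool) →
              (∀ t → g (proj₁ (h t)) ≡ proj₂ (h t)) → Holds g (every h)
holds-every g {zero} h p = p []
holds-every g {suc k} h p =
  holds-++ g (every (h ∘ (false ∷_))) _ (holds-every g (h ∘ (false ∷_)) (p ∘ (false ∷_)))
                                        (holds-every g (h ∘ (true ∷_)) (p ∘ (true ∷_)))

every-holds : ∀ {I : Set} (g : I → Bool) {k} (h : Vector k → I × Bool) → Holds g (every h) →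
              ∀ t → g (proj₁ (h t)) ≡ proj₂ (h t)
every-holds g {zero} h p [] = p
every-holds g {suc k} h p (false ∷ t) =
  every-holds g (h ∘ (false ∷_)) (holds-++ˡ g (every (h ∘ (false ∷_))) _ p) t
every-holds g {suc k} h p (true ∷ t) =
  every-holds g (h ∘ (true ∷_)) (holds-++ʳ g (every (h ∘ (false ∷_))) _ p) t

assign : ∀ {m} → Val m → Lits (Vector m) → Val m
assign a [] = a
assign a ((i , b) ∷ ls) = assign (set a i b) ls

agrees-assign : ∀ {m} (g : Vector m → Bool) a ls → Holds g ls → Agrees g a → Agrees g (assign a ls)
agrees-assign g a [] _ ag = ag
agrees-assign g a ((i , b) ∷ ls) h ag =
  agrees-assign g (set a i b) ls (holds-tail g ls h) (agrees-set g a i (holds-head g ls h) ag)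

is : ∀ {m} → Val m → Vector m → Bool → Bool
is a i b = hasValue (get a i) b

satisfied : ∀ {m} → Val m → Lits (Vector m) → Bool
satisfied a [] = true
satisfied a ((i , b) ∷ ls) = is a i b ∧ satisfied a ls

someSatisfied : ∀ {m} → Val m → List (Lits (Vector m)) → Bool
someSatisfied a [] = false
someSatisfied a (ls ∷ gs) = satisfied a ls ∨ someSatisfied a gs

-- A leaf counts only if every value it refers to is already determined. The flag `w` admits `five`
-- leaves, so one checker serves with and without `No5`.
check : ∀ {m} → Bool → List (Lits (Vector m)) → Val m → Tree → Bool
check w gs a (split k t u) =
  check w gs (set a (bits _ k) false) t ∧ check w gs (set a (bits _ k) true) u
check {m} w gs a (basis k l r) =
  let x = bits m k ; y = bits m l ; z = bits m r in
  is a x true ∧ is a y true ∧ is a z true ∧ is a (x +v y) false ∧ is a (y +v z) false ∧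
  is a (x +v z) false ∧ is a (x +v y +v z) false
check {m} w gs a (five k l r) =
  let x = bits m k ; p = bits m l ; q = bits m r in
  w ∧ is a p false ∧ is a q false ∧ is a (p +v q) true ∧ is a x true ∧ is a (x +v p) true ∧
  is a (x +v q) true ∧ is a (x +v p +v q) true
check w gs a goal = someSatisfied a gs

∧-left : ∀ a {b} → a ∧ b ≡ true → a ≡ true
∧-left true _ = refl

∧-right : ∀ a {b} → a ∧ b ≡ true → b ≡ true
∧-right true h = h

is-sound : ∀ {m} (g : Vector m → Bool) a i b → Agrees g a → is a i b ≡ true → g i ≡ b
is-sound g a i b ag h = ag i (hasValue-sound (get a i) b h)

satisfied-sound : ∀ {m} (g : Vector m → Bool) a → Agrees g a → ∀ ls → satisfied a ls ≡ true → Holds g ls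
satisfied-sound g a ag [] _ = tt
satisfied-sound g a ag ((i , b) ∷ ls) h =
  holds-∷ g ls (is-sound g a i b ag (∧-left (is a i b) h)) (satisfied-sound g a ag ls (∧-right (is a i b) h))

someSatisfied-sound : ∀ {m} (g : Vector m → Bool) a → Agrees g a → ∀ gs →
                      someSatisfied a gs ≡ true → HoldsSome g gs
someSatisfied-sound g a ag (ls ∷ gs) h with satisfied a ls in eq
... | true = holdsSome-here g ls gs (satisfied-sound g a ag ls eq)
... | false = holdsSome-there g ls gs (someSatisfied-sound g a ag gs h)

module _ {m : ℕ} (w : Bool) (gs : List (Lits (Vector m))) (g : Vector m → Bool)
         (cf : CF g) (n5 : w ≡ true → No5 g) where

  check-sound : ∀ a t → Agrees g a → check w gs a t ≡ true → HoldsSome g gs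
  check-sound a (split k t u) ag h with g (bits m k) in eq
  ... | false = check-sound _ t (agrees-set g a (bits m k) eq ag) (∧-left (check w gs _ t) h)
  ... | true = check-sound _ u (agrees-set g a (bits m k) eq ag) (∧-right (check w gs _ t) h)
  check-sound a (basis k l r) ag h =
    let x = bits m k ; y = bits m l ; z = bits m r
        s : ∀ i b → is a i b ≡ true → g i ≡ b
        s i b = is-sound g a i b ag
        h₁ = ∧-right (is a x true) h
        h₂ = ∧-right (is a y true) h₁
        h₃ = ∧-right (is a z true) h₂
        h₄ = ∧-right (is a (x +v y) false) h₃
        h₅ = ∧-right (is a (y +v z) false) h₄
        h₆ = ∧-right (is a (x +v z) false) h₅
    in false≢true (s (x +v y +v z) false h₆)
         (cf x y z (s x true (∧-left (is a x true) h)) (s y true (∧-left (is a y true) h₁))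
             (s z true (∧-left (is a z true) h₂)) (s (x +v y) false (∧-left (is a (x +v y) false) h₃))
             (s (y +v z) false (∧-left (is a (y +v z) false) h₄))
             (s (x +v z) false (∧-left (is a (x +v z) false) h₅)))
  check-sound a (five k l r) ag h =
    let x = bits m k ; p = bits m l ; q = bits m r
        s : ∀ i b → is a i b ≡ true → g i ≡ b
        s i b = is-sound g a i b ag
        h₀ = ∧-right w h
        h₁ = ∧-right (is a p false) h₀
        h₂ = ∧-right (is a q false) h₁
        h₃ = ∧-right (is a (p +v q) true) h₂
        h₄ = ∧-right (is a x true) h₃
        h₅ = ∧-right (is a (x +v p) true) h₄
        h₆ = ∧-right (is a (x +v q) true) h₅
    in false≢true
         (n5 (∧-left w h) x p q (s p false (∧-left (is a p false) h₀))
             (s q false (∧-left (is a q false) h₁)) (s (p +v q) true (∧-left (is a (p +v q) true) h₂))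
             (s x true (∧-left (is a x true) h₃)) (s (x +v p) true (∧-left (is a (x +v p) true) h₄))
             (s (x +v q) true (∧-left (is a (x +v q) true) h₅)))
         (s (x +v p +v q) true h₆)
  check-sound a goal ag h = someSatisfied-sound g a ag gs h

certified : ∀ {m} (as : Lits (Vector m)) (gs : List (Lits (Vector m))) (t : Tree) →
            check false gs (assign ∅ as) t ≡ true →
            (g : Vector m → Bool) → CF g → Holds g as → HoldsSome g gs
certified as gs t ok g cf h =
  check-sound false gs g cf (λ ()) (assign ∅ as) t (agrees-assign g ∅ as h (agrees-∅ g)) ok

normL : ∀ {m} → Lits (Expr m) → Lits (Vector m)
normL = mapₗ λ { (e , b) → norm e , b }

module _ {n m : ℕ} (f : Vector n → Bool) (vs : Vec (Vector n) m) where

  private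
    g : Vector m → Bool
    g c = f (lin vs c)

    e : Expr m → Bool
    e d = f (⟦ d ⟧ vs)

  to-norm : ∀ ls → Holds e ls → Holds g (normL ls)
  to-norm [] _ = tt
  to-norm ((d , b) ∷ ls) h =
    holds-∷ g (normL ls) (trans (cong f (norm-correct vs d)) (holds-head e ls h))
            (to-norm ls (holds-tail e ls h))

  from-norm : ∀ ls → Holds g (normL ls) → Holds e ls
  from-norm [] _ = tt
  from-norm ((d , b) ∷ ls) h =
    holds-∷ e ls (trans (cong f (sym (norm-correct vs d))) (holds-head g (normL ls) h))
            (from-norm ls (holds-tail g (normL ls) h))

  from-normSome : ∀ gs → HoldsSome g (mapₗ normL gs) → HoldsSome e gs
  from-normSome (ls ∷ []) h = from-norm ls h
  from-normSome (ls ∷ ms ∷ gs) (inj₁ h) = inj₁ (from-norm ls h)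
  from-normSome (ls ∷ ms ∷ gs) (inj₂ h) = inj₂ (from-normSome (ms ∷ gs) h)

certifiedᵥ : ∀ {m} (w : Bool) (as : Lits (Expr m)) (gs : List (Lits (Vector m))) (t : Tree) →
             check w gs (assign ∅ ((0v , false) ∷ normL as)) t ≡ true →
             ∀ {n} (f : Vector n → Bool) → f 0v ≡ false → CF f → (w ≡ true → No5 f) →
             (vs : Vec (Vector n) m) → Holds (λ d → f (⟦ d ⟧ vs)) as →
             HoldsSome (λ c → f (lin vs c)) gs
certifiedᵥ w as gs t ok f f0 cf n5 vs h =
  check-sound w gs (λ c → f (lin vs c)) (CF-∘ f (lin vs) (lin-linear vs) cf)
    (λ eq → No5-∘ f (lin vs) (lin-linear vs) (n5 eq)) _ t
    (agrees-assign _ ∅ ((0v , false) ∷ normL as)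
       (holds-∷ _ (normL as) (trans (cong f (lin-0 vs)) f0) (to-norm f vs as h)) (agrees-∅ _))
    ok

certifiedₑ : ∀ {m} (w : Bool) (as : Lits (Expr m)) (gs : List (Lits (Expr m))) (t : Tree) →
             check w (mapₗ normL gs) (assign ∅ ((0v , false) ∷ normL as)) t ≡ true →
             ∀ {n} (f : Vector n → Bool) → f 0v ≡ false → CF f → (w ≡ true → No5 f) →
             (vs : Vec (Vector n) m) → Holds (λ d → f (⟦ d ⟧ vs)) as →
             HoldsSome (λ d → f (⟦ d ⟧ vs)) gs
certifiedₑ w as gs t ok f f0 cf n5 vs h =
  from-normSome f vs gs (certifiedᵥ w as (mapₗ normL gs) t ok f f0 cf n5 vs h)

holds? : ∀ {I : Set} (g : I → Bool) (ls : Lits I) → Dec (Holds g ls)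
holds? g [] = yes tt
holds? g ((i , b) ∷ []) = g i ≟b b
holds? g ((i , b) ∷ ls@(_ ∷ _)) = (g i ≟b b) ×-dec holds? g ls

-- Subspaces

-- The subspaces below arise as stabilisers and sets of zeros, for which a decidable predicate is at
-- hand but no basis; `splitting` supplies coordinates afterwards.
record Subspace (n : ℕ) : Set₁ where
  field
    In : Vector n → Set
    in? : ∀ v → Dec (In v)
    in-0 : In 0v
    in-+ : ∀ {u v} → In u → In v → In (u +v v)

  in-cancel : ∀ {u v} → In (u +v v) → In v → In u
  in-cancel {u} {v} p q = subst In (cancel u v) (in-+ p q)

open Subspace public

pullback : ∀ {m n} → Subspace n → (φ : Vector m → Vector n) → Linear φ → Subspace m
pullback K φ L .In v = In K (φ v)
pullback K φ L .in? v = in? K (φ v)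
pullback K φ L .in-0 = subst (In K) (sym (linear-0 φ L)) (in-0 K)
pullback K φ L .in-+ {u} {v} p q = subst (In K) (sym (L u v)) (in-+ K p q)

_·_ : ∀ {n} → Bool → Vector n → Vector n
false · v = 0v
true · v = v

infixr 7 _·_

·-xor : ∀ {n} a b (v : Vector n) → (a xor b) · v ≡ a · v +v b · v
·-xor false b v = sym (+v-identityˡ (b · v))
·-xor true false v = sym (+v-identityʳ v)
·-xor true true v = sym (+v-self v)

-- Coordinates for the whole space as a direct sum: `ι` parametrises K, `κ` a complement, and `π₁`,
-- `π₂` read off the two components.
record Splitting {n} (K : Subspace n) : Set where
  field
    {d c} : ℕ
    dims : d + c ≡ n
    ι : Vector d → Vector n
    κ : Vector c → Vector n
    π₁ : Vector n → Vector d
    π₂ : Vector n → Vector c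
    ι-linear : Linear ι
    κ-linear : Linear κ
    π₁-linear : Linear π₁
    π₂-linear : Linear π₂
    recombine : ∀ v → ι (π₁ v) +v κ (π₂ v) ≡ v
    π₁-recombine : ∀ u w → π₁ (ι u +v κ w) ≡ u
    π₂-recombine : ∀ u w → π₂ (ι u +v κ w) ≡ w
    ι-in : ∀ u → In K (ι u)
    in⇒π₂≡0 : ∀ v → In K v → π₂ v ≡ 0v

  π₁-ι : ∀ u → π₁ (ι u) ≡ u
  π₁-ι u = begin
    π₁ (ι u) ≡⟨ cong π₁ (+v-identityʳ (ι u)) ⟨
    π₁ (ι u +v 0v) ≡⟨ cong (λ z → π₁ (ι u +v z)) (linear-0 κ κ-linear) ⟨
    π₁ (ι u +v κ 0v) ≡⟨ π₁-recombine u 0v ⟩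
    u ∎

  π₂-κ : ∀ w → π₂ (κ w) ≡ w
  π₂-κ w = begin
    π₂ (κ w) ≡⟨ cong π₂ (+v-identityˡ (κ w)) ⟨
    π₂ (0v +v κ w) ≡⟨ cong (λ z → π₂ (z +v κ w)) (linear-0 ι ι-linear) ⟨
    π₂ (ι 0v +v κ w) ≡⟨ π₂-recombine 0v w ⟩
    w ∎

  κ-in⇒≡0 : ∀ w → In K (κ w) → w ≡ 0v
  κ-in⇒≡0 w p = trans (sym (π₂-κ w)) (in⇒π₂≡0 (κ w) p)

  in⇒ι : ∀ v → In K v → ι (π₁ v) ≡ v
  in⇒ι v p = begin
    ι (π₁ v) ≡⟨ +v-identityʳ _ ⟨
    ι (π₁ v) +v 0v ≡⟨ cong (ι (π₁ v) +v_) (linear-0 κ κ-linear) ⟨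
    ι (π₁ v) +v κ 0v ≡⟨ cong (λ z → ι (π₁ v) +v κ z) (in⇒π₂≡0 v p) ⟨
    ι (π₁ v) +v κ (π₂ v) ≡⟨ recombine v ⟩
    v ∎

  π₂≡0⇒in : ∀ v → π₂ v ≡ 0v → In K v
  π₂≡0⇒in v eq = subst (In K) (begin
    ι (π₁ v) ≡⟨ +v-identityʳ _ ⟨
    ι (π₁ v) +v 0v ≡⟨ cong (ι (π₁ v) +v_) (linear-0 κ κ-linear) ⟨
    ι (π₁ v) +v κ 0v ≡⟨ cong (λ z → ι (π₁ v) +v κ z) eq ⟨
    ι (π₁ v) +v κ (π₂ v) ≡⟨ recombine v ⟩
    v ∎) (ι-in (π₁ v))

-- Gaussian elimination on the leading coordinate. The part of K with leading coordinate 0 is split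
-- recursively; if K has a vector `true ∷ u`, it becomes a new basis vector of K and is subtracted
-- wherever the leading coordinate is 1, otherwise the first unit vector joins the complement.
splitting : ∀ {n} (K : Subspace n) → Splitting K
splitting {zero} K = record
  { d = 0 ; c = 0 ; dims = refl ; ι = id ; κ = id ; π₁ = id ; π₂ = id
  ; ι-linear = λ _ _ → refl ; κ-linear = λ _ _ → refl ; π₁-linear = λ _ _ → refl
  ; π₂-linear = λ _ _ → refl
  ; recombine = λ { [] → refl } ; π₁-recombine = λ { [] [] → refl }
  ; π₂-recombine = λ { [] [] → refl } ; ι-in = λ { [] → in-0 K } ; in⇒π₂≡0 = λ { [] _ → refl } }
splitting {suc n} K
  with splitting (pullback K (false ∷_) (λ _ _ → refl)) | any? (λ u → in? K (true ∷ u))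
... | S | no ¬u = record
  { d = S.d ; c = suc S.c ; dims = trans (+-suc S.d S.c) (cong suc S.dims)
  ; ι = λ y → false ∷ S.ι y
  ; κ = λ { (b ∷ w) → b ∷ S.κ w }
  ; π₁ = λ { (b ∷ v) → S.π₁ v }
  ; π₂ = λ { (b ∷ v) → b ∷ S.π₂ v }
  ; ι-linear = λ x y → cong (false ∷_) (S.ι-linear x y)
  ; κ-linear = λ { (a ∷ x) (b ∷ y) → cong ((a xor b) ∷_) (S.κ-linear x y) }
  ; π₁-linear = λ { (a ∷ x) (b ∷ y) → S.π₁-linear x y }
  ; π₂-linear = λ { (a ∷ x) (b ∷ y) → cong ((a xor b) ∷_) (S.π₂-linear x y) }
  ; recombine = λ { (b ∷ v) → cong (b ∷_) (S.recombine v) }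
  ; π₁-recombine = λ { u (b ∷ w) → S.π₁-recombine u w }
  ; π₂-recombine = λ { u (b ∷ w) → cong (b ∷_) (S.π₂-recombine u w) }
  ; ι-in = S.ι-in
  ; in⇒π₂≡0 = λ { (false ∷ v) p → cong (false ∷_) (S.in⇒π₂≡0 v p)
                ; (true ∷ v) p → ⊥-elim (¬u (v , p)) } }
  where module S = Splitting S
... | S | yes (u , Ku) = record
  { d = suc S.d ; c = S.c ; dims = cong suc S.dims
  ; ι = λ { (b ∷ y) → b ∷ (S.ι y +v b · u) }
  ; κ = λ w → false ∷ S.κ w
  ; π₁ = λ { (b ∷ v) → b ∷ S.π₁ (v +v b · u) }
  ; π₂ = λ { (b ∷ v) → S.π₂ (v +v b · u) }
  ; ι-linear = λ { (a ∷ x) (b ∷ y) → cong ((a xor b) ∷_)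
      (trans (cong₂ _+v_ (S.ι-linear x y) (·-xor a b u)) (+v-swap (S.ι x) (S.ι y) (a · u) (b · u))) }
  ; κ-linear = λ x y → cong (false ∷_) (S.κ-linear x y)
  ; π₁-linear = λ { (a ∷ x) (b ∷ y) → cong ((a xor b) ∷_)
      (trans (cong S.π₁ (shift a b x y)) (S.π₁-linear (x +v a · u) (y +v b · u))) }
  ; π₂-linear = λ { (a ∷ x) (b ∷ y) →
      trans (cong S.π₂ (shift a b x y)) (S.π₂-linear (x +v a · u) (y +v b · u)) }
  ; recombine = λ { (b ∷ v) → cong₂ _∷_ (xor-false b) (begin
      (S.ι (S.π₁ (v +v b · u)) +v b · u) +v S.κ (S.π₂ (v +v b · u)) ≡⟨
        solve (S.ι (S.π₁ (v +v b · u)) ∷ b · u ∷ S.κ (S.π₂ (v +v b · u)) ∷ [])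
              (v₀ ⊕ v₁ ⊕ v₂) (v₀ ⊕ v₂ ⊕ v₁) refl ⟩
      (S.ι (S.π₁ (v +v b · u)) +v S.κ (S.π₂ (v +v b · u))) +v b · u ≡⟨
        cong (_+v b · u) (S.recombine (v +v b · u)) ⟩
      (v +v b · u) +v b · u ≡⟨ cancel v (b · u) ⟩
      v ∎) }
  ; π₁-recombine = λ { (b ∷ y) w → trans
      (cong (λ z → z ∷ S.π₁ (((S.ι y +v b · u) +v S.κ w) +v z · u)) (xor-false b))
      (cong (b ∷_) (trans (cong S.π₁ (collect b y w)) (S.π₁-recombine y w))) }
  ; π₂-recombine = λ { (b ∷ y) w → trans
      (cong (λ z → S.π₂ (((S.ι y +v b · u) +v S.κ w) +v z · u)) (xor-false b))
      (trans (cong S.π₂ (collect b y w)) (S.π₂-recombine y w)) }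
  ; ι-in = λ { (false ∷ y) → subst (λ z → In K (false ∷ z)) (sym (+v-identityʳ (S.ι y))) (S.ι-in y)
             ; (true ∷ y) → in-+ K {false ∷ S.ι y} {true ∷ u} (S.ι-in y) Ku }
  ; in⇒π₂≡0 = λ { (false ∷ v) p → trans (cong S.π₂ (+v-identityʳ v)) (S.in⇒π₂≡0 v p)
                ; (true ∷ v) p → S.in⇒π₂≡0 (v +v u) (in-+ K {true ∷ v} {true ∷ u} p Ku) } }
  where
  module S = Splitting S
  xor-false : ∀ b → b xor false ≡ b
  xor-false false = refl
  xor-false true = refl
  shift : ∀ a b x y → (x +v y) +v (a xor b) · u ≡ (x +v a · u) +v (y +v b · u)
  shift a b x y = trans (cong ((x +v y) +v_) (·-xor a b u)) (+v-swap x y (a · u) (b · u))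
  collect : ∀ b y w → ((S.ι y +v b · u) +v S.κ w) +v b · u ≡ S.ι y +v S.κ w
  collect b y w = solve (S.ι y ∷ b · u ∷ S.κ w ∷ []) (v₀ ⊕ v₁ ⊕ v₂ ⊕ v₁) (v₀ ⊕ v₂) refl

-- Linear functionals, dimension by counting, and spans

Functional : ℕ → Set
Functional n = Vector n → Bool

LinearF : ∀ {n} → Functional n → Set
LinearF ϕ = ∀ x y → ϕ (x +v y) ≡ ϕ x xor ϕ y

coordinate : ∀ {c} (w : Vector c) → isZero w ≡ false → Σ (Functional c) λ ϕ → LinearF ϕ × ϕ w ≡ true
coordinate (true ∷ w) _ = (λ { (b ∷ _) → b }) , (λ { (_ ∷ _) (_ ∷ _) → refl }) , refl
coordinate (false ∷ w) nz with coordinate w nz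
... | ϕ , L , e = (λ { (_ ∷ v) → ϕ v }) , (λ { (_ ∷ x) (_ ∷ y) → L x y }) , e

LinearF-0 : ∀ {n} (ϕ : Functional n) → LinearF ϕ → ϕ 0v ≡ false
LinearF-0 ϕ L = trans (cong ϕ (sym (+v-self 0v))) (trans (L 0v 0v) (xor-same (ϕ 0v)))

-- The component of x in a complement of K is nonzero, and one of its coordinates gives the
-- functional.
separate : ∀ {n} (K : Subspace n) x → ¬ In K x →
           Σ (Functional n) λ ϕ → LinearF ϕ × (∀ v → In K v → ϕ v ≡ false) × ϕ x ≡ true
separate K x x∉K with coordinate (π₂ x) (≢⇒isZero (π₂ x) λ eq → x∉K (π₂≡0⇒in x eq))
  where open Splitting (splitting K)
... | ϕ , L , e =
  ϕ ∘ π₂ , (λ u v → trans (cong ϕ (π₂-linear u v)) (L (π₂ u) (π₂ v))) ,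
  (λ v p → trans (cong ϕ (in⇒π₂≡0 v p)) (LinearF-0 ϕ L)) , e
  where open Splitting (splitting K)

bit : Bool → Fin 2
bit false = zero
bit true = suc zero

unbit : Fin 2 → Bool
unbit zero = false
unbit (suc zero) = true

bit-unbit : ∀ i → bit (unbit i) ≡ i
bit-unbit zero = refl
bit-unbit (suc zero) = refl

unbit-bit : ∀ b → unbit (bit b) ≡ b
unbit-bit false = refl
unbit-bit true = refl

encode : ∀ {k} → Vector k → Fin (2 ^ k)
encode [] = zero
encode (b ∷ v) = combine (bit b) (encode v)

decode : ∀ {k} → Fin (2 ^ k) → Vector k
decode {zero} _ = []
decode {suc k} i = unbit (proj₁ (remQuot {2} (2 ^ k) i)) ∷ decode (proj₂ (remQuot {2} (2 ^ k) i))

decode-encode : ∀ {k} (v : Vector k) → decode (encode v) ≡ v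
decode-encode [] = refl
decode-encode {suc k} (b ∷ v) =
  cong₂ _∷_ (trans (cong (unbit ∘ proj₁) eq) (unbit-bit b))
            (trans (cong (decode ∘ proj₂) eq) (decode-encode v))
  where
  eq : remQuot {2} (2 ^ k) (combine (bit b) (encode v)) ≡ (bit b , encode v)
  eq = remQuot-combine {2} {2 ^ k} (bit b) (encode v)

encode-decode : ∀ {k} (i : Fin (2 ^ k)) → encode {k} (decode i) ≡ i
encode-decode {zero} zero = refl
encode-decode {suc k} i =
  trans (cong₂ combine (bit-unbit (proj₁ (remQuot {2} (2 ^ k) i))) (encode-decode {k} _))
        (combine-remQuot {2} (2 ^ k) i)

encode-injective : ∀ {k} {u v : Vector k} → encode u ≡ encode v → u ≡ v
encode-injective {u = u} {v} eq =
  trans (sym (decode-encode u)) (trans (cong decode eq) (decode-encode v))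

-- Dimensions are compared by cardinality: an injection between the spaces gives 2^m ≤ 2^k.
trivial-kernel⇒≤ : ∀ {m k} (φ : Vector m → Vector k) → Linear φ → (∀ v → φ v ≡ 0v → v ≡ 0v) → m ≤ k
trivial-kernel⇒≤ {m} {k} φ L ker with m ≤? k
... | yes m≤k = m≤k
... | no m≰k = ⊥-elim (<⇒≱ (^-monoʳ-< 2 (s≤s (s≤s z≤n)) (≰⇒> m≰k)) (injective⇒≤ {f = encode ∘ φ ∘ decode} code-injective))
  where
  code-injective : ∀ {i j} → encode (φ (decode i)) ≡ encode (φ (decode j)) → i ≡ j
  code-injective {i} {j} eq = begin
    i ≡⟨ encode-decode {m} i ⟨
    encode (decode {m} i) ≡⟨ cong encode (+v≡0⇒≡ (decode i) (decode j) (ker _ (begin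
      φ (decode i +v decode j) ≡⟨ L (decode i) (decode j) ⟩
      φ (decode i) +v φ (decode j) ≡⟨ cong (_+v φ (decode j)) (encode-injective eq) ⟩
      φ (decode j) +v φ (decode j) ≡⟨ +v-self _ ⟩
      0v ∎))) ⟩
    encode (decode {m} j) ≡⟨ encode-decode {m} j ⟩
    j ∎

-- The coefficient of x is 0 or 1, so membership is a finite disjunction and is decidable by
-- recursion.
span : ∀ {n} → List (Vector n) → Vector n → Set
span [] v = v ≡ 0v
span (x ∷ xs) v = span xs v ⊎ span xs (v +v x)

span? : ∀ {n} (xs : List (Vector n)) v → Dec (span xs v)
span? [] v with isZero v in eq
... | true = yes (isZero⇒≡ v eq)
... | false = no (isZero⇒≢ v eq)
span? (x ∷ xs) v = span? xs v ⊎-dec span? xs (v +v x)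

span-0 : ∀ {n} (xs : List (Vector n)) → span xs 0v
span-0 [] = refl
span-0 (x ∷ xs) = inj₁ (span-0 xs)

span-+ : ∀ {n} (xs : List (Vector n)) {u v} → span xs u → span xs v → span xs (u +v v)
span-+ [] refl refl = +v-self 0v
span-+ (x ∷ xs) (inj₁ p) (inj₁ q) = inj₁ (span-+ xs p q)
span-+ (x ∷ xs) {u} {v} (inj₁ p) (inj₂ q) = inj₂ (subst (span xs) (sym (+v-assoc u v x)) (span-+ xs p q))
span-+ (x ∷ xs) {u} {v} (inj₂ p) (inj₁ q) =
  inj₂ (subst (span xs) (solve (u ∷ v ∷ x ∷ []) (v₀ ⊕ v₂ ⊕ v₁) (v₀ ⊕ v₁ ⊕ v₂) refl) (span-+ xs p q))
span-+ (x ∷ xs) {u} {v} (inj₂ p) (inj₂ q) =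
  inj₁ (subst (span xs) (solve (u ∷ v ∷ x ∷ []) (v₀ ⊕ v₂ ⊕ (v₁ ⊕ v₂)) (v₀ ⊕ v₁) refl) (span-+ xs p q))

⟨_⟩ : ∀ {n} → List (Vector n) → Subspace n
⟨ xs ⟩ = record { In = span xs ; in? = span? xs ; in-0 = span-0 xs ; in-+ = span-+ xs }

span-∈ : ∀ {n} (xs : List (Vector n)) {x} → x ∈ xs → span xs x
span-∈ (x ∷ xs) (here refl) = inj₂ (subst (span xs) (sym (+v-self x)) (span-0 xs))
span-∈ (x ∷ xs) (there p) = inj₁ (span-∈ xs p)

span-induction : ∀ {n} (P : Vector n → Set) (xs : List (Vector n)) → P 0v →
                 (∀ {x v} → x ∈ xs → P v → P (v +v x)) → ∀ v → span xs v → P v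
span-induction P [] p0 step v refl = p0
span-induction P (x ∷ xs) p0 step v (inj₁ p) = span-induction P xs p0 (step ∘ there) v p
span-induction P (x ∷ xs) p0 step v (inj₂ p) =
  subst P (cancel v x) (step (here refl) (span-induction P xs p0 (step ∘ there) (v +v x) p))

∈-allVecs : ∀ {n} (v : Vector n) → v ∈ allVecs n
∈-allVecs [] = here refl
∈-allVecs {suc n} (false ∷ v) = ∈-++⁺ˡ (∈-map⁺ (false ∷_) (∈-allVecs v))
∈-allVecs {suc n} (true ∷ v) = ∈-++⁺ʳ (mapₗ (false ∷_) (allVecs n)) (∈-map⁺ (true ∷_) (∈-allVecs v))

support : ∀ {n} → (Vector n → Bool) → List (Vector n)
support {n} f = filter (λ v → f v ≟b true) (allVecs n)

support⁺ : ∀ {n} (f : Vector n → Bool) {v} → f v ≡ true → v ∈ support f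
support⁺ f {v} = ∈-filter⁺ (λ v → f v ≟b true) (∈-allVecs v)

support⁻ : ∀ {n} (f : Vector n → Bool) {v} → v ∈ support f → f v ≡ true
support⁻ {n} f p = proj₂ (∈-filter⁻ (λ v → f v ≟b true) {xs = allVecs n} p)

-- Triangle-free complements

n<2^n : ∀ n → n < 2 ^ n
n<2^n zero = s≤s z≤n
n<2^n (suc n) = ≤-trans (s≤s (n<2^n n))
  (≤-trans (+-mono-≤ (m^n>0 2 n) (m≤m+n (2 ^ n) 0)) ≤-refl)

Independent : ∀ {n m} → Vec (Vector n) m → Set
Independent vs = ∀ t → isZero t ≡ false → ¬ lin vs t ≡ 0v

inˡ : ∀ {m} n → Vector m → Vector (m + n)
inˡ n u = u ++ 0v

inʳ : ∀ m {n} → Vector n → Vector (m + n)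
inʳ m w = 0v {m} ++ w

inʳ-linear : ∀ m {n} → Linear (inʳ m {n})
inʳ-linear m x y = sym (trans (++-+v (0v {m}) 0v x y) (cong (_++ (x +v y)) (+v-self 0v)))

++-0v : ∀ m n → 0v {m} ++ 0v {n} ≡ 0v
++-0v zero n = refl
++-0v (suc m) n = cong (false ∷_) (++-0v m n)

inˡ-linear : ∀ {m} n → Linear (inˡ {m} n)
inˡ-linear n x y = sym (trans (++-+v x y (0v {n}) 0v) (cong ((x +v y) ++_) (+v-self 0v)))

-- The cube lemma, over F₂: two translates u, u′ of a large subspace that are
-- coloured identically reduce dimension suc t to dimension t.
monochromatic-cube : ∀ q t → Σ ℕ λ h → (χ : Vector h → Fin q) →
  ∃[ v ] Σ (Vec (Vector h) t) λ ls → Independent ls × (∀ c → χ (v +v lin ls c) ≡ χ v)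
monochromatic-cube q zero = 0 , λ χ → [] , [] , (λ { [] () }) , λ { [] → refl }
monochromatic-cube q (suc t) with monochromatic-cube q t
... | h , cube = a + h , result
  where
  a : ℕ
  -- The number of q-colourings of the h-dimensional space. Since 2 ^ a exceeds it, two of the
  -- translates indexed by vectors of length a are coloured identically.
  a = q ^ (2 ^ h)
  result : (χ : Vector (a + h) → Fin q) →
    ∃[ v ] Σ (Vec (Vector (a + h)) (suc t)) λ ls → Independent ls × (∀ c → χ (v +v lin ls c) ≡ χ v)
  result χ with pigeonhole (n<2^n a) (λ i → funToFin (λ j → χ (decode {a} i ++ decode {h} j)))
  ... | i , j , i<j , eq with cube (λ w → χ (decode {a} i ++ w))
  ... | w , ls , ind , mono =
    u ++ w , ((u +v u′) ++ 0v) ∷ map (inʳ a) ls , ind′ , mono′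
    where
    u u′ : Vector a
    u = decode i
    u′ = decode j
    same : ∀ x → χ (u ++ x) ≡ χ (u′ ++ x)
    same x = begin
      χ (u ++ x) ≡⟨ cong (λ z → χ (u ++ z)) (decode-encode x) ⟨
      χ (u ++ decode (encode x)) ≡⟨ finToFun-funToFin (λ k → χ (u ++ decode k)) (encode x) ⟨
      finToFun (funToFin (λ k → χ (u ++ decode {h} k))) (encode x) ≡⟨ cong (λ z → finToFun z (encode x)) eq ⟩
      finToFun (funToFin (λ k → χ (u′ ++ decode {h} k))) (encode x) ≡⟨ finToFun-funToFin (λ k → χ (u′ ++ decode k)) (encode x) ⟩
      χ (u′ ++ decode (encode x)) ≡⟨ cong (λ z → χ (u′ ++ z)) (decode-encode x) ⟩
      χ (u′ ++ x) ∎
    u≢u′ : ¬ u ≡ u′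
    u≢u′ e = <⇒≢ i<j (trans (sym (encode-decode {a} i)) (trans (cong encode e) (encode-decode {a} j)))
    lift : ∀ c → lin (map (inʳ a) ls) c ≡ 0v ++ lin ls c
    lift c = sym (linear-lin (inʳ a) (inʳ-linear a) ls c)
    lift′ : ∀ c → ((u +v u′) ++ 0v) +v lin (map (inʳ a) ls) c ≡ (u +v u′) ++ lin ls c
    lift′ c = trans (cong (((u +v u′) ++ 0v) +v_) (lift c))
      (trans (++-+v (u +v u′) 0v 0v (lin ls c))
        (cong₂ _++_ (+v-identityʳ (u +v u′)) (+v-identityˡ (lin ls c))))
    ind′ : Independent (((u +v u′) ++ 0v) ∷ map (inʳ a) ls)
    ind′ (false ∷ c) nz e = ind c nz (++-injectiveʳ 0v 0v (trans (sym (lift c)) (trans e (sym (++-0v a h)))))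
    ind′ (true ∷ c) nz e = u≢u′ (+v≡0⇒≡ u u′ (++-injectiveˡ _ _ (trans (sym (lift′ c)) (trans e (sym (++-0v a h))))))
    mono′ : ∀ c → χ ((u ++ w) +v lin (((u +v u′) ++ 0v) ∷ map (inʳ a) ls) c) ≡ χ (u ++ w)
    mono′ (false ∷ c) = begin
      χ ((u ++ w) +v lin (map (inʳ a) ls) c) ≡⟨ cong (λ z → χ ((u ++ w) +v z)) (lift c) ⟩
      χ ((u ++ w) +v (0v ++ lin ls c)) ≡⟨ cong χ (++-+v u 0v w (lin ls c)) ⟩
      χ ((u +v 0v) ++ (w +v lin ls c)) ≡⟨ cong (λ z → χ (z ++ (w +v lin ls c))) (+v-identityʳ u) ⟩
      χ (u ++ (w +v lin ls c)) ≡⟨ mono c ⟩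
      χ (u ++ w) ∎
    mono′ (true ∷ c) = begin
      χ ((u ++ w) +v (((u +v u′) ++ 0v) +v lin (map (inʳ a) ls) c)) ≡⟨ cong (λ z → χ ((u ++ w) +v z)) (lift′ c) ⟩
      χ ((u ++ w) +v ((u +v u′) ++ lin ls c)) ≡⟨ cong χ (++-+v u (u +v u′) w (lin ls c)) ⟩
      χ ((u +v (u +v u′)) ++ (w +v lin ls c)) ≡⟨ cong (λ z → χ (z ++ (w +v lin ls c))) (cancelˡ u u′) ⟩
      χ (u′ ++ (w +v lin ls c)) ≡⟨ same (w +v lin ls c) ⟨
      χ (u ++ (w +v lin ls c)) ≡⟨ mono c ⟩
      χ (u ++ w) ∎

Solid : ∀ {n d} → (Vector n → Bool) → Vec (Vector n) d → Set
Solid f vs = ∀ c → isZero c ≡ false → f (lin vs c) ≡ true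

TriangleFree : ∀ {n} → (Vector n → Bool) → Set
TriangleFree f = ∀ a b → f a ≡ false → f b ≡ false → f (a +v b) ≡ false →
                 a ≡ 0v ⊎ b ≡ 0v ⊎ a ≡ b

solid-map : ∀ {m n d} (f : Vector n → Bool) (φ : Vector m → Vector n) → Linear φ →
            (vs : Vec (Vector m) d) → Solid (f ∘ φ) vs → Solid f (map φ vs)
solid-map f φ L vs S c nz = trans (cong f (sym (linear-lin φ L vs c))) (S c nz)

≢false⇒≡true : ∀ {b} → ¬ b ≡ false → b ≡ true
≢false⇒≡true {false} h = ⊥-elim (h refl)
≢false⇒≡true {true} h = refl

-- If no translate of the s-dimensional flat lies in the ground set, then every
-- w yields a zero of f in the translate of the flat by w; colouring w by its
-- position, the differences within a monochromatic cube are non-zeros of f.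
triangle-free⇒solid : ∀ s → Σ ℕ λ R → (f : Vector R → Bool) → TriangleFree f →
                      Σ (Vec (Vector R) s) (Solid f)
triangle-free⇒solid zero = 0 , λ f tf → [] , λ { [] () }
triangle-free⇒solid (suc s) with triangle-free⇒solid s
... | r , small with monochromatic-cube (2 ^ s) (suc s)
-- The first r coordinates hold the flat of dimension s and the last h index its translates. The
-- extra coordinate is 1 on every translate, which rules out the degenerate alternatives `a ≡ 0v`
-- and `b ≡ 0v` of `TriangleFree`.
... | h , cube = r + suc h , result
  where
  result : (f : Vector (r + suc h) → Bool) → TriangleFree f → Σ (Vec (Vector (r + suc h)) (suc s)) (Solid f)
  result f tf with small (f ∘ inˡ (suc h)) tf′
    where
    tf′ : TriangleFree (f ∘ inˡ (suc h))
    tf′ a b fa fb fab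
      with tf (a ++ 0v) (b ++ 0v) fa fb (trans (cong f (sym (inˡ-linear (suc h) a b))) fab)
    ... | inj₁ e = inj₁ (++-injectiveˡ a 0v (trans e (sym (++-0v r (suc h)))))
    ... | inj₂ (inj₁ e) = inj₂ (inj₁ (++-injectiveˡ b 0v (trans e (sym (++-0v r (suc h))))))
    ... | inj₂ (inj₂ e) = inj₂ (inj₂ (++-injectiveˡ a b e))
  ... | us , solid = search
    where
    vs : Vec (Vector (r + suc h)) s
    vs = map (inˡ (suc h)) us
    solid′ : Solid f vs
    solid′ = solid-map f (inˡ (suc h)) (inˡ-linear (suc h)) us solid
    p : Vector h → Vector (r + suc h)
    p w = inʳ r (true ∷ w)
    zero? : ∀ w → Dec (∃[ c ] f (p w +v lin vs c) ≡ false)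
    zero? w = any? (λ c → f (p w +v lin vs c) ≟b false)
    lin-vs : ∀ c → lin vs c ≡ lin us c ++ 0v
    lin-vs c = sym (linear-lin (inˡ (suc h)) (inˡ-linear (suc h)) us c)
    p-lin : ∀ w c → p w +v lin vs c ≡ lin us c ++ (true ∷ w)
    p-lin w c = trans (cong (p w +v_) (lin-vs c))
      (trans (++-+v 0v (lin us c) (true ∷ w) 0v) (cong₂ _++_ (+v-identityˡ (lin us c)) (+v-identityʳ (true ∷ w))))
    search : Σ (Vec (Vector (r + suc h)) (suc s)) (Solid f)
    search with any? (λ w → ¬? (zero? w))
    ... | yes (w , none) = p w ∷ vs , λ
      { (false ∷ c) nz → solid′ c nz
      ; (true ∷ c) nz → ≢false⇒≡true (λ e → none (c , e)) }
    ... | no all-zero = map δ ls , solid″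
      where
      zeroAt : ∀ w → ∃[ c ] f (p w +v lin vs c) ≡ false
      zeroAt w with zero? w
      ... | yes z = z
      ... | no ¬z = ⊥-elim (all-zero (w , ¬z))
      colour : Vector h → Vector s
      colour w = proj₁ (zeroAt w)
      δ : Vector h → Vector (r + suc h)
      δ w = inʳ r (false ∷ w)
      δ-linear : Linear δ
      δ-linear x y = inʳ-linear r (false ∷ x) (false ∷ y)
      v : Vector h
      v = proj₁ (cube (encode ∘ colour))
      ls : Vec (Vector h) (suc s)
      ls = proj₁ (proj₂ (cube (encode ∘ colour)))
      ind : Independent ls
      ind = proj₁ (proj₂ (proj₂ (cube (encode ∘ colour))))
      mono : ∀ c → colour (v +v lin ls c) ≡ colour v
      mono c = encode-injective (proj₂ (proj₂ (proj₂ (cube (encode ∘ colour)))) c)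
      solid″ : Solid f (map δ ls)
      solid″ c nz = trans (cong f (sym (linear-lin δ δ-linear ls c))) (≢false⇒≡true no-zero)
        where
        a b : Vector (r + suc h)
        a = lin us (colour v) ++ (true ∷ v)
        b = lin us (colour v) ++ (true ∷ (v +v lin ls c))
        fa : f a ≡ false
        fa = trans (cong f (sym (p-lin v (colour v)))) (proj₂ (zeroAt v))
        fb : f b ≡ false
        fb = trans (cong f (sym (p-lin (v +v lin ls c) (colour v))))
          (trans (cong (λ z → f (p (v +v lin ls c) +v lin vs z)) (sym (mono c)))
            (proj₂ (zeroAt (v +v lin ls c))))
        a+b : a +v b ≡ δ (lin ls c)
        a+b = trans (++-+v (lin us (colour v)) (lin us (colour v)) (true ∷ v) (true ∷ (v +v lin ls c)))
          (cong₂ (λ y z → y ++ (false ∷ z)) (+v-self _) (cancelˡ v (lin ls c)))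
        nonzero′ : ∀ {u : Vector r} {w : Vector h} → ¬ u ++ (true ∷ w) ≡ 0v
        nonzero′ {u} e with ++-injectiveʳ u 0v (trans e (sym (++-0v r (suc h))))
        ... | ()
        no-zero : ¬ f (δ (lin ls c)) ≡ false
        no-zero e with tf a b fa fb (trans (cong f a+b) e)
        ... | inj₁ a0 = nonzero′ a0
        ... | inj₂ (inj₁ b0) = nonzero′ b0
        ... | inj₂ (inj₂ ab) = ind c nz (trans (sym (cancelˡ v (lin ls c)))
          (trans (cong (v +v_) (sym (∷-injectiveʳ (++-injectiveʳ (lin us (colour v)) _ ab)))) (+v-self v)))

-- Iterated lift-joins

take-++ : ∀ {m n} (u : Vector m) (w : Vector n) → take m (u ++ w) ≡ u
take-++ [] w = refl
take-++ (b ∷ u) w = cong (b ∷_) (take-++ u w)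

drop-++ : ∀ {m n} (u : Vector m) (w : Vector n) → drop m (u ++ w) ≡ w
drop-++ [] w = refl
drop-++ (b ∷ u) w = drop-++ u w

take-linear : ∀ m {n} → Linear (take m {n})
take-linear m = take-zipWith {m = m} _xor_

drop-linear : ∀ m {n} → Linear (drop m {n})
drop-linear m = drop-zipWith {m = m} _xor_

join : ∀ {m n} → (Vector m → Bool) → (Vector n → Bool) → Vector m → Vector n → Bool
join f g u w = (isZero w ∧ f u) ∨ g w

liftJoinE-join : ∀ {m n} (f : Vector m → Bool) (g : Vector n → Bool) x →
                 liftJoinE f g x ≡ join f g (take m x) (drop m x)
liftJoinE-join {m} f g x with splitAt m x
... | u , w , _ = refl

liftJoinE-++ : ∀ {m n} (f : Vector m → Bool) (g : Vector n → Bool) u w →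
               liftJoinE f g (u ++ w) ≡ join f g u w
liftJoinE-++ f g u w =
  trans (liftJoinE-join f g (u ++ w)) (cong₂ (join f g) (take-++ u w) (drop-++ u w))

-- An explicit two-sided inverse makes isomorphisms easy to compose and to combine blockwise under
-- `⊗`; `≃⇒≅` returns to the official notion.
record _≃_ (M N : Matroid) : Set where
  field
    to : Vector (dim M) → Vector (dim N)
    from : Vector (dim N) → Vector (dim M)
    to-linear : Linear to
    from-to : ∀ x → from (to x) ≡ x
    to-from : ∀ y → to (from y) ≡ y
    preserves : ∀ x → E N (to x) ≡ E M x

  to-≢0 : ∀ x → isZero (to x) ≡ isZero x
  to-≢0 x with isZero x in eq
  ... | true = trans (cong isZero (trans (cong to (isZero⇒≡ x eq)) (linear-0 to to-linear))) (isZero-0v (dim N))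
  ... | false = ≢⇒isZero (to x) λ e → isZero⇒≢ x eq (begin
    x ≡⟨ from-to x ⟨
    from (to x) ≡⟨ cong from (trans e (sym (linear-0 to to-linear))) ⟩
    from (to 0v) ≡⟨ from-to 0v ⟩
    0v ∎)

open _≃_

≃⇒≅ : ∀ {M N} → M ≃ N → M ≅ N
≃⇒≅ i = to i , to-linear i ,
  ((λ {x} {y} eq → trans (sym (from-to i x)) (trans (cong (from i) eq) (from-to i y))) ,
   (λ y → from i y , λ { refl → to-from i y })) ,
  preserves i

≃-refl : ∀ {M} → M ≃ M
≃-refl = record { to = id ; from = id ; to-linear = λ _ _ → refl ; from-to = λ _ → refl
                ; to-from = λ _ → refl ; preserves = λ _ → refl }

≃-trans : ∀ {L M N} → L ≃ M → M ≃ N → L ≃ N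
≃-trans i j = record
  { to = to j ∘ to i ; from = from i ∘ from j
  ; to-linear = ∘-linear (to-linear j) (to-linear i)
  ; from-to = λ x → trans (cong (from i) (from-to j (to i x))) (from-to i x)
  ; to-from = λ y → trans (cong (to j) (to-from i (from j y))) (to-from j y)
  ; preserves = λ x → trans (preserves j (to i x)) (preserves i x) }

pointwise : ∀ {n} {f g : Vector n → Bool} → (∀ x → g x ≡ f x) → mat n f ≃ mat n g
pointwise eq = record { to = id ; from = id ; to-linear = λ _ _ → refl ; from-to = λ _ → refl
                      ; to-from = λ _ → refl ; preserves = eq }

⊗-cong : ∀ {M M′ N N′} → M ≃ M′ → N ≃ N′ → (M ⊗ N) ≃ (M′ ⊗ N′)
⊗-cong {M} {M′} {N} {N′} i j = record
  { to = λ x → to i (take m x) ++ to j (drop m x)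
  ; from = λ y → from i (take m′ y) ++ from j (drop m′ y)
  ; to-linear = λ x y → sym (trans
      (++-+v (to i (take m x)) (to i (take m y)) (to j (drop m x)) (to j (drop m y)))
      (cong₂ _++_ (trans (sym (to-linear i _ _)) (cong (to i) (sym (take-linear m x y))))
                  (trans (sym (to-linear j _ _)) (cong (to j) (sym (drop-linear m x y))))))
  ; from-to = λ x → trans
      (cong₂ (λ u w → from i u ++ from j w) (take-++ (to i (take m x)) _) (drop-++ (to i (take m x)) _))
      (trans (cong₂ _++_ (from-to i (take m x)) (from-to j (drop m x))) (take++drop≡id m x))
  ; to-from = λ y → trans
      (cong₂ (λ u w → to i u ++ to j w) (take-++ (from i (take m′ y)) _) (drop-++ (from i (take m′ y)) _))
      (trans (cong₂ _++_ (to-from i (take m′ y)) (to-from j (drop m′ y))) (take++drop≡id m′ y))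
  ; preserves = λ x → trans (liftJoinE-++ (E M′) (E N′) (to i (take m x)) (to j (drop m x)))
      (trans (cong₂ _∨_ (cong₂ _∧_ (to-≢0 j (drop m x)) (preserves i (take m x))) (preserves j (drop m x)))
             (sym (liftJoinE-join (E M) (E N) x))) }
  where
  m m′ : ℕ
  m = dim M
  m′ = dim M′

isZero-++ : ∀ {m n} (u : Vector m) (w : Vector n) → isZero (u ++ w) ≡ isZero u ∧ isZero w
isZero-++ [] w = refl
isZero-++ (false ∷ u) w = isZero-++ u w
isZero-++ (true ∷ u) w = refl

-- For components u, v, w both sides express the same condition: w is in N, or w = 0 and v is in M,
-- or v = w = 0 and u is in L. Only the coordinates are regrouped.
⊗-assoc : ∀ L M N → (L ⊗ (M ⊗ N)) ≃ ((L ⊗ M) ⊗ N)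
⊗-assoc L M N = record
  { to = φ ; from = χ ; to-linear = φ-linear
  ; from-to = λ x → trans (χ-++ (take l x) (take m (drop l x)) (drop m (drop l x))) (recompose x)
  ; to-from = λ y → trans (φ-++ (take l (take (l + m) y)) (drop l (take (l + m) y)) (drop (l + m) y)) (recompose′ y)
  ; preserves = λ x → trans (preserves-++ (take l x) (take m (drop l x)) (drop m (drop l x)))
             (cong (E (L ⊗ (M ⊗ N))) (recompose x)) }
  where
  l m n : ℕ
  l = dim L
  m = dim M
  n = dim N
  φ : Vector (l + (m + n)) → Vector ((l + m) + n)
  φ x = (take l x ++ take m (drop l x)) ++ drop m (drop l x)
  χ : Vector ((l + m) + n) → Vector (l + (m + n))
  χ y = take l (take (l + m) y) ++ (drop l (take (l + m) y) ++ drop (l + m) y)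
  recompose : ∀ x → take l x ++ (take m (drop l x) ++ drop m (drop l x)) ≡ x
  recompose x = trans (cong (take l x ++_) (take++drop≡id m (drop l x))) (take++drop≡id l x)
  recompose′ : ∀ y → (take l (take (l + m) y) ++ drop l (take (l + m) y)) ++ drop (l + m) y ≡ y
  recompose′ y = trans (cong (_++ drop (l + m) y) (take++drop≡id l (take (l + m) y))) (take++drop≡id (l + m) y)
  φ-++ : ∀ (u : Vector l) (v : Vector m) (w : Vector n) → φ (u ++ (v ++ w)) ≡ (u ++ v) ++ w
  φ-++ u v w rewrite take-++ u (v ++ w) | drop-++ u (v ++ w) | take-++ v w | drop-++ v w = refl
  χ-++ : ∀ (u : Vector l) (v : Vector m) (w : Vector n) → χ ((u ++ v) ++ w) ≡ u ++ (v ++ w)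
  χ-++ u v w rewrite take-++ (u ++ v) w | drop-++ (u ++ v) w | take-++ u v | drop-++ u v = refl
  φ-linear : Linear φ
  φ-linear x y rewrite take-linear l x y | drop-linear l x y
    | take-linear m (drop l x) (drop l y) | drop-linear m (drop l x) (drop l y) =
    sym (trans (++-+v (take l x ++ take m (drop l x)) _ (drop m (drop l x)) _)
               (cong (_++ (drop m (drop l x) +v drop m (drop l y))) (++-+v (take l x) _ (take m (drop l x)) _)))
  bool : ∀ a b c d e → (a ∧ ((b ∧ c) ∨ d)) ∨ e ≡ ((b ∧ a) ∧ c) ∨ ((a ∧ d) ∨ e)
  bool false false c d e = refl
  bool false true c d e = refl
  bool true false c d e = refl
  bool true true false d e = refl
  bool true true true d e = refl
  preserves-++ : ∀ (u : Vector l) (v : Vector m) (w : Vector n) → E ((L ⊗ M) ⊗ N) ((u ++ v) ++ w) ≡ E (L ⊗ (M ⊗ N)) (u ++ (v ++ w))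
  preserves-++ u v w = begin
    E ((L ⊗ M) ⊗ N) ((u ++ v) ++ w) ≡⟨ liftJoinE-++ (E (L ⊗ M)) (E N) (u ++ v) w ⟩
    (isZero w ∧ E (L ⊗ M) (u ++ v)) ∨ E N w ≡⟨ cong (λ z → (isZero w ∧ z) ∨ E N w) (liftJoinE-++ (E L) (E M) u v) ⟩
    (isZero w ∧ ((isZero v ∧ E L u) ∨ E M v)) ∨ E N w ≡⟨ bool (isZero w) (isZero v) (E L u) (E M v) (E N w) ⟩
    ((isZero v ∧ isZero w) ∧ E L u) ∨ ((isZero w ∧ E M v) ∨ E N w) ≡⟨ cong₂ (λ y z → (y ∧ E L u) ∨ z) (isZero-++ v w) (liftJoinE-++ (E M) (E N) v w) ⟨
    (isZero (v ++ w) ∧ E L u) ∨ E (M ⊗ N) (v ++ w) ≡⟨ liftJoinE-++ (E L) (E (M ⊗ N)) u (v ++ w) ⟨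
    E (L ⊗ (M ⊗ N)) (u ++ (v ++ w)) ∎

iter-cong : ∀ {k M M′} (Ns : Vec Matroid k) → M ≃ M′ → iterLiftJoin (M ∷ Ns) ≃ iterLiftJoin (M′ ∷ Ns)
iter-cong [] i = i
iter-cong (N ∷ Ns) i = iter-cong Ns (⊗-cong {N = N} i ≃-refl)

⊗-iter : ∀ {k} L M (Ns : Vec Matroid k) → (L ⊗ iterLiftJoin (M ∷ Ns)) ≃ iterLiftJoin (L ∷ M ∷ Ns)
⊗-iter L M [] = ≃-refl
⊗-iter L M (N ∷ Ns) = ≃-trans (⊗-iter L (M ⊗ N) Ns) (iter-cong Ns (⊗-assoc L M N))

-- Iterated lift-joins nest to the left, whereas the second operand here is itself a nest;
-- associativity dissolves it one factor at a time, so the decompositions of both parts merge into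
-- one list.
iter-++ : ∀ {j k} (Ms : Vec Matroid (suc j)) (Ns : Vec Matroid (suc k)) →
          (iterLiftJoin Ms ⊗ iterLiftJoin Ns) ≃ iterLiftJoin (Ms ++ Ns)
iter-++ (M ∷ []) (N ∷ Ns) = ⊗-iter M N Ns
iter-++ (M ∷ M′ ∷ Ms) Ns = iter-++ ((M ⊗ M′) ∷ Ms) Ns

-- Decompositions into even-plane factors

∅ₘ : ℕ → Matroid
∅ₘ n = mat n (λ _ → false)

∅-evenPlane : ∀ n → EvenPlane (∅ₘ n)
∅-evenPlane n P = 2 ∣0

-- The empty matroid of dimension 0 is a left unit for `⊗`, so a short decomposition can be
-- prolonged at its lower end to any prescribed length.
pad : ∀ {k} (Ms : Vec Matroid (suc k)) → iterLiftJoin Ms ≃ iterLiftJoin (∅ₘ 0 ∷ Ms)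
pad (M ∷ Ms) = iter-cong Ms (record
  { to = id ; from = id ; to-linear = λ _ _ → refl ; from-to = λ _ → refl ; to-from = λ _ → refl
  ; preserves = λ x → trans (liftJoinE-++ {0} (λ _ → false) (E M) [] x) (∧false (isZero x) (E M x)) })
  where
  ∧false : ∀ a b → (a ∧ false) ∨ b ≡ b
  ∧false false b = refl
  ∧false true b = refl

-- The induction only bounds the number of factors; `chain-exact` turns the bound into an equality
-- by padding.
record Chain (N : ℕ) (M : Matroid) : Set where
  constructor chain
  field
    {k} : ℕ
    k≤N : suc k ≤ N
    Ms : Vec Matroid (suc k)
    wf : All WF Ms
    even : All EvenPlane Ms
    iso : M ≃ iterLiftJoin Ms

chain-≃ : ∀ {N L M} → L ≃ M → Chain N M → Chain N L
chain-≃ i (chain le Ms wf ev iso) = chain le Ms wf ev (≃-trans i iso)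

chain-one : ∀ {M} → WF M → EvenPlane M → Chain 1 M
chain-one {M} wf ev = chain ≤-refl (M ∷ []) (wf ∷ []) (ev ∷ []) ≃-refl

chain-⊗ : ∀ {a b L M} → Chain a L → Chain b M → Chain (a + b) (L ⊗ M)
chain-⊗ {a} {b} (chain {j} j≤ Ms wf ev iso) (chain {k} k≤ Ns wf′ ev′ iso′) =
  chain (+-mono-≤ j≤ k≤) (Ms ++ Ns) (++⁺ wf wf′) (++⁺ ev ev′)
        (≃-trans (⊗-cong iso iso′) (iter-++ Ms Ns))

chain-≤ : ∀ {a b M} → a ≤ b → Chain a M → Chain b M
chain-≤ a≤b (chain le Ms wf ev iso) = chain (≤-trans le a≤b) Ms wf ev iso

chain-exact : ∀ {N M} → Chain (suc N) M →
              Σ (Vec Matroid (suc N)) λ Ms → All WF Ms × All EvenPlane Ms × (M ≅ iterLiftJoin Ms)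
chain-exact {N} {M} (chain {k} k≤N Ms wf ev iso)
  with m≤n⇒∃[o]m+o≡n (s≤s⁻¹ k≤N)
... | o , refl = subst (λ j → Σ (Vec Matroid (suc j)) λ Ms → All WF Ms × All EvenPlane Ms × (M ≅ iterLiftJoin Ms))
                       (+-comm o k) (go o)
  where
  go′ : ∀ o → Σ (Vec Matroid (suc (o + k))) λ Ms → All WF Ms × All EvenPlane Ms × (M ≃ iterLiftJoin Ms)
  go′ zero = Ms , wf , ev , iso
  go′ (suc o) with go′ o
  ... | Ms′ , wf′ , ev′ , iso′ = ∅ₘ 0 ∷ Ms′ , refl ∷ wf′ , ∅-evenPlane 0 ∷ ev′ , ≃-trans iso′ (pad Ms′)
  go : ∀ o → Σ (Vec Matroid (suc (o + k))) λ Ms → All WF Ms × All EvenPlane Ms × (M ≅ iterLiftJoin Ms)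
  go o with go′ o
  ... | Ms′ , wf′ , ev′ , iso′ = Ms′ , wf′ , ev′ , ≃⇒≅ iso′

record Good (k N n : ℕ) (f : Vector n → Bool) : Set where
  constructor good
  field
    {d} : ℕ
    φ : Vector d → Vector n
    φ-linear : Linear φ
    φ-kernel : ∀ v → φ v ≡ 0v → v ≡ 0v
    codim : n ≤ d + k
    decomposition : Chain N (mat d (f ∘ φ))

good-even : ∀ {n f} → f 0v ≡ false → EvenPlane (mat n f) → Good 0 1 n f
good-even f0 ev = good id (λ _ _ → refl) (λ _ e → e) (≤-reflexive (sym (+-identityʳ _))) (chain-one f0 ev)

good-∅ : ∀ {n f} → (∀ x → f x ≡ false) → Good 0 1 n f
good-∅ {n} f≡0 = good id (λ _ _ → refl) (λ _ e → e) (≤-reflexive (sym (+-identityʳ n)))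
  (chain-≃ (pointwise (λ x → sym (f≡0 x))) (chain-one refl (∅-evenPlane n)))

good-≤ : ∀ {k k′ N N′ n f} → k ≤ k′ → N ≤ N′ → Good k N n f → Good k′ N′ n f
good-≤ le le′ (good {d} φ L ker co ch) =
  good φ L ker (≤-trans co (+-mono-≤ (≤-refl {d}) le)) (chain-≤ le′ ch)

module _ {n : ℕ} (f : Vector n → Bool) (f0 : f 0v ≡ false) (K : Subspace n)
         (invariant : ∀ {u v} → In K u → ¬ In K v → f (u +v v) ≡ f v) where

  open Splitting (splitting K)

  -- Invariance says that off K membership depends only on the coset of K. This is the shape of a
  -- lift-join whose lower factor lives on K and whose upper factor lives on a complement.
  split-join : ∀ u w → f (ι u +v κ w) ≡ join (f ∘ ι) (f ∘ κ) u w
  split-join u w with isZero w in eq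
  ... | true = begin
    f (ι u +v κ w) ≡⟨ cong f (cong (ι u +v_) κw≡0) ⟩
    f (ι u +v 0v) ≡⟨ cong f (+v-identityʳ (ι u)) ⟩
    f (ι u) ≡⟨ ∨-identityʳ (f (ι u)) ⟨
    f (ι u) ∨ false ≡⟨ cong (f (ι u) ∨_) (trans (cong f κw≡0) f0) ⟨
    f (ι u) ∨ f (κ w) ∎
    where
    κw≡0 : κ w ≡ 0v
    κw≡0 = trans (cong κ (isZero⇒≡ w eq)) (linear-0 κ κ-linear)
  ... | false = invariant (ι-in u) (λ p → isZero⇒≢ w eq (κ-in⇒≡0 w p))

  -- The subspaces found in K and in the complement are added, and the sum still splits along K; so
  -- codimensions add up as well as numbers of factors.
  good-⊗ : ∀ {k₁ k₂ N₁ N₂} → Good k₁ N₁ d (f ∘ ι) → Good k₂ N₂ c (f ∘ κ) → Good (k₁ + k₂) (N₁ + N₂) n f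
  good-⊗ {k₁} {k₂} (good {d₁} φ Lφ kφ coφ chφ) (good {d₂} χ Lχ kχ coχ chχ) =
    good Φ Φ-linear Φ-kernel co (chain-≃ (pointwise same) (chain-⊗ chφ chχ))
    where
    Φ : Vector (d₁ + d₂) → Vector n
    Φ x = ι (φ (take d₁ x)) +v κ (χ (drop d₁ x))
    Φ-linear : Linear Φ
    Φ-linear x y = trans
      (cong₂ (λ a b → ι (φ a) +v κ (χ b)) (take-linear d₁ x y) (drop-linear d₁ x y))
      (trans (cong₂ _+v_ (∘-linear ι-linear Lφ _ _) (∘-linear κ-linear Lχ _ _))
             (+v-swap (ι (φ (take d₁ x))) _ (κ (χ (drop d₁ x))) _))
    Φ-kernel : ∀ x → Φ x ≡ 0v → x ≡ 0v
    Φ-kernel x e = begin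
      x ≡⟨ take++drop≡id d₁ x ⟨
      take d₁ x ++ drop d₁ x ≡⟨ cong₂ _++_ (kφ _ left) (kχ _ right) ⟩
      0v {d₁} ++ 0v {d₂} ≡⟨ zeros d₁ d₂ ⟩
      0v ∎
      where
      zeros : ∀ m n → 0v {m} ++ 0v {n} ≡ 0v
      zeros zero n = refl
      zeros (suc m) n = cong (false ∷_) (zeros m n)
      left : φ (take d₁ x) ≡ 0v
      left = trans (sym (π₁-recombine _ (χ (drop d₁ x)))) (trans (cong π₁ e) (linear-0 π₁ π₁-linear))
      right : χ (drop d₁ x) ≡ 0v
      right = trans (sym (π₂-recombine (φ (take d₁ x)) _)) (trans (cong π₂ e) (linear-0 π₂ π₂-linear))
    kernel-isZero : ∀ w → isZero (χ w) ≡ isZero w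
    kernel-isZero w with isZero w in eq
    ... | true = trans (cong isZero (trans (cong χ (isZero⇒≡ w eq)) (linear-0 χ Lχ))) (isZero-0v c)
    ... | false = ≢⇒isZero (χ w) λ e → isZero⇒≢ w eq (kχ w e)
    same : ∀ x → liftJoinE (f ∘ ι ∘ φ) (f ∘ κ ∘ χ) x ≡ f (Φ x)
    same x = trans (liftJoinE-join (f ∘ ι ∘ φ) (f ∘ κ ∘ χ) x)
      (trans (cong (λ z → (z ∧ f (ι (φ (take d₁ x)))) ∨ f (κ (χ (drop d₁ x))))
                   (sym (kernel-isZero (drop d₁ x))))
             (sym (split-join (φ (take d₁ x)) (χ (drop d₁ x)))))
    co : n ≤ (d₁ + d₂) + (k₁ + k₂)
    co = ≤-trans (≤-reflexive (sym dims)) (≤-trans (+-mono-≤ coφ coχ) (≤-reflexive (swap d₁ k₁ d₂ k₂)))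
      where
      swap : ∀ a b c d → (a + b) + (c + d) ≡ (a + c) + (b + d)
      swap a b c d = begin
        (a + b) + (c + d) ≡⟨ +-assoc a b (c + d) ⟩
        a + (b + (c + d)) ≡⟨ cong (a +_) (+-assoc b c d) ⟨
        a + ((b + c) + d) ≡⟨ cong (λ z → a + (z + d)) (+-comm b c) ⟩
        a + ((c + b) + d) ≡⟨ cong (a +_) (+-assoc c b d) ⟩
        a + (c + (b + d)) ≡⟨ +-assoc a c (b + d) ⟨
        (a + c) + (b + d) ∎

-- No five-point planes

evalᵇ : ∀ {m} → Expr m → Vec Bool m → Bool
evalᵇ (var i) bs = lookup bs i
evalᵇ (d ⊕ e) bs = evalᵇ d bs xor evalᵇ e bs
evalᵇ 𝟘 bs = false

evalᵇ-correct : ∀ {m} (e : Expr m) bs → ⟦ e ⟧ (map (_∷ []) bs) ≡ evalᵇ e bs ∷ []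
evalᵇ-correct (var zero) (b ∷ bs) = refl
evalᵇ-correct (var (suc i)) (b ∷ bs) = evalᵇ-correct (var i) bs
evalᵇ-correct (d ⊕ e) bs = cong₂ _+v_ (evalᵇ-correct d bs) (evalᵇ-correct e bs)
evalᵇ-correct 𝟘 bs = refl

-- Parity identities between truth values are vector identities in dimension one.
solveᵇ : ∀ {m} (bs : Vec Bool m) (d e : Expr m) → norm d ≡ norm e → evalᵇ d bs ≡ evalᵇ e bs
solveᵇ bs d e eq = cong head (trans (sym (evalᵇ-correct d bs))
  (trans (solve (map (_∷ []) bs) d e eq) (evalᵇ-correct e bs)))

-- For independent a, b, c the identity says that f has even sum over the seven points of their
-- plane; together with `f 0v ≡ false` it is the vanishing of the third derivative.
EvenOn : ∀ {n} → (Vector n → Bool) → (Vector n → Set) → Set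
EvenOn f P = ∀ a b c → P a → P b → P c →
  f (a +v b +v c) ≡ f a xor f b xor f c xor f (a +v b) xor f (a +v c) xor f (b +v c)

parity : ℕ → Bool
parity zero = false
parity (suc n) = not (parity n)

parity-even : ∀ n → parity n ≡ false → 2 ∣ n
parity-even zero _ = divides 0 refl
parity-even (suc (suc n)) h with parity-even n (trans (sym (not-not (parity n))) h)
  where
  not-not : ∀ b → not (not b) ≡ b
  not-not false = refl
  not-not true = refl
... | divides q refl = divides (suc q) refl

parity-filter : ∀ {n} (h : Vector n → Bool) xs →
                parity (length (filter (λ x → T? (h x)) xs)) ≡ foldr (λ x r → h x xor r) false xs
parity-filter h [] = refl
parity-filter h (x ∷ xs) with h x
... | true = cong not (parity-filter h xs)
... | false = parity-filter h xs

evenOn⇒evenPlane : ∀ {n} (f : Vector n → Bool) → f 0v ≡ false → (∀ a b c →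
  f (a +v b +v c) ≡ f a xor f b xor f c xor f (a +v b) xor f (a +v c) xor f (b +v c)) →
  EvenPlane (mat n f)
evenOn⇒evenPlane f f0 ev P = parity-even (countIn (mat _ f) P) (begin
  parity (countIn (mat _ f) P) ≡⟨ parity-filter h (allVecs 3) ⟩
  h (false ∷ false ∷ false ∷ []) xor rest (h (true ∷ true ∷ true ∷ [])) ≡⟨
    cong₂ (λ y z → y xor rest z) (trans (cong f (linear-0 (emb P) (linear P))) f0) h₇ ⟩
  rest (h₄ xor h₂ xor h₁ xor h₆ xor h₅ xor h₃) ≡⟨
    solveᵇ (h₁ ∷ h₂ ∷ h₃ ∷ h₄ ∷ h₅ ∷ h₆ ∷ [])
      (v₀ ⊕ (v₁ ⊕ (v₂ ⊕ (v₃ ⊕ (v₄ ⊕ (v₅ ⊕ ((v₃ ⊕ (v₁ ⊕ (v₀ ⊕ (v₅ ⊕ (v₄ ⊕ v₂))))) ⊕ 𝟘))))))) 𝟘 refl ⟩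
  false ∎)
  where
  h : Vector 3 → Bool
  h v = f (emb P v)
  h₁ h₂ h₃ h₄ h₅ h₆ : Bool
  h₁ = h (false ∷ false ∷ true ∷ [])
  h₂ = h (false ∷ true ∷ false ∷ [])
  h₃ = h (false ∷ true ∷ true ∷ [])
  h₄ = h (true ∷ false ∷ false ∷ [])
  h₅ = h (true ∷ false ∷ true ∷ [])
  h₆ = h (true ∷ true ∷ false ∷ [])
  rest : Bool → Bool
  rest z = h₁ xor (h₂ xor (h₃ xor (h₄ xor (h₅ xor (h₆ xor (z xor false))))))
  a b c : Vector 3
  a = true ∷ false ∷ false ∷ []
  b = false ∷ true ∷ false ∷ []
  c = false ∷ false ∷ true ∷ []
  L : Linear (emb P)
  L = linear P
  h₇ : h (true ∷ true ∷ true ∷ []) ≡ h₄ xor h₂ xor h₁ xor h₆ xor h₅ xor h₃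
  h₇ = begin
    f (emb P (a +v b +v c)) ≡⟨ cong f (trans (L (a +v b) c) (cong (_+v emb P c) (L a b))) ⟩
    f (emb P a +v emb P b +v emb P c) ≡⟨ ev (emb P a) (emb P b) (emb P c) ⟩
    h a xor h b xor h c xor f (emb P a +v emb P b) xor f (emb P a +v emb P c) xor f (emb P b +v emb P c)
      ≡⟨ cong₂ (λ y z → h a xor h b xor h c xor y xor z) (cong f (sym (L a b)))
           (cong₂ _xor_ (cong f (sym (L a c))) (cong f (sym (L b c)))) ⟩
    h₄ xor h₂ xor h₁ xor h₆ xor h₅ xor h₃ ∎

-- In the last two cases K contains the ground set, so that f is the lift-join of
-- its restriction to K with an empty matroid.
data Outcome (k : ℕ) {n} (f : Vector n → Bool) : Set₁ where
  joined : (K : Subspace n) → (∀ {u v} → In K u → ¬ In K v → f (u +v v) ≡ f v) →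
           ∀ x → f x ≡ true → In K x → ∀ y → f y ≡ true → ¬ In K y → Outcome k f
  even : (K : Subspace n) → (∀ v → f v ≡ true → In K v) → EvenOn f (In K) → Outcome k f
  extending : (K U : Subspace n) → (∀ v → f v ≡ true → In K v) →
    (∀ m (φ : Vector m → Vector n) → Linear φ → (∀ w → In K (φ w)) →
       (∀ w → In U (φ w) → w ≡ 0v) → m ≤ k) →
    (∀ {d} (vs : Vec (Vector n) d) → Solid f vs → (∀ c → In U (lin vs c)) →
       Σ (Vec (Vector n) (suc d)) (Solid f)) → Outcome k f

H-tree : Tree
H-tree =
  split 2 (split 3 goal (split 4 (split 5 goal (split 6 (split 7 (basis 1 3 5) goal) (split 7 goal (five 1 2
  4)))) (split 5 (split 7 (split 6 (basis 1 3 4) goal) (split 6 goal (five 1 2 5))) goal))) (split 3 (split 4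
  (split 5 goal (split 7 (split 6 (basis 1 2 5) goal) (split 6 goal (five 1 3 4)))) (split 5 (split 7 (split 6
  (basis 1 2 4) goal) (split 6 goal (five 1 3 5))) goal)) goal)

Z-tree : Tree
Z-tree =
  split 19 (five 1 16 19) (split 11 (five 1 8 11) (split 14 (split 15 (five 4 14 15) (five 1 8 14)) (split 12
  (five 2 8 12) (split 15 (five 3 8 15) (split 13 (five 3 8 13) (split 23 (split 20 (five 5 20 23) (five 3 16
  23)) (split 31 (split 30 (five 12 30 31) (five 1 16 31)) (split 24 goal (five 7 8 16)))))))))

mixed-tree : Tree
mixed-tree =
  split 11 (split 12 (split 13 (split 14 (split 15 (split 24 goal (split 18 (split 26 (split 19 (split 17
  goal (five 2 18 19)) (split 27 (five 3 11 27) (split 25 (five 1 25 26) (split 17 (five 1 17 18) (split 30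
  (split 29 (five 5 29 30) (five 3 26 30)) (split 23 (basis 4 19 30) (five 17 9 15))))))) (five 2 10 18))
  (split 26 (five 2 10 26) (split 30 (split 22 (split 28 (five 4 28 30) (split 20 (five 4 20 22) (split 29
  (split 31 (five 5 29 31) (five 1 29 30)) (split 25 (five 3 25 30) (five 16 9 13))))) (five 6 14 30)) (split
  28 (split 22 (five 6 14 22) (split 20 (split 31 (split 21 (basis 7 18 24) (basis 1 21 30)) (split 25 (five 3
  25 28) (five 16 9 15))) (five 6 14 28))) (five 16 12 14)))))) (five 3 11 12)) (five 3 11 13)) (five 1 9
  12)) (split 13 (five 1 9 13) (five 6 10 11))) (five 1 9 10)

outside-tree : Tree
outside-tree =
  split 7 (five 1 5 7) goal

xyz-tree : Tree
xyz-tree =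
  split 6 (split 7 (five 2 6 7) goal) (split 7 goal goal)

false≢ : ∀ {b} → ¬ b ≡ true → b ≡ false
false≢ {false} _ = refl
false≢ {true} h = ⊥-elim (h refl)

solid-∷ : ∀ {n d} (f : Vector n → Bool) x (vs : Vec (Vector n) d) → f x ≡ true → Solid f vs →
          (∀ c → isZero c ≡ false → f (x +v lin vs c) ≡ true) → Solid f (x ∷ vs)
solid-∷ f x vs fx S h (false ∷ c) nz = S c nz
solid-∷ f x vs fx S h (true ∷ c) _ with isZero c in eq
... | true = trans (cong f (trans (cong (λ z → x +v lin vs z) (isZero⇒≡ c eq))
                                  (trans (cong (x +v_) (lin-0 vs)) (+v-identityʳ x)))) fx
... | false = h c eq

whole : ∀ {n} → Subspace n
whole = record { In = λ _ → ⊤ ; in? = λ _ → yes tt ; in-0 = tt ; in-+ = λ _ _ → tt }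

module NoFivePlane {n : ℕ} (f : Vector n → Bool) (f0 : f 0v ≡ false) (cf : CF f) (n5 : No5 f) where

  h : Vector n → Vector n → Bool
  h x u = f u xor f (u +v x)

  -- Here `h x` is the derivative of f in direction x. A failure of closure would produce a claw or
  -- a five-point plane in the span of x, u, v. Of the certified alternatives the first four
  -- contradict the hypotheses on u and v, the last two give the claim.
  H-closed : ∀ x → f x ≡ true → ∀ {u v} → h x u ≡ true → h x v ≡ true → h x (u +v v) ≡ true
  H-closed x fx {u} {v} hu hv
    with certifiedₑ true ((v₀ , true) ∷ [])
      (((v₁ , false) ∷ (v₁ ⊕ v₀ , false) ∷ []) ∷ ((v₁ , true) ∷ (v₁ ⊕ v₀ , true) ∷ []) ∷
       ((v₂ , false) ∷ (v₂ ⊕ v₀ , false) ∷ []) ∷ ((v₂ , true) ∷ (v₂ ⊕ v₀ , true) ∷ []) ∷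
       ((v₁ ⊕ v₂ , false) ∷ (v₁ ⊕ v₂ ⊕ v₀ , true) ∷ []) ∷
       ((v₁ ⊕ v₂ , true) ∷ (v₁ ⊕ v₂ ⊕ v₀ , false) ∷ []) ∷ [])
      H-tree refl f f0 cf (λ _ → n5) (x ∷ u ∷ v ∷ []) fx
  ... | inj₁ (p , q) = false≢true (cong₂ _xor_ p q) hu
  ... | inj₂ (inj₁ (p , q)) = false≢true (cong₂ _xor_ p q) hu
  ... | inj₂ (inj₂ (inj₁ (p , q))) = false≢true (cong₂ _xor_ p q) hv
  ... | inj₂ (inj₂ (inj₂ (inj₁ (p , q)))) = false≢true (cong₂ _xor_ p q) hv
  ... | inj₂ (inj₂ (inj₂ (inj₂ (inj₁ (p , q))))) = cong₂ _xor_ p q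
  ... | inj₂ (inj₂ (inj₂ (inj₂ (inj₂ (p , q))))) = cong₂ _xor_ p q

  H : ∀ x → f x ≡ true → Subspace n
  H x fx = record
    { In = λ u → h x u ≡ true ; in? = λ u → h x u ≟b true
    ; in-0 = cong₂ _xor_ f0 (trans (cong f (+v-identityˡ x)) fx)
    ; in-+ = λ {u} {v} → H-closed x fx {u} {v} }

  -- y and z are independent modulo `H x`, which witnesses that `H x` has codimension at least 2 in
  -- the span of the ground set.
  Triple : Vector n → Vector n → Vector n → Set
  Triple x y z = f x ≡ true × f y ≡ true × f z ≡ true × h x y ≡ false × h x z ≡ false × h x (z +v y) ≡ false

  triple? : ∀ x y z → Dec (Triple x y z)
  triple? x y z = f x ≟b true ×-dec f y ≟b true ×-dec f z ≟b true ×-dec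
                  h x y ≟b false ×-dec h x z ≟b false ×-dec h x (z +v y) ≟b false

  module Affine (none : ∀ x y z → ¬ Triple x y z) where

    S : Subspace n
    S = ⟨ support f ⟩

    S⊇ : ∀ v → f v ≡ true → In S v
    S⊇ v fv = span-∈ (support f) (support⁺ f fv)

    -- Without triples `H x` has codimension at most 1 in S: either it contains the ground set, or
    -- the ground set lies in the union of `H x` and y + `H x` for one y, and that union is a
    -- subspace. So 1 + `h x` is linear on S.
    affine : ∀ x → f x ≡ true → ∀ u v → In S u → In S v → h x u xor h x v xor h x (u +v v) ≡ true
    affine x fx u v Su Sv with any? (λ y → f y ≟b true ×-dec h x y ≟b false)
    ... | no all-H = cong₂ _xor_ (S⊆H u Su) (cong₂ _xor_ (S⊆H v Sv) (H-closed x fx {u} {v} (S⊆H u Su) (S⊆H v Sv)))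
      where
      E⊆H : ∀ {e} → f e ≡ true → h x e ≡ true
      E⊆H {e} fe = ≢false⇒≡true (λ he → all-H (e , fe , he))
      S⊆H : ∀ v → In S v → h x v ≡ true
      S⊆H = span-induction (λ v → h x v ≡ true) (support f) (in-0 (H x fx))
        (λ {e} {v} e∈ hv → H-closed x fx {v} {e} hv (E⊆H (support⁻ f e∈)))
    ... | yes (y , fy , hy) = finish (h x u) (h x v) (h x (u +v v)) refl refl refl
      where
      H∪ : Vector n → Set
      H∪ v = h x v ≡ true ⊎ h x (v +v y) ≡ true
      H∪-+ : ∀ {v e} → H∪ v → H∪ e → H∪ (v +v e)
      H∪-+ {v} {e} (inj₁ p) (inj₁ q) = inj₁ (H-closed x fx {v} {e} p q)
      H∪-+ {v} {e} (inj₁ p) (inj₂ q) = inj₂ (trans (cong (h x) (+v-assoc v e y)) (H-closed x fx {v} {e +v y} p q))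
      H∪-+ {v} {e} (inj₂ p) (inj₁ q) = inj₂ (trans (cong (h x)
        (solve (v ∷ e ∷ y ∷ []) (v₀ ⊕ v₁ ⊕ v₂) (v₀ ⊕ v₂ ⊕ v₁) refl)) (H-closed x fx {v +v y} {e} p q))
      H∪-+ {v} {e} (inj₂ p) (inj₂ q) = inj₁ (trans (cong (h x)
        (solve (v ∷ e ∷ y ∷ []) (v₀ ⊕ v₁) (v₀ ⊕ v₂ ⊕ (v₁ ⊕ v₂)) refl)) (H-closed x fx {v +v y} {e +v y} p q))
      E⊆ : ∀ {e} → f e ≡ true → H∪ e
      E⊆ {e} fe with h x e in he | h x (e +v y) in hey
      ... | true | _ = inj₁ refl
      ... | false | true = inj₂ refl
      ... | false | false = ⊥-elim (none x y e (fx , fy , fe , hy , he , hey))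
      S⊆ : ∀ v → In S v → H∪ v
      S⊆ = span-induction H∪ (support f) (inj₁ (in-0 (H x fx)))
        (λ {e} {v} e∈ p → H∪-+ {v} {e} p (E⊆ (support⁻ f e∈)))
      shifted : ∀ v → In S v → h x v ≡ false → h x (v +v y) ≡ true
      shifted v Sv hv with S⊆ v Sv
      ... | inj₁ p = false≢true hv p
      ... | inj₂ p = p
      finish : ∀ a b c → h x u ≡ a → h x v ≡ b → h x (u +v v) ≡ c → a xor b xor c ≡ true
      finish true true true _ _ _ = refl
      finish true true false p q r = ⊥-elim (false≢true r (H-closed x fx {u} {v} p q))
      finish true false false _ _ _ = refl
      finish true false true p q r = ⊥-elim (false≢true q
        (trans (cong (h x) (sym (cancelˡ u v))) (H-closed x fx {u} {u +v v} p r)))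
      finish false true false _ _ _ = refl
      finish false true true p q r = ⊥-elim (false≢true p
        (trans (cong (h x) (sym (cancel u v))) (H-closed x fx {u +v v} {v} r q)))
      finish false false true _ _ _ = refl
      finish false false false p q r = ⊥-elim (false≢true r (trans
        (cong (h x) (solve (u ∷ v ∷ y ∷ []) (v₀ ⊕ v₁) (v₀ ⊕ v₂ ⊕ (v₁ ⊕ v₂)) refl))
        (H-closed x fx {u +v y} {v +v y} (shifted u Su p) (shifted v Sv q))))

    -- The vectors whose derivative h is affine on S form a subspace, by
    -- h (v + x) u = h v u + h x (u + v).
    Aff : Vector n → Set
    Aff v = In S v × (∀ a b → In S a → In S b → h v a xor h v b xor h v (a +v b) ≡ f v)

    aff-0 : Aff 0v
    aff-0 = in-0 S , λ a b _ _ → trans (cong₂ _xor_ (h-0 a) (cong₂ _xor_ (h-0 b) (h-0 (a +v b)))) (sym f0)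
      where
      h-0 : ∀ a → h 0v a ≡ false
      h-0 a = trans (cong (λ z → f a xor f z) (+v-identityʳ a)) (xor-same (f a))

    aff-step : ∀ {x v} → f x ≡ true → Aff v → Aff (v +v x)
    aff-step {x} {v} fx (Sv , A) = in-+ S Sv (S⊇ x fx) , λ a b Sa Sb →
      let ha = h x (a +v v) ; hb = h x (b +v v) ; hab = h x (a +v b +v v) ; g = h x (a +v b) in begin
      h (v +v x) a xor h (v +v x) b xor h (v +v x) (a +v b) ≡⟨
        cong₂ _xor_ (h-+ a) (cong₂ _xor_ (h-+ b) (h-+ (a +v b))) ⟩
      (h v a xor ha) xor (h v b xor hb) xor (h v (a +v b) xor hab) ≡⟨
        solveᵇ (h v a ∷ ha ∷ h v b ∷ hb ∷ h v (a +v b) ∷ hab ∷ [])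
          ((v₀ ⊕ v₁) ⊕ ((v₂ ⊕ v₃) ⊕ (v₄ ⊕ v₅))) ((v₀ ⊕ (v₂ ⊕ v₄)) ⊕ (v₁ ⊕ v₃ ⊕ v₅)) refl ⟩
      (h v a xor h v b xor h v (a +v b)) xor ((ha xor hb) xor hab) ≡⟨ cong (_xor ((ha xor hb) xor hab)) (A a b Sa Sb) ⟩
      -- Inserting `g` and `h x v` twice each completes two instances of `affine`; both are 1 and
      -- cancel.
      f v xor ((ha xor hb) xor hab) ≡⟨ cong (f v xor_)
        (solveᵇ (ha ∷ hb ∷ hab ∷ g ∷ h x v ∷ []) (v₀ ⊕ v₁ ⊕ v₂) ((v₀ ⊕ (v₁ ⊕ v₃)) ⊕ (v₃ ⊕ (v₄ ⊕ v₂)) ⊕ v₄) refl) ⟩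
      f v xor (((ha xor hb xor g) xor (g xor h x v xor hab)) xor h x v) ≡⟨
        cong (λ z → f v xor (z xor h x v)) (cong₂ _xor_ (first a b Sa Sb) (affine x fx (a +v b) v (in-+ S Sa Sb) Sv)) ⟩
      f v xor h x v ≡⟨ solveᵇ (f v ∷ f (v +v x) ∷ []) (v₀ ⊕ (v₀ ⊕ v₁)) v₁ refl ⟩
      f (v +v x) ∎
      where
      h-+ : ∀ a → h (v +v x) a ≡ h v a xor h x (a +v v)
      h-+ a = trans (cong (λ z → f a xor f z) (sym (+v-assoc a v x)))
        (solveᵇ (f a ∷ f (a +v v +v x) ∷ f (a +v v) ∷ []) (v₀ ⊕ v₁) ((v₀ ⊕ v₂) ⊕ (v₂ ⊕ v₁)) refl)
      first : ∀ a b → In S a → In S b → h x (a +v v) xor h x (b +v v) xor h x (a +v b) ≡ true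
      first a b Sa Sb = trans
        (cong (λ z → h x (a +v v) xor h x (b +v v) xor h x z)
              (solve (a ∷ b ∷ v ∷ []) (v₀ ⊕ v₁) (v₀ ⊕ v₂ ⊕ (v₁ ⊕ v₂)) refl))
        (affine x fx (a +v v) (b +v v) (in-+ S Sa Sv) (in-+ S Sb Sv))

    evenOn : EvenOn f (In S)
    evenOn a b c Sa Sb Sc = begin
      f (a +v b +v c) ≡⟨ solveᵇ (f a ∷ f b ∷ f (a +v b) ∷ f (a +v c) ∷ f (b +v c) ∷ f (a +v b +v c) ∷ [])
        v₅ (((v₀ ⊕ v₃) ⊕ ((v₁ ⊕ v₄) ⊕ (v₂ ⊕ v₅))) ⊕ (v₀ ⊕ v₁ ⊕ v₂ ⊕ v₃ ⊕ v₄)) refl ⟩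
      (h c a xor h c b xor h c (a +v b)) xor ((((f a xor f b) xor f (a +v b)) xor f (a +v c)) xor f (b +v c)) ≡⟨
        cong (_xor ((((f a xor f b) xor f (a +v b)) xor f (a +v c)) xor f (b +v c))) (proj₂ (all-Aff c Sc) a b Sa Sb) ⟩
      f c xor ((((f a xor f b) xor f (a +v b)) xor f (a +v c)) xor f (b +v c)) ≡⟨
        solveᵇ (f a ∷ f b ∷ f c ∷ f (a +v b) ∷ f (a +v c) ∷ f (b +v c) ∷ [])
          (v₂ ⊕ (v₀ ⊕ v₁ ⊕ v₃ ⊕ v₄ ⊕ v₅)) (v₀ ⊕ (v₁ ⊕ (v₂ ⊕ (v₃ ⊕ (v₄ ⊕ v₅))))) refl ⟩
      f a xor f b xor f c xor f (a +v b) xor f (a +v c) xor f (b +v c) ∎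
      where
      all-Aff : ∀ v → In S v → Aff v
      all-Aff = span-induction Aff (support f) aff-0 (λ e∈ A → aff-step (support⁻ f e∈) A)

  -- The zeros in R = H x ∩ H y form a subspace Z, and no flat in the ground set
  -- meets both R and its complement.  A flat avoiding R extends by x if a functional
  -- vanishing on R but not at x vanishes on it; a flat inside R extends by any d₀ in
  -- R ∖ Z if a functional vanishing on Z but not at d₀ vanishes on it.
  module Triples {x y z : Vector n} (fx : f x ≡ true) (fy : f y ≡ true) (fz : f z ≡ true)
                 (hy : h x y ≡ false) (hz : h x z ≡ false) (hzy : h x (z +v y) ≡ false) where

    private
      h-false : ∀ {x u} → f u ≡ true → h x u ≡ false → f (u +v x) ≡ true
      h-false {x} {u} fu e with f u | f (u +v x)
      h-false refl () | true | false
      h-false refl refl | true | true = refl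

      fyx : f (y +v x) ≡ true
      fyx = h-false fy hy

      fzx : f (z +v x) ≡ true
      fzx = h-false fz hz

      -- By the hypothesis on z + y, the vectors z + y and z + y + x are both points or both zeros.
      -- If both were zeros, the span of x, y, z would be a plane with exactly five points.
      fzy : f (z +v y) ≡ true × f (z +v y +v x) ≡ true
      fzy with certifiedₑ true
        ((v₀ , true) ∷ (v₁ , true) ∷ (v₁ ⊕ v₀ , true) ∷ (v₂ , true) ∷ (v₂ ⊕ v₀ , true) ∷ [])
        (((v₂ ⊕ v₁ , true) ∷ (v₂ ⊕ v₁ ⊕ v₀ , true) ∷ []) ∷
         ((v₂ ⊕ v₁ , true) ∷ (v₂ ⊕ v₁ ⊕ v₀ , false) ∷ []) ∷
         ((v₂ ⊕ v₁ , false) ∷ (v₂ ⊕ v₁ ⊕ v₀ , true) ∷ []) ∷ [])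
        xyz-tree refl f f0 cf (λ _ → n5) (x ∷ y ∷ z ∷ []) (fx , fy , fyx , fz , fzx)
      ... | inj₁ p = p
      ... | inj₂ (inj₁ (p , q)) = false≢true hzy (cong₂ _xor_ p q)
      ... | inj₂ (inj₂ (p , q)) = false≢true hzy (cong₂ _xor_ p q)

      flat-lits : ∀ {m} → Lits (Expr (suc (suc (suc m))))
      flat-lits = (v₀ , true) ∷ (v₁ , true) ∷ (v₁ ⊕ v₀ , true) ∷ (v₂ , true) ∷ (v₂ ⊕ v₀ , true) ∷
                  (v₂ ⊕ v₁ , true) ∷ (v₂ ⊕ v₁ ⊕ v₀ , true) ∷ []

    R : Subspace n
    R = record
      { In = λ u → h x u ≡ true × h y u ≡ true
      ; in? = λ u → h x u ≟b true ×-dec h y u ≟b true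
      ; in-0 = in-0 (H x fx) , in-0 (H y fy)
      ; in-+ = λ {u} {v} p q → H-closed x fx {u} {v} (proj₁ p) (proj₁ q) ,
                               H-closed y fy {u} {v} (proj₂ p) (proj₂ q) }

    h-zero : ∀ {x u} → f u ≡ false → h x u ≡ true → f (u +v x) ≡ true
    h-zero {x} {u} fu e with f u
    h-zero refl e | false = e

    h-one : ∀ {x u} → f u ≡ true → h x u ≡ true → f (u +v x) ≡ false
    h-one {x} {u} fu e with f u | f (u +v x)
    h-one refl e | true | false = refl
    h-one refl () | true | true

    Z : Subspace n
    Z = record
      { In = λ u → f u ≡ false × In R u
      ; in? = λ u → f u ≟b false ×-dec in? R u
      ; in-0 = f0 , in-0 R
      ; in-+ = λ {u} {v} (fu , Ru) (fv , Rv) →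
          certifiedₑ true
            ((v₃ , false) ∷ (v₃ ⊕ v₀ , true) ∷ (v₃ ⊕ v₁ , true) ∷
             (v₄ , false) ∷ (v₄ ⊕ v₀ , true) ∷ (v₄ ⊕ v₁ , true) ∷ flat-lits)
            (((v₃ ⊕ v₄ , false) ∷ []) ∷ []) Z-tree refl f f0 cf (λ _ → n5)
            (x ∷ y ∷ z ∷ u ∷ v ∷ [])
            (fu , h-zero fu (proj₁ Ru) , h-zero fu (proj₂ Ru) ,
             fv , h-zero fv (proj₁ Rv) , h-zero fv (proj₂ Rv) ,
             fx , fy , fyx , fz , fzx , fzy) ,
          in-+ R Ru Rv }

    mixed : ∀ {d e} → f d ≡ true → In R d → f e ≡ true → ¬ In R e → f (e +v d) ≡ false
    mixed {d} {e} fd (Rx , Ry) fe e∉R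
      with certifiedₑ true
        ((v₃ , true) ∷ (v₃ ⊕ v₀ , false) ∷ (v₃ ⊕ v₁ , false) ∷ (v₄ , true) ∷ flat-lits)
        (((v₄ ⊕ v₀ , false) ∷ (v₄ ⊕ v₁ , false) ∷ []) ∷ ((v₄ ⊕ v₃ , false) ∷ []) ∷ [])
        mixed-tree refl f f0 cf (λ _ → n5) (x ∷ y ∷ z ∷ d ∷ e ∷ [])
        (fd , h-one fd Rx , h-one fd Ry , fe , fx , fy , fyx , fz , fzx , fzy)
    ... | inj₁ (p , q) = ⊥-elim (e∉R (cong₂ _xor_ fe p , cong₂ _xor_ fe q))
    ... | inj₂ p = p

    -- A zero at e + x would put e + x into `R`: as e is not in `R`, e + y is then a point, and
    -- without a five-point plane in the span of x, y, e the vector e + x + y is a point as well.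
    outside : ∀ {e} → f e ≡ true → ¬ In R e → ¬ In R (e +v x) → f (e +v x) ≡ true
    outside {e} fe e∉R ex∉R = go _ _ refl refl
      where
      go : ∀ a b → f (e +v x) ≡ a → f (e +v y) ≡ b → f (e +v x) ≡ true
      go true _ fex _ = fex
      go false false fex fey = ⊥-elim (e∉R (cong₂ _xor_ fe fex , cong₂ _xor_ fe fey))
      go false true fex fey = ⊥-elim (ex∉R
        ( cong₂ _xor_ fex (trans (cong f (cancel e x)) fe)
        , cong₂ _xor_ fex (certifiedₑ true
            ((v₀ , true) ∷ (v₁ , true) ∷ (v₁ ⊕ v₀ , true) ∷ (v₂ , true) ∷ (v₂ ⊕ v₀ , false) ∷
             (v₂ ⊕ v₁ , true) ∷ [])
            (((v₂ ⊕ v₀ ⊕ v₁ , true) ∷ []) ∷ []) outside-tree refl f f0 cf (λ _ → n5) (x ∷ y ∷ e ∷ [])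
            (fx , fy , fyx , fe , fex , fey))))

    x∉R : ¬ In R x
    x∉R (_ , p) = false≢true (cong₂ _xor_ fx (trans (cong f (+v-comm x y)) fyx)) p

    module _ {d : ℕ} (v : Vector n) (vs : Vec (Vector n) d) (S : Solid f (v ∷ vs)) where

      private
        fv : f v ≡ true
        fv = trans (cong f (sym (trans (cong (v +v_) (lin-0 vs)) (+v-identityʳ v)))) (S (true ∷ 0v) refl)

      sum-in-flat : ∀ c → isZero c ≡ false → ¬ lin (v ∷ vs) c ≡ v → f (lin (v ∷ vs) c +v v) ≡ true
      sum-in-flat c nz ≢v = trans (cong f (begin
        lin (v ∷ vs) c +v v ≡⟨ cong (lin (v ∷ vs) c +v_) (trans (cong (v +v_) (lin-0 vs)) (+v-identityʳ v)) ⟨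
        lin (v ∷ vs) c +v lin (v ∷ vs) (true ∷ 0v) ≡⟨ lin-linear (v ∷ vs) c (true ∷ 0v) ⟨
        lin (v ∷ vs) (c +v (true ∷ 0v)) ∎)) (S (c +v (true ∷ 0v)) (≢⇒isZero _ λ eq →
          ≢v (trans (cong (lin (v ∷ vs)) (+v≡0⇒≡ c (true ∷ 0v) eq)) (trans (cong (v +v_) (lin-0 vs)) (+v-identityʳ v)))))

      all-in : In R v → ∀ c → isZero c ≡ false → In R (lin (v ∷ vs) c)
      all-in Rv c nz with in? R (lin (v ∷ vs) c)
      ... | yes p = p
      ... | no ∉R = ⊥-elim (false≢true (mixed fv Rv (S c nz) ∉R)
                      (sum-in-flat c nz λ eq → ∉R (subst (In R) (sym eq) Rv)))

      all-out : ¬ In R v → ∀ c → isZero c ≡ false → ¬ In R (lin (v ∷ vs) c)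
      all-out v∉R c nz p = false≢true
        (trans (cong f (+v-comm (lin (v ∷ vs) c) v)) (mixed (S c nz) p fv v∉R))
        (sum-in-flat c nz λ eq → v∉R (subst (In R) eq p))

      extend-out : ¬ In R v → (ϕ : Functional n) → LinearF ϕ → (∀ w → In R w → ϕ w ≡ false) → ϕ x ≡ true →
                   (∀ c → ϕ (lin (v ∷ vs) c) ≡ false) → Solid f (x ∷ v ∷ vs)
      extend-out v∉R ϕ L ϕR ϕx ϕvs = solid-∷ f x (v ∷ vs) fx S λ c nz →
        trans (cong f (+v-comm x _)) (outside (S c nz) (all-out v∉R c nz)
          λ p → false≢true (ϕR _ p) (trans (L _ x) (cong₂ _xor_ (ϕvs c) ϕx)))

      extend-in : In R v → ∀ {d₀} → f d₀ ≡ true → In R d₀ → (ϕ : Functional n) → LinearF ϕ →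
                  (∀ w → In Z w → ϕ w ≡ false) → ϕ d₀ ≡ true →
                  (∀ c → ϕ (lin (v ∷ vs) c) ≡ false) → Solid f (d₀ ∷ v ∷ vs)
      extend-in Rv {d₀} fd Rd ϕ L ϕZ ϕd ϕvs = solid-∷ f d₀ (v ∷ vs) fd S λ c nz →
        ≢false⇒≡true λ e → false≢true (ϕZ _ (e , in-+ R Rd (all-in Rv c nz)))
          (trans (L d₀ _) (cong₂ _xor_ ϕd (ϕvs c)))

    -- When `R` contains no point of the ground set, the zero functional serves vacuously; otherwise
    -- any point of `R` is separated from `Z`.
    second : Σ (Functional n) λ ψ → LinearF ψ × (∀ w → In Z w → ψ w ≡ false) ×
             (∀ {v} → f v ≡ true → In R v → Σ (Vector n) λ d₀ → f d₀ ≡ true × In R d₀ × ψ d₀ ≡ true)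
    second with any? (λ d → f d ≟b true ×-dec in? R d)
    ... | no none = (λ _ → false) , (λ _ _ → refl) , (λ _ _ → refl) , λ {v} fv Rv → ⊥-elim (none (v , fv , Rv))
    ... | yes (d₀ , fd , Rd) with separate Z d₀ (λ p → false≢true (proj₁ p) fd)
    ... | ψ , Lψ , ψZ , ψd = ψ , Lψ , ψZ , λ _ _ → d₀ , fd , Rd , ψd

    outcome : Outcome 2 f
    outcome with separate R x x∉R | second
    ... | ϕ , Lϕ , ϕR , ϕx | ψ , Lψ , ψZ , ψd = extending whole U (λ _ _ → _) codim extend
      where
      U : Subspace n
      U = record
        { In = λ v → ϕ v ≡ false × ψ v ≡ false
        ; in? = λ v → ϕ v ≟b false ×-dec ψ v ≟b false
        ; in-0 = LinearF-0 ϕ Lϕ , LinearF-0 ψ Lψ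
        ; in-+ = λ {u} {v} (a , b) (c , d) → trans (Lϕ u v) (cong₂ _xor_ a c) , trans (Lψ u v) (cong₂ _xor_ b d) }
      codim : ∀ m (χ : Vector m → Vector n) → Linear χ → (∀ w → In (whole {n}) (χ w)) →
              (∀ w → In U (χ w) → w ≡ 0v) → m ≤ 2
      codim m χ Lχ _ ker = trivial-kernel⇒≤ (λ w → ϕ (χ w) ∷ ψ (χ w) ∷ [])
        (λ u w → cong₂ (λ a b → a ∷ b ∷ []) (trans (cong ϕ (Lχ u w)) (Lϕ _ _)) (trans (cong ψ (Lχ u w)) (Lψ _ _)))
        (λ w e → ker w (cong head e , cong (λ { (_ ∷ b ∷ []) → b }) e))
      extend : ∀ {d} (vs : Vec (Vector n) d) → Solid f vs → (∀ c → In U (lin vs c)) →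
               Σ (Vec (Vector n) (suc d)) (Solid f)
      extend [] S _ = x ∷ [] , λ { (true ∷ []) _ → trans (cong f (+v-identityʳ x)) fx }
      extend (v ∷ vs) S inU with in? R v
      ... | no v∉R = x ∷ v ∷ vs , extend-out v vs S v∉R ϕ Lϕ ϕR ϕx (λ c → proj₁ (inU c))
      ... | yes Rv with ψd
              (trans (cong f (sym (trans (cong (v +v_) (lin-0 vs)) (+v-identityʳ v)))) (S (true ∷ 0v) refl)) Rv
      ... | d₀ , fd , Rd , ψd₀ = d₀ ∷ v ∷ vs ,
        extend-in v vs S Rv fd Rd ψ Lψ ψZ ψd₀ (λ c → proj₂ (inU c))

  no5-outcome : Outcome 2 f
  no5-outcome with any? (λ x → any? (λ y → any? (triple? x y)))
  ... | yes (x , y , z , fx , fy , fz , hy , hz , hzy) = Triples.outcome {x} {y} {z} fx fy fz hy hz hzy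
  ... | no none = even S S⊇ evenOn
    where open Affine (λ x y z t → none (x , y , z , t))

-- Local configurations

-- At t = 0 a harmless literal about `0v` is substituted, so that conditions on nonzero t can still
-- be listed over all t by `every`.
nonzero : ∀ {m k} → (Vector k → Vector m × Bool) → Vector k → Vector m × Bool
nonzero h t with isZero t
... | true = 0v , false
... | false = h t

nonzero-intro : ∀ {m k} (g : Vector m → Bool) (h : Vector k → Vector m × Bool) → g 0v ≡ false →
                (∀ t → isZero t ≡ false → g (proj₁ (h t)) ≡ proj₂ (h t)) →
                ∀ t → g (proj₁ (nonzero h t)) ≡ proj₂ (nonzero h t)
nonzero-intro g h g0 p t with isZero t in eq
... | true = g0
... | false = p t eq

nonzero-elim : ∀ {m k} (g : Vector m → Bool) (h : Vector k → Vector m × Bool) →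
               (∀ t → g (proj₁ (nonzero h t)) ≡ proj₂ (nonzero h t)) →
               ∀ t → isZero t ≡ false → g (proj₁ (h t)) ≡ proj₂ (h t)
nonzero-elim g h p t nz with isZero t | p t
nonzero-elim g h p t refl | false | q = q

-- The local analysis is relative to a k-dimensional subspace T on which f
-- is known to be τ.  A coset a + T is called neutral when f (a + t) = τ t for all
-- nonzero t ∈ T.
module _ {k : ℕ} (τ : Vector k → Bool) where

  -- The leading coordinate tells a + T from T. The third alternative is neutrality of a + r; thus a
  -- nonempty coset with zeros at a and a + r has a neutral zero among these two.
  Zero-or-neutral : Vector k → Set
  Zero-or-neutral r = (g : Vector (suc k) → Bool) → CF g → (∀ t → g (false ∷ t) ≡ τ t) →
    g (true ∷ 0v) ≡ false → g (true ∷ r) ≡ false →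
    (∀ t → g (true ∷ t) ≡ false) ⊎
    (∀ t → isZero t ≡ false → g (true ∷ t) ≡ τ t) ⊎
    (∀ t → isZero t ≡ false → g (true ∷ (t +v r)) ≡ τ t)

  -- Applied contrapositively: a coset that meets the ground set without lying in it carries empty
  -- cosets to empty cosets.
  Full-coset : Set
  Full-coset = (g : Vector (suc (suc k)) → Bool) → CF g → (∀ t → g (false ∷ false ∷ t) ≡ τ t) →
    g (true ∷ false ∷ 0v) ≡ true → g (false ∷ true ∷ 0v) ≡ true →
    (∀ t → g (true ∷ true ∷ t) ≡ false) → ∀ t → g (false ∷ true ∷ t) ≡ true

  -- This lets neutral zeros act by translation on the set of all neutral vectors.
  Neutral-sum : Set
  Neutral-sum = (g : Vector (suc (suc k)) → Bool) → CF g → (∀ t → g (false ∷ false ∷ t) ≡ τ t) →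
    (∀ t → isZero t ≡ false → g (true ∷ false ∷ t) ≡ τ t) →
    (∀ t → isZero t ≡ false → g (false ∷ true ∷ t) ≡ τ t) → g (false ∷ true ∷ 0v) ≡ false →
    ∀ t → isZero t ≡ false → g (true ∷ true ∷ t) ≡ τ t

  private
    base₁ : Lits (Vector (suc k))
    base₁ = every λ t → false ∷ t , τ t

    base₂ : Lits (Vector (suc (suc k)))
    base₂ = every λ t → false ∷ false ∷ t , τ t

    hyps₁ : Vector k → Lits (Vector (suc k))
    hyps₁ r = (true ∷ 0v , false) ∷ (true ∷ r , false) ∷ base₁

    goals₁ : Vector k → List (Lits (Vector (suc k)))
    goals₁ r = every (λ t → true ∷ t , false) ∷
               every (nonzero λ t → true ∷ t , τ t) ∷
               every (nonzero λ t → true ∷ (t +v r) , τ t) ∷ []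

    empty : Vector k → Vector (suc (suc k)) × Bool
    empty t = true ∷ true ∷ t , false

    hyps₂ : Lits (Vector (suc (suc k)))
    hyps₂ = (true ∷ false ∷ 0v , true) ∷ (false ∷ true ∷ 0v , true) ∷
            (every empty ++ₗ base₂)

    goals₂ : List (Lits (Vector (suc (suc k))))
    goals₂ = every (λ t → false ∷ true ∷ t , true) ∷ []

    n₁ n₂ : Vector k → Vector (suc (suc k)) × Bool
    n₁ = nonzero λ t → true ∷ false ∷ t , τ t
    n₂ = nonzero λ t → false ∷ true ∷ t , τ t

    hyps₃ : Lits (Vector (suc (suc k)))
    hyps₃ = (false ∷ true ∷ 0v , false) ∷ (every n₁ ++ₗ (every n₂ ++ₗ base₂))

    goals₃ : List (Lits (Vector (suc (suc k))))
    goals₃ = every (nonzero λ t → true ∷ true ∷ t , τ t) ∷ []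

  zero-or-neutral : τ 0v ≡ false → ∀ r t → check false (goals₁ r) (assign ∅ (hyps₁ r)) t ≡ true →
                    Zero-or-neutral r
  zero-or-neutral τ0 r t ok g cf b a₀ aᵣ
    with certified (hyps₁ r) (goals₁ r) t ok g cf
           (holds-∷ g _ a₀ (holds-∷ g _ aᵣ (holds-every g _ b)))
  ... | inj₁ h = inj₁ (every-holds g _ h)
  ... | inj₂ (inj₁ h) = inj₂ (inj₁ (nonzero-elim g _ (every-holds g _ h)))
  ... | inj₂ (inj₂ h) = inj₂ (inj₂ (nonzero-elim g _ (every-holds g _ h)))

  full-coset : ∀ t → check false goals₂ (assign ∅ hyps₂) t ≡ true → Full-coset
  full-coset t ok g cf b ea eb z =
    every-holds g _ (certified hyps₂ goals₂ t ok g cf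
      (holds-∷ g _ ea (holds-∷ g _ eb
        (holds-++ g (every empty) base₂ (holds-every g empty z) (holds-every g _ b)))))

  neutral-sum : τ 0v ≡ false → ∀ t → check false goals₃ (assign ∅ hyps₃) t ≡ true → Neutral-sum
  neutral-sum τ0 t ok g cf b na nb zb =
    nonzero-elim g _ (every-holds g _ (certified hyps₃ goals₃ t ok g cf
      (holds-∷ g _ zb
        (holds-++ g (every n₁) _ (holds-every g n₁ (nonzero-intro g _ g0 na))
          (holds-++ g (every n₂) base₂ (holds-every g n₂ (nonzero-intro g _ g0 nb)) (holds-every g _ b))))))
    where
    g0 : g 0v ≡ false
    g0 = trans (b 0v) τ0

-- All that the global argument needs from a pattern. The zeros `r i` number four because a triangle
-- has three points; `top` is the vector by which flats will be extended.
record Template : Set where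
  field
    {k} : ℕ
    τ : Vector k → Bool
    τ0 : τ 0v ≡ false
    top : Vector k
    τ-top : τ top ≡ true
    r : Fin 4 → Vector k
    r-zero : ∀ i → τ (r i) ≡ false
    r-sum : ∀ i j → ¬ i ≡ j → τ (r i +v r j) ≡ true
    zero∣neutral : ∀ i → Zero-or-neutral τ (r i)
    full : Full-coset τ
    sum : Neutral-sum τ

-- Certificates for the local statements of the three templates

tree₁a₀ : Tree
tree₁a₀ =
  split 15 (split 13 (split 23 (split 21 (split 27 (split 25 (split 29 (split 11 (split 19 (split 5 (split 17
  (split 9 (split 7 (split 31 goal (basis 20 22 31)) (basis 7 20 22)) (basis 9 12 28)) (basis 12 17 28)) (basis 5
  18 22)) (basis 10 18 19)) (basis 11 18 22)) (split 5 (basis 10 18 29) (basis 5 28 29))) (basis 20 22 25)) (basis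
  14 22 27)) (basis 20 21 22)) (split 21 (basis 20 22 23) (basis 21 23 26))) (basis 12 13 14)) (split 13 (basis 12
  14 15) (split 9 (split 11 (basis 6 13 15) (basis 8 10 11)) (split 11 (basis 8 9 10) (split 21 (split 23 (basis
  13 15 26) (basis 20 22 23)) (split 23 (basis 20 21 22) (split 17 (split 19 (basis 13 15 28) (split 31 (split 5
  (split 7 (basis 19 20 23) (split 25 (split 27 (basis 11 15 20) (split 29 (basis 13 15 18) goal)) (basis 8 9
  25))) (basis 5 20 21)) (basis 14 15 31))) (split 31 (basis 14 15 17) (split 5 (basis 17 20 21) (split 19 (split
  27 (split 25 (basis 10 11 18) (split 7 (split 29 goal (basis 28 29 31)) (basis 7 28 31))) (basis 8 11 27))
  (basis 17 18 19))))))))))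

tree₁a₁ : Tree
tree₁a₁ =
  split 13 (split 9 (split 11 (split 3 (split 15 (split 7 (split 19 (split 21 (split 25 (split 27 (split 31
  (split 29 (split 17 (split 23 goal (basis 20 22 23)) (basis 17 20 22)) (basis 20 22 29)) (basis 18 22 31))
  (basis 20 22 27)) (basis 12 25 28)) (basis 6 21 22)) (split 17 (basis 19 20 22) (basis 17 19 28))) (basis 7 12
  14)) (basis 12 14 15)) (basis 3 8 10)) (split 15 (basis 10 11 14) (basis 6 11 15))) (basis 8 9 12)) (split 9
  (basis 8 12 13) (split 11 (split 15 (basis 6 9 13) (basis 10 14 15)) (split 15 (basis 10 11 14) (split 23
  (split 19 (basis 11 15 28) (basis 18 19 22)) (split 19 (basis 18 22 23) (split 21 (split 3 (basis 20 22 23)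
  (split 29 (split 17 (basis 12 13 28) (split 31 (basis 14 15 17) (split 27 (split 25 (basis 12 14 23) (split 7
  goal (basis 7 26 31))) (basis 26 27 31)))) (basis 8 13 29))) (split 7 (basis 18 21 23) (split 3 (split 27 (basis
  11 14 21) (split 17 (split 29 (basis 13 14 19) (split 25 (split 31 goal (basis 28 29 31)) (basis 25 28 29)))
  (basis 17 20 21))) (basis 3 6 7)))))))))

tree₁a₂ : Tree
tree₁a₂ =
  split 19 (split 5 (split 7 (split 23 (split 31 (split 11 (split 27 (split 15 (split 9 (split 13 (split 29
  (split 21 (split 25 (split 3 goal (basis 3 20 22)) (basis 20 22 25)) (basis 10 21 26)) (basis 20 22 29)) (basis
  13 18 22)) (basis 9 14 22)) (basis 10 15 20)) (basis 12 27 28)) (basis 11 12 20)) (split 27 (basis 8 12 31)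
  (basis 26 27 31))) (basis 18 22 23)) (basis 7 20 22)) (split 21 (split 7 (basis 5 20 22) (split 23 (basis 6 7
  22) (split 3 (basis 20 22 23) (split 31 (split 27 (basis 8 12 23) (basis 10 14 27)) (split 27 (basis 10 14 31)
  (split 25 (basis 8 10 27) (split 15 (split 13 (basis 12 20 25) (split 29 (basis 12 14 31) (split 11 (basis 20
  27 31) (split 9 goal (basis 9 13 28))))) (basis 14 15 31)))))))) (basis 5 20 21))) (split 3 (split 9 (split 27
  (split 13 (split 31 (basis 12 18 19) (basis 18 22 31)) (split 21 (basis 13 14 22) (basis 13 21 28))) (basis 10
  18 27)) (split 25 (split 27 (basis 9 10 18) (split 11 (basis 10 26 27) (split 21 (split 23 (basis 12 14 27)
  (basis 20 22 23)) (split 7 (basis 18 21 22) (split 15 (basis 11 21 26) (split 29 (basis 12 15 18) (split 13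
  (basis 12 28 29) (split 31 (split 5 (split 23 (basis 20 21 22) goal) (basis 5 28 29)) (basis 28 29 31)))))))))
  (basis 8 9 25))) (basis 3 18 19))

tree₁a₃ : Tree
tree₁a₃ =
  split 11 (split 19 (split 21 (split 7 (split 13 (split 31 (split 29 (split 17 (split 23 (split 15 (split 27
  (split 3 (split 9 (split 5 goal (basis 5 20 22)) (basis 9 20 22)) (basis 3 20 22)) (basis 20 22 27)) (basis 15
  18 22)) (basis 10 23 26)) (basis 12 17 28)) (split 5 (basis 14 22 29) (basis 5 28 29))) (basis 12 20 31)) (basis
  12 13 20)) (basis 7 12 18)) (split 13 (basis 12 20 21) (basis 6 13 21))) (basis 10 18 19)) (split 19 (basis 10
  11 18) (split 23 (split 15 (basis 11 19 28) (basis 14 15 22)) (split 15 (basis 14 22 23) (split 21 (split 13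
  (basis 15 23 26) (basis 12 13 20)) (split 13 (basis 12 20 21) (split 9 (split 27 (split 31 (basis 13 18 22)
  (split 3 (basis 10 19 26) (split 17 (basis 14 15 31) (split 5 (basis 17 20 21) (split 7 (split 29 goal (basis
  13 20 29)) (basis 7 14 23)))))) (basis 11 18 27)) (split 17 (split 29 (basis 12 13 28) (split 5 (split 27
  (basis 11 14 21) (split 7 (basis 19 20 22) (split 3 (split 31 goal (basis 28 29 31)) (basis 3 26 27)))) (basis 5
  28 29))) (basis 8 9 17))))))))

tree₂a : Tree
tree₂a =
  split 62 (split 61 (split 6 (split 5 (split 34 (split 33 (split 41 (split 21 (basis 1 20 40) (split 45 (basis
  1 40 44) (split 57 (basis 16 21 44) (split 10 (split 18 (basis 2 16 57) (basis 18 24 57)) (basis 10 40 45)))))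
  (split 46 (basis 2 41 44) (split 22 (basis 2 20 41) (split 54 (split 49 (basis 24 41 46) (basis 22 49 52))
  (basis 20 41 54))))) (basis 1 2 33)) (split 29 (basis 1 28 34) (basis 2 29 34))) (basis 1 2 5)) (split 58 (basis
  2 6 56) (basis 1 6 58))) (basis 1 2 61)) (split 61 (basis 1 2 62) (split 6 (split 5 (basis 56 61 62) (basis 1 2
  5)) (split 57 (basis 2 6 61) (split 5 (basis 2 57 62) (split 58 (basis 57 61 62) (split 9 (split 53 (basis 5 12
  57) (basis 6 53 58)) (split 53 (basis 6 9 58) (split 50 (basis 53 58 61) (split 14 (basis 9 57 62) (split 13
  (basis 14 61 62) (split 10 (basis 14 57 61) (split 54 (basis 53 61 62) (split 42 (split 37 (basis 28 54 57)
  (basis 5 10 37)) (split 26 (basis 13 42 61) (split 29 (basis 26 58 61) (split 34 (basis 42 53 61) (split 38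
  (basis 34 57 61) (split 30 (basis 29 61 62) (split 46 (basis 42 57 61) (split 22 (basis 30 53 61) (split 18
  (basis 29 50 61) goal)))))))))))))))))))))

tree₃a : Tree
tree₃a =
  split 43 (split 47 (basis 26 30 53) (basis 41 45 47)) (split 55 (basis 22 28 43) (split 19 (basis 26 43 56)
  (split 23 (basis 21 53 55) (split 39 (basis 21 23 37) (split 59 (basis 26 28 39) (split 15 (basis 39 40 46)
  (split 27 (basis 25 57 59) (split 35 (split 51 (split 63 (split 47 (basis 41 43 45) (split 31 (basis 29 45 47)
  (split 11 (split 7 goal (basis 7 57 59)) (basis 11 57 59)))) (basis 57 59 63)) (basis 51 57 59)) (basis 35 41
  43)))))))))

tree₁b₀ : Tree
tree₁b₀ =
  split 15 (split 13 (split 19 (split 17 (split 31 (split 29 (split 5 (split 11 (split 7 (split 23 (split 27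
  (split 25 (split 9 (split 21 goal (basis 21 28 30)) (basis 9 26 30)) (basis 25 28 30)) (basis 26 27 30)) (basis
  18 22 23)) (basis 7 20 22)) (basis 11 14 22)) (split 21 (basis 5 10 26) (basis 5 20 21))) (basis 28 29 30))
  (basis 14 30 31)) (basis 17 28 30)) (split 17 (basis 19 28 30) (basis 17 18 19))) (basis 12 13 14)) (split 13
  (basis 12 14 15) (split 23 (split 21 (basis 13 15 26) (basis 20 21 22)) (split 21 (basis 20 22 23) (split 5
  (split 29 (basis 8 13 21) (split 7 (basis 18 21 23) (split 9 (basis 8 12 13) (split 17 (split 11 (basis 10 14
  15) (split 25 (split 19 (basis 18 22 23) (split 31 (basis 28 29 30) (split 27 (basis 26 30 31) goal))) (basis
  25 28 29))) (basis 17 20 21))))) (split 17 (basis 5 20 21) (split 7 (split 19 (split 11 (basis 15 23 28)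
  (split 9 (basis 10 13 14) (split 31 (basis 12 15 28) (split 29 (basis 28 30 31) (split 25 (basis 26 29 30)
  (split 27 goal (basis 27 28 31))))))) (basis 19 20 23)) (basis 5 6 7)))))))

tree₁b₁ : Tree
tree₁b₁ =
  split 15 (split 11 (split 21 (split 31 (split 27 (split 17 (split 25 (split 23 (split 7 (split 9 (split 19
  (split 13 (split 3 (split 29 goal (basis 28 29 30)) (basis 3 20 22)) (basis 13 28 30)) (basis 19 20 22)) (basis
  9 28 30)) (basis 7 28 30)) (basis 14 22 23)) (split 9 (basis 12 25 28) (basis 9 18 25))) (basis 17 26 30)) (basis
  26 27 30)) (basis 10 26 31)) (split 17 (basis 21 26 30) (basis 17 20 21))) (basis 10 11 14)) (split 11 (basis 10
  14 15) (split 27 (split 31 (basis 11 15 20) (basis 26 30 31)) (split 31 (basis 26 27 30) (split 3 (split 25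
  (split 7 (basis 27 28 31) (split 19 (basis 10 11 18) (split 17 (split 29 (basis 28 30 31) (split 21 (basis 8 12
  29) (split 9 (basis 12 21 28) (split 13 (basis 12 28 29) (split 23 (basis 20 21 22) goal))))) (basis 17 18
  19)))) (basis 25 26 27)) (split 7 (split 9 (basis 11 12 14) (split 25 (basis 27 28 30) (split 29 (split 23
  (basis 10 15 18) (split 13 (basis 15 18 31) (split 17 (basis 12 13 28) (split 21 (split 19 (basis 18 22 23)
  goal) (basis 18 21 23))))) (basis 26 29 31)))) (basis 3 6 7))))))

tree₁b₂ : Tree
tree₁b₂ =
  split 15 (split 31 (split 19 (split 13 (split 3 (split 29 (split 25 (split 23 (split 5 (split 11 (split 9
  (split 27 (split 21 (split 7 goal (basis 7 28 30)) (basis 21 28 30)) (basis 26 27 30)) (basis 9 26 30)) (basis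
  11 18 22)) (basis 5 18 22)) (basis 14 22 23)) (split 27 (basis 20 22 25) (basis 25 26 27))) (basis 28 29 30))
  (basis 3 12 28)) (basis 13 28 30)) (split 3 (basis 12 19 28) (basis 3 18 19))) (basis 14 30 31)) (split 31 (basis
  14 15 30) (split 11 (split 27 (basis 15 20 31) (basis 10 26 27)) (split 27 (basis 10 11 26) (split 23 (split 7
  (basis 8 15 31) (basis 6 7 22)) (split 7 (basis 6 22 23) (split 19 (split 25 (basis 10 11 18) (split 5 (basis 18
  22 23) (split 9 (split 3 (basis 25 26 27) (split 13 (basis 23 26 30) (split 21 (split 29 (basis 12 14 31)
  goal) (basis 13 21 28)))) (basis 9 11 26)))) (split 9 (basis 11 19 26) (split 21 (basis 6 19 23) (split 5
  (split 13 (basis 8 9 12) (split 29 (basis 12 13 28) (split 25 (split 3 goal (basis 3 26 27)) (basis 25 28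
  29)))) (basis 5 20 21))))))))))

tree₁b₃ : Tree
tree₁b₃ =
  split 23 (split 15 (split 21 (split 13 (split 3 (split 27 (split 5 (split 29 (split 11 (split 19 (split 17
  (split 7 (split 31 (split 9 goal (basis 9 28 30)) (basis 28 30 31)) (basis 7 28 30)) (basis 17 28 30)) (basis 18
  19 22)) (basis 11 18 22)) (basis 10 18 29)) (split 29 (basis 5 10 18) (basis 5 28 29))) (basis 20 22 27)) (basis
  3 20 22)) (basis 12 13 20)) (split 13 (basis 12 20 21) (basis 13 21 26))) (basis 14 15 22)) (split 15 (basis 14
  22 23) (split 7 (split 31 (basis 8 15 23) (basis 6 30 31)) (split 31 (basis 6 7 30) (split 3 (split 29 (basis
  28 30 31) (split 27 (basis 7 28 31) (split 19 (basis 7 20 23) (split 11 (basis 10 18 19) (split 9 (basis 11 18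
  27) (split 17 (split 13 (basis 12 28 29) (split 21 (basis 20 22 23) (split 5 goal (basis 5 28 29)))) (basis 17
  18 19))))))) (split 27 (split 29 (split 5 (basis 26 30 31) (split 13 (basis 15 20 22) (split 9 (split 17
  (basis 12 13 28) (split 21 (basis 12 14 23) (split 19 (basis 10 14 23) (split 11 (basis 20 22 31) goal))))
  (basis 9 13 20)))) (basis 6 29 31)) (basis 3 26 27))))))

tree₂b : Tree
tree₂b =
  split 49 (split 50 (split 6 (split 5 (split 34 (split 26 (split 30 (basis 2 24 28) (split 57 (split 58 (basis
  2 24 56) (split 46 (split 21 (basis 1 20 58) (basis 21 30 44)) (basis 1 30 46))) (basis 30 57 60))) (split 9
  (split 57 (basis 1 26 56) (split 21 (split 29 (basis 36 44 57) (split 38 (basis 26 57 60) (basis 20 29 38)))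
  (basis 21 26 28))) (basis 9 26 56))) (split 38 (basis 2 34 36) (basis 1 34 38))) (basis 1 2 5)) (split 54 (basis
  2 6 52) (basis 1 6 54))) (basis 1 2 50)) (split 50 (basis 1 2 49) (split 33 (split 18 (basis 2 16 49) (basis 1
  18 50)) (split 18 (basis 1 33 50) (split 17 (basis 18 49 50) (split 34 (basis 17 18 33) (split 26 (split 42
  (basis 18 34 56) (basis 17 33 42)) (split 25 (basis 17 18 26) (split 57 (basis 18 26 49) (split 58 (basis 49 50
  57) (split 42 (basis 34 49 57) (split 41 (basis 33 50 58) (split 10 (basis 25 42 57) (split 21 (split 14 (basis
  41 50 60) (basis 10 14 17)) (split 53 (basis 21 26 58) (split 54 (basis 49 50 53) (split 6 (basis 25 41 54)
  (split 38 (basis 34 49 53) (split 14 (basis 10 49 53) (split 22 (basis 25 54 57) (split 62 (basis 49 54 57)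
  (split 30 (basis 26 49 53) (split 46 (basis 42 49 53) goal))))))))))))))))))))))

tree₃b : Tree
tree₃b =
  split 43 (split 47 (basis 26 30 53) (basis 41 45 47)) (split 27 (basis 25 41 43) (split 19 (basis 27 42 57)
  (split 55 (basis 19 22 36) (split 39 (basis 19 22 52) (split 23 (basis 21 53 55) (split 31 (basis 25 27 29)
  (split 15 (basis 55 56 62) (split 7 (split 59 (basis 57 60 62) (split 47 (basis 41 43 45) (split 35 (split 63
  (basis 57 59 61) (split 51 (split 11 goal (basis 11 57 59)) (basis 51 57 59))) (basis 35 41 43)))) (basis 7 53
  55)))))))))

tree₁c₀ : Tree
tree₁c₀ =
  split 43 (split 53 (split 29 (split 31 (split 33 (split 63 (split 11 (split 21 (split 9 (split 23 (split 13
  (split 17 (split 49 (split 5 (split 15 (split 7 (split 19 (split 27 (split 25 (split 37 (split 39 (split 47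
  (split 61 (split 51 (split 41 (split 59 (split 55 (split 35 (split 45 (split 57 goal (basis 30 57 62)) (basis
  30 45 62)) (basis 30 35 62)) (basis 30 55 62)) (basis 30 59 62)) (basis 24 41 62)) (basis 24 51 62)) (basis 24 61
  62)) (basis 30 47 62)) (basis 24 39 62)) (basis 20 37 62)) (basis 25 30 56)) (basis 27 30 46)) (basis 19 30 56))
  (basis 7 24 26)) (basis 15 30 46)) (basis 5 20 46)) (basis 14 49 50)) (basis 17 24 28)) (split 25 (basis 13 20
  56) (split 57 (basis 24 25 56) (basis 12 25 57)))) (basis 23 30 40)) (basis 9 20 40)) (basis 21 30 62)) (basis 11
  20 62)) (basis 30 62 63)) (split 11 (basis 20 33 62) (basis 10 11 33))) (basis 30 31 52)) (basis 29 30 40))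
  (split 31 (basis 30 52 53) (split 55 (split 29 (basis 31 40 53) (split 41 (basis 30 31 40) (split 63 (split 61
  (basis 29 31 34) (basis 10 53 61)) (split 23 (basis 31 40 63) (split 9 (split 35 (basis 28 31 63) (split 21
  (basis 20 62 63) (split 61 (split 33 (split 51 (split 15 (basis 23 24 36) (basis 14 15 50)) (split 17 (basis 24
  34 51) (split 5 (split 47 (basis 28 31 51) (split 37 (basis 26 31 63) (split 25 (basis 24 50 51) (split 39
  (split 15 (basis 14 50 51) (split 7 (basis 15 56 63) (split 11 (basis 15 51 56) (split 57 (basis 30 31 56)
  (split 13 (basis 15 53 56) (split 19 (basis 18 56 57) (split 27 (basis 31 47 52) (split 59 (split 45 (split 49
  goal (basis 49 56 57)) (basis 45 46 47)) (basis 59 62 63))))))))) (basis 39 46 47))))) (basis 5 50 51)))) (basis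
  33 40 41)) (basis 61 62 63)))) (basis 9 62 63)))))) (basis 52 53 55)))) (split 41 (split 39 (split 13 (split
  15 (split 37 (basis 14 40 43) (split 17 (split 59 (basis 30 37 52) (basis 18 56 59)) (split 55 (basis 17 30 56)
  (basis 16 17 55)))) (basis 14 15 40)) (basis 13 14 36)) (split 37 (split 13 (basis 14 40 43) (split 15 (basis 14
  39 40) (split 55 (split 17 (basis 15 30 56) (basis 17 18 52)) (split 31 (basis 30 40 55) (split 17 (basis 18 52
  55) (split 53 (split 19 (basis 18 39 52) (split 57 (split 59 (basis 30 31 36) (split 29 (basis 30 56 59)
  (split 33 (split 23 (basis 15 24 46) (basis 23 31 62)) (split 35 (split 5 (basis 13 43 46) (split 25 (basis 29
  39 62) (split 49 (basis 25 29 40) (split 45 (basis 28 29 49) (split 11 (split 9 (basis 13 49 56) (split 47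
  (split 61 (basis 30 31 34) (split 7 (split 21 (basis 30 46 59) (split 23 (basis 20 61 62) (split 51 (split 27
  (basis 24 61 62) (split 63 goal (basis 61 62 63))) (basis 51 56 59)))) (basis 7 61 62))) (basis 45 46 47)))
  (basis 11 49 50)))))) (basis 33 34 35))))) (basis 28 31 57))) (basis 52 53 55))))))) (basis 36 37 39))) (basis 40
  41 43))

tree₁c₁ : Tree
tree₁c₁ =
  split 45 (split 27 (split 51 (split 31 (split 23 (split 33 (split 19 (split 9 (split 13 (split 63 (split 49
  (split 35 (split 61 (split 47 (split 3 (split 11 (split 15 (split 7 (split 21 (split 17 (split 25 (split 29
  (split 37 (split 43 (split 57 (split 55 (split 39 (split 41 (split 59 (split 53 goal (basis 30 53 62)) (basis
  30 59 62)) (basis 30 41 62)) (basis 30 39 62)) (basis 24 55 62)) (basis 24 57 62)) (basis 24 43 62)) (basis 24 37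
  62)) (basis 29 30 62)) (basis 25 30 56)) (basis 17 30 62)) (basis 21 30 56)) (basis 7 24 28)) (basis 15 24 28))
  (basis 11 20 28)) (basis 3 14 62)) (basis 30 47 56)) (basis 30 56 61)) (basis 18 35 56)) (split 7 (basis 14 49
  56) (basis 7 49 52))) (basis 30 62 63)) (basis 13 30 62)) (basis 9 30 36)) (basis 18 19 50)) (basis 18 33 36))
  (split 33 (basis 18 23 36) (basis 12 23 33))) (basis 30 31 50)) (basis 30 40 51)) (split 51 (basis 27 30 40)
  (split 55 (split 41 (basis 27 30 50) (split 31 (basis 30 50 51) (split 29 (split 25 (basis 6 27 31) (basis 25
  46 51)) (split 47 (basis 29 31 50) (split 25 (basis 24 46 47) (split 53 (basis 29 31 40) (split 43 (split 3
  (split 49 (split 37 (split 19 (basis 14 29 56) (basis 19 27 62)) (split 11 (basis 14 37 46) (split 9 (split 57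
  (basis 28 31 37) (split 23 (basis 31 46 57) (split 7 (basis 14 57 62) (split 35 (basis 26 31 57) (split 15
  (basis 14 56 57) (split 33 (split 13 (basis 15 53 56) (split 19 (basis 18 56 57) (split 59 (split 61 (split 63
  (basis 30 31 62) (split 17 (basis 25 46 63) (split 21 (basis 20 62 63) (split 39 goal (basis 39 46 47)))))
  (basis 56 57 61)) (basis 56 57 59)))) (basis 33 40 41))))))) (basis 9 36 37)))) (basis 49 52 53)) (basis 3 52
  53)) (basis 43 46 47)))))))) (basis 50 51 55)))) (split 41 (split 39 (split 15 (split 27 (split 57 (basis 20
  34 45) (basis 30 34 57)) (split 31 (basis 27 45 50) (split 57 (basis 30 31 56) (basis 16 31 57)))) (basis 14 15
  40)) (split 11 (basis 14 34 39) (split 35 (split 15 (basis 14 39 40) (split 61 (split 17 (basis 15 30 50)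
  (basis 17 20 56)) (split 27 (basis 30 56 61) (split 31 (basis 30 34 61) (split 55 (basis 30 31 40) (split 57
  (split 17 (basis 20 56 61) (split 21 (basis 20 45 56) (split 51 (split 49 (split 29 (basis 15 18 62) (basis 29
  31 46)) (split 53 (split 59 (basis 14 15 52) (split 7 (split 9 (basis 14 55 62) (split 23 (basis 18 59 62)
  (split 37 (split 3 (basis 11 61 62) (split 43 (basis 30 31 52) (split 13 (split 47 (split 25 (basis 30 46 55)
  (split 33 (basis 27 31 62) (split 19 (basis 30 46 61) (split 29 (basis 24 59 62) (split 63 goal (basis 59 62
  63)))))) (basis 43 46 47)) (basis 13 59 62)))) (basis 34 37 39)))) (basis 7 59 62))) (basis 49 52 53))) (basis 50
  51 55)))) (basis 56 57 61))))))) (basis 34 35 39)))) (basis 40 41 45))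

tree₁c₂ : Tree
tree₁c₂ =
  split 19 (split 51 (split 61 (split 47 (split 29 (split 15 (split 9 (split 41 (split 59 (split 7 (split 21
  (split 53 (split 39 (split 27 (split 63 (split 45 (split 11 (split 3 (split 5 (split 23 (split 13 (split 35
  (split 31 (split 25 (split 49 (split 17 (split 55 (split 57 (split 43 (split 37 goal (basis 30 37 62)) (basis
  30 43 62)) (basis 30 57 62)) (basis 30 55 62)) (basis 17 30 62)) (basis 30 49 56)) (basis 25 30 56)) (basis 30 31
  62)) (basis 30 35 62)) (basis 13 30 62)) (basis 23 30 40)) (basis 5 30 40)) (basis 3 30 46)) (basis 11 30 56))
  (basis 18 45 62)) (split 3 (basis 30 34 63) (basis 3 62 63))) (basis 20 27 52)) (basis 20 39 52)) (basis 20 52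
  53)) (basis 20 21 46)) (basis 7 20 46)) (basis 20 50 59)) (basis 20 41 52)) (split 41 (basis 9 20 52) (basis 9 40
  41))) (basis 15 18 50)) (basis 14 29 50)) (basis 18 46 47)) (split 29 (basis 14 46 61) (basis 28 29 61))) (basis
  18 50 51)) (split 51 (basis 18 19 50) (split 47 (split 15 (basis 19 28 51) (basis 14 15 46)) (split 15 (basis
  14 46 47) (split 35 (split 31 (basis 15 16 51) (split 3 (basis 16 19 51) (split 29 (split 45 (basis 31 47 50)
  (split 17 (split 61 (basis 30 31 34) (split 13 (split 49 (basis 31 46 51) (split 63 (basis 30 31 62) (split 25
  (split 53 (basis 24 45 52) (basis 40 49 53)) (split 39 (basis 25 47 62) (split 37 (split 59 (basis 30 31 36)
  (split 43 (basis 25 47 50) (split 9 (basis 50 59 63) (split 5 (basis 59 62 63) (split 21 (basis 46 59 63)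
  (split 55 (basis 25 46 63) (split 11 (split 41 (split 27 (split 7 (split 57 (basis 24 31 62) (split 23 (split
  53 (basis 20 31 62) goal) (basis 23 31 62))) (basis 7 28 61)) (basis 27 31 62)) (basis 25 41 56)) (basis 11 26
  59)))))))) (basis 25 37 56)))))) (basis 13 28 61))) (basis 17 19 50))) (basis 29 31 62)))) (split 3 (split 63
  (basis 16 19 47) (split 13 (basis 15 35 46) (split 49 (split 17 (basis 19 35 50) (split 45 (split 31 (basis 30
  62 63) (split 29 (basis 31 47 50) (split 61 (split 37 (split 25 (basis 15 22 51) (basis 25 29 56)) (split 27
  (basis 31 37 62) (split 23 (basis 31 37 50) (split 41 (basis 27 31 50) (split 7 (basis 15 41 46) (split 11
  (basis 15 37 46) (split 43 (split 57 (basis 28 31 37) (split 39 (split 59 (split 55 (split 9 (split 53 (basis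
  30 31 52) (split 5 (split 21 (basis 20 62 63) (split 25 (basis 24 62 63) goal)) (basis 5 62 63))) (basis 9 62
  63)) (basis 28 29 55)) (basis 56 57 59)) (basis 36 37 39))) (basis 40 41 43)))))))) (basis 61 62 63)))) (basis 45
  46 47))) (basis 49 50 51)))) (basis 3 34 35))))))

tree₁c₃ : Tree
tree₁c₃ =
  split 15 (split 63 (split 35 (split 29 (split 45 (split 19 (split 23 (split 5 (split 53 (split 39 (split 59
  (split 41 (split 11 (split 25 (split 37 (split 13 (split 31 (split 3 (split 17 (split 9 (split 43 (split 7
  (split 21 (split 61 (split 51 (split 27 (split 47 (split 33 (split 55 (split 57 goal (basis 30 57 62)) (basis
  30 55 62)) (basis 30 33 62)) (basis 30 47 62)) (basis 27 30 62)) (basis 30 51 62)) (basis 30 61 62)) (basis 21 30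
  62)) (basis 7 30 50)) (basis 30 43 56)) (basis 9 30 50)) (basis 17 30 52)) (basis 3 30 56)) (basis 30 31 36))
  (basis 13 30 40)) (split 33 (basis 26 30 37) (basis 33 37 56))) (basis 24 25 62)) (basis 11 24 62)) (basis 24 41
  62)) (basis 24 59 62)) (basis 24 39 40)) (basis 24 40 53)) (basis 5 18 52)) (split 25 (basis 14 23 52) (split 53
  (basis 24 25 52) (basis 25 40 53)))) (basis 18 19 62)) (basis 18 34 45)) (basis 18 29 62)) (split 19 (basis 18 34
  35) (basis 19 28 35))) (basis 14 62 63)) (split 63 (basis 14 15 62) (split 21 (split 37 (basis 15 26 63) (basis
  20 36 37)) (split 37 (basis 20 21 36) (split 47 (split 31 (basis 15 16 63) (basis 30 31 46)) (split 31 (basis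
  30 46 47) (split 19 (split 35 (basis 15 28 63) (basis 18 34 35)) (split 35 (basis 18 19 34) (split 53 (split
  33 (basis 20 21 52) (split 23 (split 45 (basis 31 37 50) (split 11 (split 3 (basis 45 46 47) (split 25 (basis
  24 45 52) (split 39 (basis 31 47 56) (split 17 (split 59 (basis 21 46 63) (split 61 (basis 21 40 63) (split 5
  (basis 59 62 63) (split 55 (basis 31 40 63) (split 9 (basis 55 62 63) (split 51 (split 41 (basis 24 28 45)
  (split 7 (split 43 (basis 31 35 52) (split 27 (split 13 (split 29 (split 57 goal (basis 31 46 57)) (basis 29
  31 46)) (basis 13 28 45)) (basis 27 31 46))) (basis 7 22 39))) (basis 21 36 51))))))) (basis 17 21 36))))) (basis
  11 28 45))) (basis 19 23 34))) (split 11 (basis 15 53 62) (split 59 (split 5 (split 41 (basis 19 22 63) (split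
  27 (basis 31 46 53) (split 23 (basis 19 40 63) (split 51 (basis 26 31 41) (split 57 (basis 26 31 35) (split 39
  (split 29 (basis 31 46 51) (split 17 (basis 21 46 63) (split 25 (basis 24 62 63) (split 45 (split 61 (split 43
  (split 3 (split 9 (split 7 (basis 15 57 62) (split 33 (split 13 (basis 15 52 57) (split 55 goal (basis 55 62
  63))) (basis 33 40 41))) (basis 9 56 57)) (basis 3 62 63)) (basis 43 46 47)) (basis 56 57 61)) (basis 40 41
  45))))) (basis 34 35 39))))))) (basis 5 62 63)) (basis 10 11 59)))))))))))

tree₂c : Tree
tree₂c =
  split 117 (split 118 (split 10 (split 9 (split 65 (split 66 (split 77 (split 78 (split 106 (split 30 (basis
  2 28 104) (split 126 (split 94 (split 125 (basis 1 2 124) (split 54 (basis 30 40 104) (basis 54 60 125)))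
  (basis 1 30 94)) (basis 20 30 126))) (split 42 (split 29 (basis 1 28 106) (split 45 (split 6 (split 90 (basis
  29 48 106) (basis 29 90 92)) (basis 1 6 44)) (basis 36 45 106))) (basis 1 42 106))) (basis 1 2 78)) (split 14
  (basis 2 12 77) (basis 1 14 77))) (basis 1 2 66)) (split 54 (basis 2 52 65) (basis 1 54 65))) (basis 1 2 9))
  (split 126 (basis 2 10 124) (basis 1 10 126))) (basis 1 2 118)) (split 118 (basis 1 2 117) (split 18 (split 101
  (basis 1 100 118) (basis 2 101 117)) (split 101 (basis 2 18 117) (split 102 (basis 101 117 118) (split 37
  (split 38 (basis 80 117 118) (basis 38 101 102)) (split 66 (basis 2 37 101) (split 53 (basis 37 102 118) (split
  54 (basis 53 117 118) (split 81 (basis 37 54 66) (split 82 (basis 66 101 117) (split 38 (basis 54 101 117)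
  (split 34 (split 50 (basis 68 102 118) (basis 50 101 117)) (split 85 (basis 34 53 66) (split 22 (basis 53 85
  118) (split 50 (basis 54 81 85) (split 98 (basis 81 85 102) (split 6 (basis 53 85 102) (split 70 (basis 66 81
  85) (split 86 (basis 81 82 85) (split 97 (basis 98 101 102) (split 113 (basis 98 102 117) (split 114 (basis 113
  117 118) (split 74 (split 41 (basis 54 85 124) (basis 41 50 81)) (split 30 (basis 53 74 97) (split 109 (basis
  66 74 101) (split 90 (basis 82 101 109) (split 62 (basis 54 101 109) (split 94 (basis 90 113 117) (split 58
  (basis 62 113 117) (split 106 (basis 98 101 109) (split 78 (basis 94 101 117) (split 121 (basis 98 106 113)
  (split 126 (basis 113 118 121) (split 122 (basis 113 117 126) (split 14 (basis 53 90 97) (split 42 (basis 58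
  101 117) (split 10 (basis 53 94 97) (split 26 (basis 53 90 117) (split 46 (basis 62 101 117) (split 110 (basis
  106 113 117) goal))))))))))))))))))))))))))))))))))))))))

tree₃c : Tree
tree₃c =
  split 127 (split 43 (basis 30 53 74) (basis 43 58 69)) (split 47 (basis 62 80 127) (split 107 (basis 47 62 68)
  (split 59 (basis 62 80 107) (split 115 (basis 59 62 72) (split 103 (basis 59 62 92) (split 35 (basis 50 92 127)
  (split 55 (basis 62 92 107) (split 95 (basis 59 62 100) (split 75 (basis 59 62 112) (split 83 (basis 59 62 104)
  (split 71 (basis 59 62 124) (split 39 (basis 37 125 127) (split 27 (basis 30 107 112) (split 23 (basis 30 107
  124) (split 43 (basis 41 125 127) (split 51 (basis 49 125 127) (split 19 (split 63 (basis 61 125 127) (split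
  67 (split 31 (basis 29 125 127) (split 15 (basis 31 114 125) (split 111 (split 119 (split 11 (split 91 (split
  7 (split 87 (split 123 (split 79 (split 99 goal (basis 99 113 115)) (basis 79 93 95)) (basis 123 125 127))
  (basis 87 93 95)) (basis 7 125 127)) (basis 91 93 95)) (basis 11 125 127)) (basis 119 125 127)) (basis 111 125
  127)))) (basis 67 81 83))) (basis 19 125 127))))))))))))))))))

-- The coordinates are with respect to p, q, x, n, where f vanishes at p, q, n and
-- n + x; the parameter is the value at n + x + p + q.
τ₄ : Bool → Vector 4 → Bool
τ₄ c (p ∷ q ∷ x ∷ false ∷ []) = x ∨ (p ∧ q)
τ₄ c (p ∷ q ∷ x ∷ true ∷ []) = (p xor q) ∨ (p ∧ q ∧ (not x ∨ c))

r₄ : Fin 4 → Vector 4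
r₄ zero = true ∷ false ∷ false ∷ false ∷ []
r₄ (suc zero) = false ∷ true ∷ false ∷ false ∷ []
r₄ (suc (suc zero)) = false ∷ false ∷ false ∷ true ∷ []
r₄ (suc (suc (suc zero))) = false ∷ false ∷ true ∷ true ∷ []

-- The coordinates are with respect to p, q, a, x, n; here p + q + a is a
-- point of the ground set all of whose translates by p + q, p + a, q + a are zeros.
τ₅ : Vector 5 → Bool
τ₅ (p ∷ q ∷ a ∷ x ∷ false ∷ []) = x ∨ (p ∧ q) ∨ (q ∧ a) ∨ (p ∧ a)
τ₅ (p ∷ q ∷ a ∷ x ∷ true ∷ []) = p xor q xor a

r₅ : Fin 4 → Vector 5
r₅ zero = true ∷ false ∷ false ∷ false ∷ false ∷ []
r₅ (suc zero) = false ∷ true ∷ false ∷ false ∷ false ∷ []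
r₅ (suc (suc zero)) = false ∷ false ∷ false ∷ false ∷ true ∷ []
r₅ (suc (suc (suc zero))) = false ∷ false ∷ false ∷ true ∷ true ∷ []

r-zero₄ : ∀ c i → τ₄ c (r₄ i) ≡ false
r-zero₄ c zero = refl
r-zero₄ c (suc zero) = refl
r-zero₄ c (suc (suc zero)) = refl
r-zero₄ c (suc (suc (suc zero))) = refl

r-zero₅ : ∀ i → τ₅ (r₅ i) ≡ false
r-zero₅ zero = refl
r-zero₅ (suc zero) = refl
r-zero₅ (suc (suc zero)) = refl
r-zero₅ (suc (suc (suc zero))) = refl

r-sum₄ : ∀ c i j → ¬ i ≡ j → τ₄ c (r₄ i +v r₄ j) ≡ true
r-sum₄ c zero zero i≢j = contradiction refl i≢j
r-sum₄ c zero (suc zero) _ = refl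
r-sum₄ c zero (suc (suc zero)) _ = refl
r-sum₄ c zero (suc (suc (suc zero))) _ = refl
r-sum₄ c (suc zero) zero _ = refl
r-sum₄ c (suc zero) (suc zero) i≢j = contradiction refl i≢j
r-sum₄ c (suc zero) (suc (suc zero)) _ = refl
r-sum₄ c (suc zero) (suc (suc (suc zero))) _ = refl
r-sum₄ c (suc (suc zero)) zero _ = refl
r-sum₄ c (suc (suc zero)) (suc zero) _ = refl
r-sum₄ c (suc (suc zero)) (suc (suc zero)) i≢j = contradiction refl i≢j
r-sum₄ c (suc (suc zero)) (suc (suc (suc zero))) _ = refl
r-sum₄ c (suc (suc (suc zero))) zero _ = refl
r-sum₄ c (suc (suc (suc zero))) (suc zero) _ = refl
r-sum₄ c (suc (suc (suc zero))) (suc (suc zero)) _ = refl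
r-sum₄ c (suc (suc (suc zero))) (suc (suc (suc zero))) i≢j = contradiction refl i≢j

r-sum₅ : ∀ i j → ¬ i ≡ j → τ₅ (r₅ i +v r₅ j) ≡ true
r-sum₅ zero zero i≢j = contradiction refl i≢j
r-sum₅ zero (suc zero) _ = refl
r-sum₅ zero (suc (suc zero)) _ = refl
r-sum₅ zero (suc (suc (suc zero))) _ = refl
r-sum₅ (suc zero) zero _ = refl
r-sum₅ (suc zero) (suc zero) i≢j = contradiction refl i≢j
r-sum₅ (suc zero) (suc (suc zero)) _ = refl
r-sum₅ (suc zero) (suc (suc (suc zero))) _ = refl
r-sum₅ (suc (suc zero)) zero _ = refl
r-sum₅ (suc (suc zero)) (suc zero) _ = refl
r-sum₅ (suc (suc zero)) (suc (suc zero)) i≢j = contradiction refl i≢j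
r-sum₅ (suc (suc zero)) (suc (suc (suc zero))) _ = refl
r-sum₅ (suc (suc (suc zero))) zero _ = refl
r-sum₅ (suc (suc (suc zero))) (suc zero) _ = refl
r-sum₅ (suc (suc (suc zero))) (suc (suc zero)) _ = refl
r-sum₅ (suc (suc (suc zero))) (suc (suc (suc zero))) i≢j = contradiction refl i≢j

template₄ : Bool → Template
template₄ false = record
  { τ = τ₄ false ; τ0 = refl ; top = false ∷ false ∷ true ∷ false ∷ [] ; τ-top = refl
  ; r = r₄ ; r-zero = r-zero₄ false ; r-sum = r-sum₄ false
  ; zero∣neutral = λ
      { zero → zero-or-neutral (τ₄ false) refl (r₄ zero) tree₁a₀ refl
      ; (suc zero) → zero-or-neutral (τ₄ false) refl (r₄ (suc zero)) tree₁a₁ refl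
      ; (suc (suc zero)) → zero-or-neutral (τ₄ false) refl (r₄ (suc (suc zero))) tree₁a₂ refl
      ; (suc (suc (suc zero))) →
          zero-or-neutral (τ₄ false) refl (r₄ (suc (suc (suc zero)))) tree₁a₃ refl }
  ; full = full-coset (τ₄ false) tree₂a refl
  ; sum = neutral-sum (τ₄ false) refl tree₃a refl }
template₄ true = record
  { τ = τ₄ true ; τ0 = refl ; top = false ∷ false ∷ true ∷ false ∷ [] ; τ-top = refl
  ; r = r₄ ; r-zero = r-zero₄ true ; r-sum = r-sum₄ true
  ; zero∣neutral = λ
      { zero → zero-or-neutral (τ₄ true) refl (r₄ zero) tree₁b₀ refl
      ; (suc zero) → zero-or-neutral (τ₄ true) refl (r₄ (suc zero)) tree₁b₁ refl
      ; (suc (suc zero)) → zero-or-neutral (τ₄ true) refl (r₄ (suc (suc zero))) tree₁b₂ refl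
      ; (suc (suc (suc zero))) →
          zero-or-neutral (τ₄ true) refl (r₄ (suc (suc (suc zero)))) tree₁b₃ refl }
  ; full = full-coset (τ₄ true) tree₂b refl
  ; sum = neutral-sum (τ₄ true) refl tree₃b refl }

template₅ : Template
template₅ = record
  { τ = τ₅ ; τ0 = refl ; top = false ∷ false ∷ false ∷ true ∷ false ∷ [] ; τ-top = refl
  ; r = r₅ ; r-zero = r-zero₅ ; r-sum = r-sum₅
  ; zero∣neutral = λ
      { zero → zero-or-neutral τ₅ refl (r₅ zero) tree₁c₀ refl
      ; (suc zero) → zero-or-neutral τ₅ refl (r₅ (suc zero)) tree₁c₁ refl
      ; (suc (suc zero)) → zero-or-neutral τ₅ refl (r₅ (suc (suc zero))) tree₁c₂ refl
      ; (suc (suc (suc zero))) → zero-or-neutral τ₅ refl (r₅ (suc (suc (suc zero)))) tree₁c₃ refl }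
  ; full = full-coset τ₅ tree₂c refl
  ; sum = neutral-sum τ₅ refl tree₃c refl }

-- From a pattern on T to an outcome

FlatBound : ∀ {n} → (Vector n → Bool) → ℕ → Set
FlatBound {n} f s = ∀ {d} (vs : Vec (Vector n) d) → Solid f vs → d ≤ s

-- At this dimension a triangle-free set of zeros forces a flat of dimension s + 1, one more than
-- the bound on ω allows.
triangleBound : ℕ → ℕ
triangleBound s = proj₁ (triangle-free⇒solid (suc s))

triangle-free-bounded : ∀ {m s} (g : Vector m → Bool) → TriangleFree g → FlatBound g s → m ≤ triangleBound s
triangle-free-bounded {m} {s} g tf bound with triangleBound s ≤? m
... | no R≰m = <⇒≤ (≰⇒> R≰m)
... | yes R≤m with m≤n⇒∃[o]m+o≡n R≤m
... | o , refl = ⊥-elim (1+n≰n (bound (map (inˡ o) (proj₁ large)) (solid-map g (inˡ o) (inˡ-linear o) (proj₁ large) (proj₂ large))))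
  where
  R : ℕ
  R = triangleBound s
  injective-0 : ∀ (u : Vector R) → inˡ o u ≡ 0v → u ≡ 0v
  injective-0 u e = ++-injectiveˡ u 0v (trans e (sym (++-0v R o)))
  tf′ : TriangleFree (g ∘ inˡ o)
  tf′ a b ga gb gab with tf (inˡ o a) (inˡ o b) ga gb (trans (cong g (sym (inˡ-linear o a b))) gab)
  ... | inj₁ e = inj₁ (injective-0 a e)
  ... | inj₂ (inj₁ e) = inj₂ (inj₁ (injective-0 b e))
  ... | inj₂ (inj₂ e) = inj₂ (inj₂ (++-injectiveˡ a b e))
  large : Σ (Vec (Vector R) (suc s)) (Solid (g ∘ inˡ o))
  large = proj₂ (triangle-free⇒solid (suc s)) (g ∘ inˡ o) tf′

commonly : ∀ {k} {A : Set} {B : Fin k → Set} → (∀ i → A ⊎ B i) → A ⊎ (∀ i → B i)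
commonly {zero} h = inj₂ λ ()
commonly {suc k} h with h zero | commonly (h ∘ suc)
... | inj₁ a | _ = inj₁ a
... | inj₂ _ | inj₁ a = inj₁ a
... | inj₂ b | inj₂ bs = inj₂ λ { zero → b ; (suc i) → bs i }

line-tree : Tree
line-tree = split 5 goal (split 6 goal (split 7 goal (basis 5 6 7)))

module Configuration (T : Template) {n : ℕ} (f : Vector n → Bool) (f0 : f 0v ≡ false) (cf : CF f)
         (Q : Vec (Vector n) (Template.k T)) (pattern-Q : ∀ t → f (lin Q t) ≡ Template.τ T t) where

  open Template T

  Empty Full Neutral : Vector n → Set
  Empty v = ∀ t → f (v +v lin Q t) ≡ false
  Full v = ∀ t → f (v +v lin Q t) ≡ true
  Neutral v = ∀ t → isZero t ≡ false → f (v +v lin Q t) ≡ τ t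

  empty? : ∀ v → Dec (Empty v)
  empty? v = all? (λ t → f (v +v lin Q t) ≟b false)

  neutral? : ∀ v → Dec (Neutral v)
  neutral? v = all? (λ t → (isZero t ≟b false) →-dec (f (v +v lin Q t) ≟b τ t))

  x : Vector n
  x = lin Q top

  fx : f x ≡ true
  fx = trans (pattern-Q top) τ-top

  ¬empty-0 : ¬ Empty 0v
  ¬empty-0 e = false≢true (e top) (trans (cong f (+v-identityˡ x)) fx)

  along : ∀ v t u → (v +v lin Q t) +v lin Q u ≡ v +v lin Q (t +v u)
  along v t u = trans (+v-assoc v _ _) (cong (v +v_) (sym (lin-linear Q t u)))

  -- The stabiliser of the family of empty cosets of T.
  W : Subspace n
  W = record
    { In = λ w → ∀ v → Empty v → Empty (w +v v)
    ; in? = λ w → all? (λ v → empty? v →-dec empty? (w +v v))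
    ; in-0 = λ v → subst Empty (sym (+v-identityˡ v))
    ; in-+ = λ {u} {w} p q v e → subst Empty (sym (+v-assoc u w v)) (p (w +v v) (q v e)) }

  -- If w + T were empty, translating it by w would make T empty, but T contains the point `x`.
  W-nonempty : ∀ w → In W w → ¬ Empty w
  W-nonempty w p e = ¬empty-0 (subst Empty (+v-self w) (p w e))

  Q⊆W : ∀ t → In W (lin Q t)
  Q⊆W t v e u = trans (cong f (trans (cong (_+v lin Q u) (+v-comm (lin Q t) v)) (along v t u))) (e (t +v u))

  nonempty : ∀ v → ¬ Empty v → ∃[ t ] f (v +v lin Q t) ≡ true
  nonempty v ¬e with any? (λ t → f (v +v lin Q t) ≟b true)
  ... | yes p = p
  ... | no ¬p = ⊥-elim (¬e (λ t → false≢ (λ q → ¬p (t , q))))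

  -- Suppose v + T is empty and a + v + T contains a point e. For any point e′ of a + T the sum e +
  -- e′ lies in v + T, so `full` fills the whole coset a + T.
  mixed∈W : ∀ a → ¬ Empty a → ¬ Full a → In W a
  mixed∈W a ¬e ¬f v ev t = false≢ λ q → ¬f (full-a q)
    where
    full-a : f ((a +v v) +v lin Q t) ≡ true → Full a
    full-a q u with nonempty a ¬e
    ... | t₁ , q₁ = trans (cong f (begin
        a +v lin Q u ≡⟨ cong (λ z → a +v lin Q z) (cancelˡ t₁ u) ⟨
        a +v lin Q (t₁ +v (t₁ +v u)) ≡⟨ along a t₁ (t₁ +v u) ⟨
        e′ +v lin Q (t₁ +v u) ∎))
      (full (f ∘ lin (e ∷ e′ ∷ Q)) (CF-∘ f _ (lin-linear (e ∷ e′ ∷ Q)) cf) pattern-Q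
        (trans (cong f (trans (cong (e +v_) (lin-0 Q)) (+v-identityʳ e))) q)
        (trans (cong f (trans (cong (e′ +v_) (lin-0 Q)) (+v-identityʳ e′))) q₁)
        (λ r → trans (cong f (begin
          e +v (e′ +v lin Q r) ≡⟨ solve (a ∷ v ∷ lin Q t ∷ lin Q t₁ ∷ lin Q r ∷ [])
            (v₀ ⊕ v₁ ⊕ v₂ ⊕ ((v₀ ⊕ v₃) ⊕ v₄)) (v₁ ⊕ (v₂ ⊕ (v₃ ⊕ v₄))) refl ⟩
          v +v (lin Q t +v (lin Q t₁ +v lin Q r)) ≡⟨ cong (λ z → v +v (lin Q t +v z)) (lin-linear Q t₁ r) ⟨
          v +v (lin Q t +v lin Q (t₁ +v r)) ≡⟨ cong (v +v_) (lin-linear Q t (t₁ +v r)) ⟨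
          v +v lin Q (t +v (t₁ +v r)) ∎)) (ev (t +v (t₁ +v r))))
        (t₁ +v u))
      where
      e e′ : Vector n
      e = (a +v v) +v lin Q t
      e′ = a +v lin Q t₁

  at-0 : ∀ v → v +v lin Q 0v ≡ v
  at-0 v = trans (cong (v +v_) (lin-0 Q)) (+v-identityʳ v)

  empty⊎full : ∀ v → ¬ In W v → Empty v ⊎ Full v
  empty⊎full v v∉W with empty? v | all? (λ t → f (v +v lin Q t) ≟b true)
  ... | yes e | _ = inj₁ e
  ... | _ | yes p = inj₂ p
  ... | no ¬e | no ¬p = ⊥-elim (v∉W (mixed∈W v ¬e ¬p))

  -- Off `W` every coset of T is empty or full. Translation by u preserves emptiness and, being an
  -- involution, also fullness.
  W-invariant : ∀ {u v} → In W u → ¬ In W v → f (u +v v) ≡ f v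
  W-invariant {u} {v} p v∉W with empty⊎full v v∉W
  ... | inj₁ e = trans (trans (cong f (sym (at-0 (u +v v)))) (p v e 0v))
                       (sym (trans (cong f (sym (at-0 v))) (e 0v)))
  ... | inj₂ full-v with empty⊎full (u +v v) (λ q → v∉W (in-cancel W {v} {u} (subst (In W) (+v-comm u v) q) p))
  ... | inj₂ full-uv = trans (trans (cong f (sym (at-0 (u +v v)))) (full-uv 0v))
                             (sym (trans (cong f (sym (at-0 v))) (full-v 0v)))
  ... | inj₁ e = false≢true (subst Empty (cancelˡ u v) (p (u +v v) e) 0v) (full-v 0v)

  -- The stabiliser of the set of neutral vectors. Since `0v` is neutral, its elements are neutral;
  -- by `sum` it contains every neutral zero.
  U : Subspace n
  U = record
    { In = λ u → ∀ z → Neutral z → Neutral (u +v z)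
    ; in? = λ u → all? (λ z → neutral? z →-dec neutral? (u +v z))
    ; in-0 = λ z → subst Neutral (sym (+v-identityˡ z))
    ; in-+ = λ {u} {w} p q z e → subst Neutral (sym (+v-assoc u w z)) (p (w +v z) (q z e)) }

  U⊆Neutral : ∀ u → In U u → Neutral u
  U⊆Neutral u p = subst Neutral (+v-identityʳ u)
    (p 0v (λ t _ → trans (cong f (+v-identityˡ (lin Q t))) (pattern-Q t)))

  neutral-zero∈U : ∀ a → f a ≡ false → Neutral a → In U a
  neutral-zero∈U a fa na z nz t t≢0 = trans (cong f (solve (a ∷ z ∷ lin Q t ∷ [])
      (v₀ ⊕ v₁ ⊕ v₂) (v₁ ⊕ (v₀ ⊕ v₂)) refl))
    (sum (f ∘ lin (z ∷ a ∷ Q)) (CF-∘ f _ (lin-linear (z ∷ a ∷ Q)) cf) pattern-Q nz na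
      (trans (cong f (at-0 a)) fa) t t≢0)

  module _ (A : Fin 3 → Vector n) (A-zero : ∀ j → f (A j) ≡ false) (A-sum : A zero +v A (suc zero) ≡ A (suc (suc zero)))
           (A∈W : ∀ j → In W (A j)) where

    -- Otherwise the translates of the triangle by `r i` are three points whose pairwise sums are
    -- zeros, and claw-freeness makes their total `r i` a point.
    near : ∀ i → ∃[ j ] f (A j +v lin Q (r i)) ≡ false
    near i with certifiedₑ false
        ((v₀ , false) ∷ (v₁ , false) ∷ (v₀ ⊕ v₁ , false) ∷ (v₂ , false) ∷ [])
        (((v₀ ⊕ v₂ , false) ∷ []) ∷ ((v₁ ⊕ v₂ , false) ∷ []) ∷ ((v₀ ⊕ v₁ ⊕ v₂ , false) ∷ []) ∷ [])
        line-tree refl f f0 cf (λ ()) (A zero ∷ A (suc zero) ∷ lin Q (r i) ∷ [])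
        (A-zero zero , A-zero (suc zero) , trans (cong f A-sum) (A-zero (suc (suc zero))) ,
         trans (pattern-Q (r i)) (r-zero i))
    ... | inj₁ p = zero , p
    ... | inj₂ (inj₁ p) = suc zero , p
    ... | inj₂ (inj₂ p) = suc (suc zero) , trans (cong (λ z → f (z +v lin Q (r i))) (sym A-sum)) p

    neutral-near : ∀ i → (∃[ j ] Neutral (A j)) ⊎
      (∃[ j ] (f (A j +v lin Q (r i)) ≡ false × Neutral (A j +v lin Q (r i))))
    neutral-near i with near i
    ... | j , p with zero∣neutral i (f ∘ lin (A j ∷ Q)) (CF-∘ f _ (lin-linear (A j ∷ Q)) cf) pattern-Q
                       (trans (cong f (at-0 (A j))) (A-zero j)) p
    ... | inj₁ e = ⊥-elim (W-nonempty (A j) (A∈W j) e)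
    ... | inj₂ (inj₁ na) = inj₁ (j , na)
    ... | inj₂ (inj₂ nar) = inj₂ (j , p , λ t t≢0 →
      trans (cong f (trans (along (A j) (r i) t) (cong (λ z → A j +v lin Q z) (+v-comm (r i) t)))) (nar t t≢0))

    -- Two of the four translations r i lead from the same A j to neutral zeros,
    -- although their sum is not a zero of τ.
    clash : (all : ∀ i → ∃[ j ] (f (A j +v lin Q (r i)) ≡ false × Neutral (A j +v lin Q (r i)))) →
            (∃[ i ] ∃[ i′ ] (i <ᶠ i′ × proj₁ (all i) ≡ proj₁ (all i′))) → ⊥
    clash all (i , i′ , i<i′ , eq) = false≢true (begin
      f ((A j +v lin Q (r i)) +v lin Q (r i +v r i′)) ≡⟨ cong f (trans (along (A j) (r i) (r i +v r i′))
                                                          (cong (λ z → A j +v lin Q z) (cancelˡ (r i) (r i′)))) ⟩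
      f (A j +v lin Q (r i′)) ≡⟨ cong (λ z → f (A z +v lin Q (r i′))) eq ⟩
      f (A (proj₁ (all i′)) +v lin Q (r i′)) ≡⟨ proj₁ (proj₂ (all i′)) ⟩
      false ∎)
      (trans (proj₂ (proj₂ (all i)) (r i +v r i′) (≢⇒isZero _ λ e → false≢true (trans (cong τ e) τ0) τ-sum)) τ-sum)
      where
      j : Fin 3
      j = proj₁ (all i)
      τ-sum : τ (r i +v r i′) ≡ true
      τ-sum = r-sum i i′ (<⇒≢ i<i′)

    some-neutral : ∃[ j ] Neutral (A j)
    some-neutral = fromInj₁ (λ all → ⊥-elim (clash all (pigeonhole ≤-refl (λ i → proj₁ (all i)))))
                            (commonly neutral-near)

  -- A point outside `W` makes M a lift-join along `W`. Otherwise every triangle of zeros in `W` has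
  -- a point in `U`, so a subspace of `W` meeting `U` trivially is triangle-free and of bounded
  -- dimension.
  template-outcome : ∀ {s} → FlatBound f s → Outcome (triangleBound s) f
  template-outcome {s} bound with any? (λ y → f y ≟b true ×-dec ¬? (in? W y))
  ... | yes (y , fy , y∉W) = joined W W-invariant x fx (Q⊆W top) y fy y∉W
  ... | no none = extending W U E⊆W codim extend
    where
    E⊆W : ∀ v → f v ≡ true → In W v
    E⊆W v fv with in? W v
    ... | yes p = p
    ... | no q = ⊥-elim (none (v , fv , q))
    codim : ∀ m (φ : Vector m → Vector n) → Linear φ → (∀ w → In W (φ w)) →
            (∀ w → In U (φ w) → w ≡ 0v) → m ≤ triangleBound s
    codim m φ L φ∈W ker = triangle-free-bounded (f ∘ φ) tf
      (λ vs S → bound (map φ vs) (solid-map f φ L vs S))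
      where
      tf : TriangleFree (f ∘ φ)
      tf a b fa fb fab = conclude (some-neutral A A-zero (sym (L a b)) (λ { zero → φ∈W a ; (suc zero) → φ∈W b ; (suc (suc zero)) → φ∈W (a +v b) }))
        where
        A : Fin 3 → Vector n
        A zero = φ a
        A (suc zero) = φ b
        A (suc (suc zero)) = φ (a +v b)
        A-zero : ∀ j → f (A j) ≡ false
        A-zero zero = fa
        A-zero (suc zero) = fb
        A-zero (suc (suc zero)) = fab
        conclude : ∃[ j ] Neutral (A j) → a ≡ 0v ⊎ b ≡ 0v ⊎ a ≡ b
        conclude (zero , na) = inj₁ (ker a (neutral-zero∈U _ fa na))
        conclude (suc zero , nb) = inj₂ (inj₁ (ker b (neutral-zero∈U _ fb nb)))
        conclude (suc (suc zero) , nab) = inj₂ (inj₂ (+v≡0⇒≡ a b (ker (a +v b) (neutral-zero∈U _ fab nab))))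
    extend : ∀ {d} (vs : Vec (Vector n) d) → Solid f vs → (∀ c → In U (lin vs c)) →
             Σ (Vec (Vector n) (suc d)) (Solid f)
    -- Elements of `U` are neutral, so the value at u + x is that of the pattern at `top`.
    extend vs S inU = x ∷ vs , solid-∷ f x vs fx S λ c _ →
      trans (cong f (+v-comm x (lin vs c)))
        (trans (U⊆Neutral (lin vs c) (inU c) top (≢⇒isZero top λ e → false≢true (trans (cong τ e) τ0) τ-top)) τ-top)

-- Five-point planes

coset-tree : Tree
coset-tree =
  split 12 (split 13 (split 10 (split 11 goal (basis 1 3 11)) (split 14 (basis 3 7 10) (basis 6 10 14))) (basis 1
  5 13)) (split 13 (basis 1 5 12) (split 11 (split 15 (basis 3 7 12) (basis 6 13 15)) (split 10 (basis 1 3 11)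
  goal)))

star-tree : Tree
star-tree =
  split 5 (basis 7 26 31) (split 6 (basis 7 26 28) goal)

-- The value at m + x + r + s is left open; either value gives one of the two templates of dimension
-- 4.
lits₄ : Lits (Expr 4)
lits₄ = let r = v₀ ; s = v₁ ; x = v₂ ; m = v₃ in
  (r , false) ∷ (s , false) ∷ (r ⊕ s , true) ∷
  (x , true) ∷ (x ⊕ r , true) ∷ (x ⊕ s , true) ∷ (x ⊕ r ⊕ s , true) ∷
  (m , false) ∷ (m ⊕ x , false) ∷ (m ⊕ r , true) ∷ (m ⊕ r ⊕ x , true) ∷
  (m ⊕ s , true) ∷ (m ⊕ s ⊕ x , true) ∷ (m ⊕ r ⊕ s , true) ∷ []

-- The values at a + r and a + s are left open, because `star-tree` derives that both are points.
lits₅ : Lits (Expr 5)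
lits₅ = let r = v₀ ; s = v₁ ; a = v₂ ; x = v₃ ; m = v₄ in
  (r , false) ∷ (s , false) ∷ (r ⊕ s , true) ∷ (a , false) ∷ (a ⊕ r ⊕ s , true) ∷
  (x , true) ∷ (x ⊕ r , true) ∷ (x ⊕ s , true) ∷ (x ⊕ (r ⊕ s) , true) ∷
  (x ⊕ a , true) ∷ (x ⊕ (a ⊕ r) , true) ∷ (x ⊕ (a ⊕ s) , true) ∷ (x ⊕ (a ⊕ r ⊕ s) , true) ∷
  (m , false) ∷ (m ⊕ x , false) ∷ (m ⊕ (r ⊕ s) , false) ∷ (m ⊕ (r ⊕ s) ⊕ x , false) ∷
  (m ⊕ (a ⊕ r) , false) ∷ (m ⊕ (a ⊕ r) ⊕ x , false) ∷ (m ⊕ (a ⊕ s) , false) ∷ (m ⊕ (a ⊕ s) ⊕ x , false) ∷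
  (m ⊕ r , true) ∷ (m ⊕ r ⊕ x , true) ∷ (m ⊕ s , true) ∷ (m ⊕ s ⊕ x , true) ∷
  (m ⊕ a , true) ∷ (m ⊕ a ⊕ x , true) ∷ (m ⊕ (a ⊕ r ⊕ s) , true) ∷ (m ⊕ (a ⊕ r ⊕ s) ⊕ x , true) ∷ []

-- Growing a connected set of zeros

data Indep {n} : List (Vector n) → Set where
  [] : Indep []
  _∷_ : ∀ {r S} → ¬ span S r → Indep S → Indep (r ∷ S)

lin-span : ∀ {n} (S : List (Vector n)) c → span S (lin (fromList S) c)
lin-span [] [] = refl
lin-span (r ∷ S) (false ∷ c) = inj₁ (lin-span S c)
lin-span (r ∷ S) (true ∷ c) = inj₂ (subst (span S)
  (solve (r ∷ lin (fromList S) c ∷ []) v₁ (v₀ ⊕ v₁ ⊕ v₀) refl) (lin-span S c))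

indep-length : ∀ {n} (S : List (Vector n)) → Indep S → length S ≤ n
indep-length S ind = trivial-kernel⇒≤ (lin (fromList S)) (lin-linear (fromList S)) (kernel S ind)
  where
  kernel : ∀ S → Indep S → ∀ c → lin (fromList S) c ≡ 0v → c ≡ 0v
  kernel [] [] [] _ = refl
  kernel (r ∷ S) (_ ∷ ind) (false ∷ c) e = cong (false ∷_) (kernel S ind c e)
  kernel (r ∷ S) (r∉ ∷ _) (true ∷ c) e =
    ⊥-elim (r∉ (subst (span S) (sym (+v≡0⇒≡ r (lin (fromList S) c) e)) (lin-span S c)))

module FivePlane {n : ℕ} (f : Vector n → Bool) (f0 : f 0v ≡ false) (cf : CF f) where

  by : ∀ {m} (vs : Vec (Vector n) m) (d e : Expr m) → norm d ≡ norm e → ∀ {b} → f (⟦ d ⟧ vs) ≡ b → f (⟦ e ⟧ vs) ≡ b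
  by vs d e eq p = trans (cong f (sym (solve vs d e eq))) p

  Conf₄ : Vector n → Vector n → Vector n → Vector n → Set
  Conf₄ r s x m = Holds (λ d → f (⟦ d ⟧ (r ∷ s ∷ x ∷ m ∷ []))) lits₄

  Conf₅ : Vector n → Vector n → Vector n → Vector n → Vector n → Set
  Conf₅ r s a x m = Holds (λ d → f (⟦ d ⟧ (r ∷ s ∷ a ∷ x ∷ m ∷ []))) lits₅

  conf₄-outcome : ∀ {s₀} → FlatBound f s₀ → ∀ r s x m → Conf₄ r s x m → Outcome (triangleBound s₀) f
  conf₄-outcome {s₀} bound r s x m h = go (f (m +v x +v r +v s)) refl
    where
    vs : Vec (Vector n) 4
    vs = r ∷ s ∷ x ∷ m ∷ []
    last : Expr 4
    last = v₃ ⊕ v₂ ⊕ v₀ ⊕ v₁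
    go : ∀ c → f (m +v x +v r +v s) ≡ c → Outcome (triangleBound s₀) f
    go false e = Configuration.template-outcome (template₄ false) f f0 cf vs (every-holds (f ∘ lin vs) (λ t → t , τ₄ false t)
      (certifiedᵥ false ((last , false) ∷ lits₄) (every (λ t → t , τ₄ false t) ∷ []) goal refl f f0 cf (λ ()) vs
        (e , h))) bound
    go true e = Configuration.template-outcome (template₄ true) f f0 cf vs (every-holds (f ∘ lin vs) (λ t → t , τ₄ true t)
      (certifiedᵥ false ((last , true) ∷ lits₄) (every (λ t → t , τ₄ true t) ∷ []) goal refl f f0 cf (λ ()) vs
        (e , h))) bound

  conf₅-outcome : ∀ {s₀} → FlatBound f s₀ → ∀ r s a x m → Conf₅ r s a x m → Outcome (triangleBound s₀) f
  conf₅-outcome bound r s a x m h =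
    Configuration.template-outcome template₅ f f0 cf vs (every-holds (f ∘ lin vs) (λ t → t , τ₅ t)
      (certifiedᵥ false lits₅ (every (λ t → t , τ₅ t) ∷ []) star-tree refl f f0 cf (λ ()) vs h)) bound
    where
    vs : Vec (Vector n) 5
    vs = r ∷ s ∷ a ∷ x ∷ m ∷ []

  Both : Bool → Vector n → Vector n → Set
  Both b x m = f m ≡ b × f (m +v x) ≡ b

  both-cong : ∀ {b x m m′} → m ≡ m′ → Both b x m → Both b x m′
  both-cong refl h = h

  both-absurd : ∀ {x m} {A : Set} → Both false x m → Both true x m → A
  both-absurd (p , _) (q , _) = false≢true p q

  -- Claw-freeness forbids mixed values: m + r, m + s and their translates by x are all zeros or all
  -- points.
  coset : ∀ r s x m → f r ≡ false → f s ≡ false → f (r +v s) ≡ true →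
          f x ≡ true → f (x +v r) ≡ true → f (x +v s) ≡ true → f (x +v r +v s) ≡ true → Both false x m →
          (Both false x (m +v r) × Both false x (m +v s)) ⊎ (Both true x (m +v r) × Both true x (m +v s))
  coset r s x m fr fs frs fx fxr fxs fxrs (fm , fmx)
    with certifiedₑ false
      ((v₁ , false) ∷ (v₂ , false) ∷ (v₁ ⊕ v₂ , true) ∷ (v₀ , true) ∷ (v₀ ⊕ v₁ , true) ∷ (v₀ ⊕ v₂ , true) ∷
       (v₀ ⊕ v₁ ⊕ v₂ , true) ∷ (v₃ , false) ∷ (v₃ ⊕ v₀ , false) ∷ [])
      (((v₃ ⊕ v₁ , false) ∷ (v₃ ⊕ v₁ ⊕ v₀ , false) ∷ (v₃ ⊕ v₂ , false) ∷ (v₃ ⊕ v₂ ⊕ v₀ , false) ∷ []) ∷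
       ((v₃ ⊕ v₁ , true) ∷ (v₃ ⊕ v₁ ⊕ v₀ , true) ∷ (v₃ ⊕ v₂ , true) ∷ (v₃ ⊕ v₂ ⊕ v₀ , true) ∷ []) ∷ [])
      coset-tree refl f f0 cf (λ ()) (x ∷ r ∷ s ∷ m ∷ []) (fr , fs , frs , fx , fxr , fxs , fxrs , fm , fmx)
  ... | inj₁ (a , b , c , d) = inj₁ ((a , b) , (c , d))
  ... | inj₂ (a , b , c , d) = inj₂ ((a , b) , (c , d))

  module _ (p q : Vector n) where

    -- A connected graph on zeros of f, two being joined when their sum is a point. Every `grow`
    -- attaches a vertex by an edge, so whatever is stable along edges can be proved by recursion.
    data Grown : List (Vector n) → Set where
      pair : f p ≡ false → f q ≡ false → f (p +v q) ≡ true → Grown (q ∷ p ∷ [])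
      grow : ∀ {S r s} → Grown S → s ∈ S → f r ≡ false → f (r +v s) ≡ true → Grown (r ∷ S)

    Top : Vector n → List (Vector n) → Set
    Top x S = ∀ w → span S w → f (x +v w) ≡ true

    p∈ : ∀ {S} → Grown S → p ∈ S
    p∈ (pair _ _ _) = there (here refl)
    p∈ (grow G _ _ _) = there (p∈ G)

    sum∈ : ∀ {S} → Grown S → ∃[ r ] ∃[ s ] (r ∈ S × s ∈ S × f (r +v s) ≡ true)
    sum∈ (pair _ _ e) = p , q , there (here refl) , here refl , e
    sum∈ (grow G _ _ _) with sum∈ G
    ... | r , s , r∈ , s∈ , e = r , s , there r∈ , there s∈ , e

    zero-of : ∀ {S s} → Grown S → s ∈ S → f s ≡ false
    zero-of (pair fp fq _) (here refl) = fq
    zero-of (pair fp fq _) (there (here refl)) = fp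
    zero-of (grow G _ fr _) (here refl) = fr
    zero-of (grow G _ _ _) (there s∈) = zero-of G s∈

    coset-in : ∀ {S x r s m} → Grown S → Top x S → r ∈ S → s ∈ S → f (r +v s) ≡ true → Both false x m →
      (Both false x (m +v r) × Both false x (m +v s)) ⊎ (Both true x (m +v r) × Both true x (m +v s))
    coset-in {S} {x} {r} {s} {m} G top r∈ s∈ frs = coset r s x m (zero-of G r∈) (zero-of G s∈) frs
      (trans (cong f (sym (+v-identityʳ x))) (top 0v (span-0 S)))
      (top r (span-∈ S r∈)) (top s (span-∈ S s∈))
      (trans (cong f (+v-assoc x r s)) (top (r +v s) (span-+ S (span-∈ S r∈) (span-∈ S s∈))))

    -- At the two ends of an edge the behaviour agrees by `coset-in`; connectivity spreads it over
    -- S.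
    dichotomy : ∀ {S x m} → Grown S → Top x S → Both false x m →
                (∀ {s} → s ∈ S → Both false x (m +v s)) ⊎ (∀ {s} → s ∈ S → Both true x (m +v s))
    dichotomy G@(pair _ _ e) top b with coset-in G top (there (here refl)) (here refl) e b
    ... | inj₁ (bp , bq) = inj₁ λ { (here refl) → bq ; (there (here refl)) → bp }
    ... | inj₂ (bp , bq) = inj₂ λ { (here refl) → bq ; (there (here refl)) → bp }
    dichotomy G@(grow G′ s∈ _ e) top b
      with dichotomy G′ (λ w w∈ → top w (inj₁ w∈)) b | coset-in G top (here refl) (there s∈) e b
    ... | inj₁ h | inj₁ (br , _) = inj₁ λ { (here refl) → br ; (there t∈) → h t∈ }
    ... | inj₁ h | inj₂ (_ , bs) = both-absurd (h s∈) bs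
    ... | inj₂ h | inj₁ (_ , bs) = both-absurd bs (h s∈)
    ... | inj₂ h | inj₂ (br , _) = inj₂ λ { (here refl) → br ; (there t∈) → h t∈ }

    propagate : ∀ {S x m r b} → Grown S → Top x S → Both false x m → r ∈ S → Both b x (m +v r) →
                ∀ {s} → s ∈ S → Both b x (m +v s)
    propagate {b = b} G top bm r∈ br s∈ with dichotomy G top bm
    propagate {b = false} G top bm r∈ br s∈ | inj₁ h = h s∈
    propagate {b = true} G top bm r∈ br s∈ | inj₁ h = both-absurd (h r∈) br
    propagate {b = false} G top bm r∈ br s∈ | inj₂ h = both-absurd br (h r∈)
    propagate {b = true} G top bm r∈ br s∈ | inj₂ h = h s∈

    -- The induction carries the neighbours m + w + s along. After a step by r the old vector m + w
    -- is a neighbour of the new one, and being zero it forces all the other neighbours to be zero.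
    all-zero : ∀ {S x m} → Grown S → Top x S → Both false x m → (∀ {s} → s ∈ S → Both false x (m +v s)) →
               ∀ w → span S w → Both false x (m +v w)
    all-zero {S} {x} {m} G top b h w w∈ = proj₁ (span-induction P S
        (both-cong (sym (+v-identityʳ m)) b , λ s∈ → both-cong (cong (_+v _) (sym (+v-identityʳ m))) (h s∈))
        step w w∈)
      where
      P : Vector n → Set
      P w = Both false x (m +v w) × (∀ {s} → s ∈ S → Both false x (m +v w +v s))
      step : ∀ {r w} → r ∈ S → P w → P (w +v r)
      step {r} {w} r∈ (bw , hw) = next , λ s∈ → propagate G top next r∈
          (both-cong (solve (m ∷ w ∷ r ∷ []) (v₀ ⊕ v₁) (v₀ ⊕ (v₁ ⊕ v₂) ⊕ v₂) refl) bw) s∈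
        where
        next : Both false x (m +v (w +v r))
        next = both-cong (+v-assoc m w r) (hw r∈)

    module Contradiction (no₄ : ∀ r s x m → ¬ Conf₄ r s x m) (no₅ : ∀ r s a x m → ¬ Conf₅ r s a x m)
             {S : List (Vector n)} (G : Grown S) {x : Vector n} (top : Top x S) where

      top-0 : f x ≡ true
      top-0 = trans (cong f (sym (+v-identityʳ x))) (top 0v (span-0 S))

      -- The second alternative of `dichotomy`, as a type of vector that will be shown to persist
      -- under even sums.
      C : Vector n → Set
      C m = Both false x m × (∀ {s} → s ∈ S → Both true x (m +v s))

      C-cong : ∀ {m m′} → m ≡ m′ → C m → C m′
      C-cong refl c = c

      -- A point at m + r + s, or at its translate by x, would complete `Conf₄` with m or with m +
      -- x. The type persists because m + r is a neighbour of the new vector.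
      edge : ∀ {m r s} → C m → r ∈ S → s ∈ S → f (r +v s) ≡ true → C (m +v r +v s)
      edge {m} {r} {s} (bm , h) r∈ s∈ frs =
        next , λ t∈ → propagate G top next s∈ (both-cong (sym (cancel (m +v r) s)) (h r∈)) t∈
        where
        fr = zero-of G r∈
        fs = zero-of G s∈
        fxr = top r (span-∈ S r∈)
        fxs = top s (span-∈ S s∈)
        fxrs = trans (cong f (+v-assoc x r s)) (top (r +v s) (span-+ S (span-∈ S r∈) (span-∈ S s∈)))
        vs : Vec (Vector n) 4
        vs = x ∷ m ∷ r ∷ s ∷ []
        next : Both false x (m +v r +v s)
        next = false≢ (λ e → no₄ r s x m
            (fr , fs , frs , top-0 , fxr , fxs , fxrs , proj₁ bm , proj₂ bm ,
             proj₁ (h r∈) , proj₂ (h r∈) , proj₁ (h s∈) , proj₂ (h s∈) , e)) ,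
          false≢ (λ e → no₄ r s x (m +v x)
            (fr , fs , frs , top-0 , fxr , fxs , fxrs , proj₂ bm ,
             by vs v₁ (v₁ ⊕ v₀ ⊕ v₀) refl (proj₁ bm) ,
             by vs (v₁ ⊕ v₂ ⊕ v₀) (v₁ ⊕ v₀ ⊕ v₂) refl (proj₂ (h r∈)) ,
             by vs (v₁ ⊕ v₂) (v₁ ⊕ v₀ ⊕ v₂ ⊕ v₀) refl (proj₁ (h r∈)) ,
             by vs (v₁ ⊕ v₃ ⊕ v₀) (v₁ ⊕ v₀ ⊕ v₃) refl (proj₂ (h s∈)) ,
             by vs (v₁ ⊕ v₃) (v₁ ⊕ v₀ ⊕ v₃ ⊕ v₀) refl (proj₁ (h s∈)) ,
             by vs (v₁ ⊕ v₂ ⊕ v₃ ⊕ v₀) (v₁ ⊕ v₀ ⊕ v₂ ⊕ v₃) refl e))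

      -- Along a path in the graph from p to s the edge sums telescope to p + s.
      from-p : ∀ {S′} → Grown S′ → (∀ {s} → s ∈ S′ → s ∈ S) → ∀ {m s} → C m → s ∈ S′ → C (m +v (p +v s))
      from-p (pair _ _ e) ⊆S {m} c (here refl) =
        C-cong (+v-assoc m p q) (edge c (⊆S (there (here refl))) (⊆S (here refl)) e)
      from-p (pair _ _ _) ⊆S {m} c (there (here refl)) =
        C-cong (solve (m ∷ p ∷ []) v₀ (v₀ ⊕ (v₁ ⊕ v₁)) refl) c
      from-p (grow G′ _ _ _) ⊆S c (there t∈) = from-p G′ (⊆S ∘ there) c t∈
      from-p (grow {r = r} {s} G′ s∈ _ e) ⊆S {m} c (here refl) =
        C-cong (solve (m ∷ p ∷ r ∷ s ∷ []) (v₀ ⊕ (v₁ ⊕ v₃) ⊕ v₂ ⊕ v₃) (v₀ ⊕ (v₁ ⊕ v₂)) refl)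
          (edge (from-p G′ (⊆S ∘ there) c s∈) (⊆S (here refl)) (⊆S (there s∈)) e)

      -- Its span consists of the sums of evenly many members of S.
      Λ : List (Vector n)
      Λ = mapₗ (p +v_) S

      Λ-∈ : ∀ {s} → s ∈ S → span Λ (p +v s)
      Λ-∈ s∈ = span-∈ Λ (∈-map⁺ (p +v_) s∈)

      C-Λ : ∀ {m} → C m → ∀ l → span Λ l → C (m +v l)
      C-Λ {m} c = span-induction (λ l → C (m +v l)) Λ (C-cong (sym (+v-identityʳ m)) c) step
        where
        step : ∀ {r l} → r ∈ Λ → C (m +v l) → C (m +v (l +v r))
        step {r} {l} r∈ cl with ∈-map⁻ (p +v_) r∈
        ... | s , s∈ , refl = C-cong (+v-assoc m l (p +v s)) (from-p G id cl s∈)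

      module _ {m : Vector n} (c : C m) where

        -- If p + l + r + s were a point, then a = p + l would complete `Conf₅`: by `C-Λ` even
        -- translates of m are zeros and odd ones are points, together with their translates by x.
        edge₅ : ∀ {l r s} → span Λ l → r ∈ S → s ∈ S → f (r +v s) ≡ true →
                f (p +v l) ≡ false → f (p +v l +v r +v s) ≡ false
        edge₅ {l} {r} {s} l∈ r∈ s∈ frs fa = false≢ λ e → no₅ r s a x m
          (zero-of G r∈ , zero-of G s∈ , frs , fa , e ,
           top-0 , top r r∈W , top s s∈W , top (r +v s) (span-+ S r∈W s∈W) ,
           top a a∈W , top (a +v r) (span-+ S a∈W r∈W) , top (a +v s) (span-+ S a∈W s∈W) ,
           top (a +v r +v s) (span-+ S (span-+ S a∈W r∈W) s∈W) ,
           proj₁ (proj₁ c) , proj₂ (proj₁ c) ,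
           proj₁ m+rs , proj₂ m+rs , proj₁ m+ar , proj₂ m+ar , proj₁ m+as , proj₂ m+as ,
           proj₁ (proj₂ c r∈) , proj₂ (proj₂ c r∈) , proj₁ (proj₂ c s∈) , proj₂ (proj₂ c s∈) ,
           proj₁ m+a , proj₂ m+a , proj₁ m+ars , proj₂ m+ars)
          where
          a : Vector n
          a = p +v l
          vs : Vec (Vector n) 5
          vs = m ∷ p ∷ l ∷ r ∷ s ∷ []
          Λ⊆W : ∀ l → span Λ l → span S l
          Λ⊆W = span-induction (span S) Λ (span-0 S) λ {t} {l} t∈ l∈ → span-+ S l∈ (t∈W t∈)
            where
            t∈W : ∀ {t} → t ∈ Λ → span S t
            t∈W t∈ with ∈-map⁻ (p +v_) t∈
            ... | u , u∈ , refl = span-+ S (span-∈ S (p∈ G)) (span-∈ S u∈)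
          r∈W = span-∈ S r∈
          s∈W = span-∈ S s∈
          a∈W : span S a
          a∈W = span-+ S (span-∈ S (p∈ G)) (Λ⊆W l l∈)
          l+r : C (m +v (l +v (p +v r)))
          l+r = C-Λ c _ (span-+ Λ l∈ (Λ-∈ r∈))
          m+rs : Both false x (m +v (r +v s))
          m+rs = both-cong (solve vs (v₀ ⊕ ((v₁ ⊕ v₃) ⊕ (v₁ ⊕ v₄))) (v₀ ⊕ (v₃ ⊕ v₄)) refl)
            (proj₁ (C-Λ c _ (span-+ Λ (Λ-∈ r∈) (Λ-∈ s∈))))
          m+ar : Both false x (m +v (a +v r))
          m+ar = both-cong (solve vs (v₀ ⊕ (v₂ ⊕ (v₁ ⊕ v₃))) (v₀ ⊕ ((v₁ ⊕ v₂) ⊕ v₃)) refl) (proj₁ l+r)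
          m+as : Both false x (m +v (a +v s))
          m+as = both-cong (solve vs (v₀ ⊕ (v₂ ⊕ (v₁ ⊕ v₄))) (v₀ ⊕ ((v₁ ⊕ v₂) ⊕ v₄)) refl)
            (proj₁ (C-Λ c _ (span-+ Λ l∈ (Λ-∈ s∈))))
          m+a : Both true x (m +v a)
          m+a = both-cong (solve vs (v₀ ⊕ v₂ ⊕ v₁) (v₀ ⊕ (v₁ ⊕ v₂)) refl) (proj₂ (C-Λ c l l∈) (p∈ G))
          m+ars : Both true x (m +v (a +v r +v s))
          m+ars = both-cong (solve vs (v₀ ⊕ (v₂ ⊕ (v₁ ⊕ v₃)) ⊕ v₄) (v₀ ⊕ ((v₁ ⊕ v₂) ⊕ v₃ ⊕ v₄)) refl)
            (proj₂ l+r s∈)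

        zero-walk : ∀ {S′} → Grown S′ → (∀ {s} → s ∈ S′ → s ∈ S) → ∀ {l s} → span Λ l →
                    f (p +v l) ≡ false → s ∈ S′ → f (p +v (l +v (p +v s))) ≡ false
        zero-walk (pair _ _ e) ⊆S {l} l∈ fa (here refl) =
          by (p ∷ l ∷ q ∷ []) (v₀ ⊕ v₁ ⊕ v₀ ⊕ v₂) (v₀ ⊕ (v₁ ⊕ (v₀ ⊕ v₂))) refl
            (edge₅ l∈ (⊆S (there (here refl))) (⊆S (here refl)) e fa)
        zero-walk (pair _ _ _) ⊆S {l} l∈ fa (there (here refl)) =
          by (p ∷ l ∷ []) (v₀ ⊕ v₁) (v₀ ⊕ (v₁ ⊕ (v₀ ⊕ v₀))) refl fa
        zero-walk (grow G′ _ _ _) ⊆S l∈ fa (there t∈) = zero-walk G′ (⊆S ∘ there) l∈ fa t∈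
        zero-walk (grow {r = r} {s} G′ s∈ _ e) ⊆S {l} l∈ fa (here refl) =
          by (p ∷ l ∷ r ∷ s ∷ []) (v₀ ⊕ (v₁ ⊕ (v₀ ⊕ v₃)) ⊕ v₂ ⊕ v₃) (v₀ ⊕ (v₁ ⊕ (v₀ ⊕ v₂))) refl
            (edge₅ (span-+ Λ l∈ (Λ-∈ (⊆S (there s∈)))) (⊆S (here refl)) (⊆S (there s∈)) e
              (zero-walk G′ (⊆S ∘ there) l∈ fa s∈))

        -- p itself is a zero, and every generator p + s of `Λ` is a walk along edges on which
        -- `edge₅` preserves zeros.
        odd-zero : ∀ l → span Λ l → f (p +v l) ≡ false
        odd-zero l l∈ = proj₂ (span-induction (λ l → span Λ l × f (p +v l) ≡ false) Λ
            (span-0 Λ , trans (cong f (+v-identityʳ p)) (zero-of G (p∈ G))) step l l∈)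
          where
          step : ∀ {r l} → r ∈ Λ → span Λ l × f (p +v l) ≡ false → span Λ (l +v r) × f (p +v (l +v r)) ≡ false
          step r∈ (l∈ , fl) with ∈-map⁻ (p +v_) r∈
          ... | s , s∈ , refl = span-+ Λ l∈ (Λ-∈ s∈) , zero-walk G id l∈ fl s∈

        Λ⊎p+Λ : ∀ w → span S w → span Λ w ⊎ span Λ (p +v w)
        Λ⊎p+Λ = span-induction (λ w → span Λ w ⊎ span Λ (p +v w)) S (inj₁ (span-0 Λ)) λ
          { {s} {w} s∈ (inj₁ h) → inj₂ (subst (span Λ)
              (solve (p ∷ w ∷ s ∷ []) (v₁ ⊕ (v₀ ⊕ v₂)) (v₀ ⊕ (v₁ ⊕ v₂)) refl) (span-+ Λ h (Λ-∈ s∈)))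
          ; {s} {w} s∈ (inj₂ h) → inj₁ (subst (span Λ)
              (solve (p ∷ w ∷ s ∷ []) (v₀ ⊕ v₁ ⊕ (v₀ ⊕ v₂)) (v₁ ⊕ v₂) refl) (span-+ Λ h (Λ-∈ s∈))) }

      -- If all neighbours of m are zero, so is m + e. Otherwise e is an even sum, where m + e is
      -- zero like m, or an odd sum, where e itself is zero.
      contradiction′ : ∀ {m e} → Both false x m → span S e → f e ≡ true → f (m +v e) ≡ true → ⊥
      contradiction′ {m} {e} b e∈ fe fme with dichotomy G top b
      ... | inj₁ h = false≢true (proj₁ (all-zero G top b h e e∈)) fme
      ... | inj₂ h with Λ⊎p+Λ (b , h) e e∈
      ... | inj₁ l = false≢true (proj₁ (proj₁ (C-Λ (b , h) e l))) fme
      ... | inj₂ l = false≢true (odd-zero (b , h) (p +v e) l) (by (p ∷ e ∷ []) v₁ (v₀ ⊕ (v₀ ⊕ v₁)) refl fe)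

    module _ {k₀ : ℕ} (no₄ : ∀ r s x m → ¬ Conf₄ r s x m) (no₅ : ∀ r s a x m → ¬ Conf₅ r s a x m) where

      linked? : ∀ (S : List (Vector n)) → Dec (∃[ e ] ∃[ h ]
        (span S e × f e ≡ true × ¬ span S h × f h ≡ true × f (e +v h) ≡ false))
      linked? S = any? λ e → any? λ h →
        span? S e ×-dec (f e ≟b true) ×-dec ¬? (span? S h) ×-dec (f h ≟b true) ×-dec (f (e +v h) ≟b false)

      -- Without a link, adding a point of W to a point off W gives a point. So the stabiliser `L`
      -- in W of the points off W contains all points of W; a point outside `L` lies off W, hence f
      -- is invariant under `L` there.
      unlinked-outcome : ∀ {S x} → Grown S → Top x S → ¬ (∃[ e ] ∃[ h ]
        (span S e × f e ≡ true × ¬ span S h × f h ≡ true × f (e +v h) ≡ false)) → Outcome k₀ f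
      unlinked-outcome {S} {x} G top none with sum∈ G
      ... | r , s , r∈ , s∈ , frs =
        joined L L-invariant (r +v s) frs (E∩W⊆L _ (span-+ S (span-∈ S r∈) (span-∈ S s∈)) frs)
               x (trans (cong f (sym (+v-identityʳ x))) (top 0v (span-0 S))) (x∉W ∘ proj₁)
        where
        L : Subspace n
        L = record
          { In = λ v → span S v × (∀ h → f h ≡ true → ¬ span S h → f (h +v v) ≡ true)
          ; in? = λ v → span? S v ×-dec all? (λ h → (f h ≟b true) →-dec (¬? (span? S h) →-dec (f (h +v v) ≟b true)))
          ; in-0 = span-0 S , λ h fh _ → trans (cong f (+v-identityʳ h)) fh
          ; in-+ = λ {u} {v} (u∈ , p) (v∈ , q) → span-+ S u∈ v∈ , λ h fh h∉ →
              trans (cong f (sym (+v-assoc h u v)))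
                (q (h +v u) (p h fh h∉) (λ hu → h∉ (in-cancel ⟨ S ⟩ {h} {u} hu u∈))) }
        E∩W⊆L : ∀ e → span S e → f e ≡ true → In L e
        E∩W⊆L e e∈ fe = e∈ , λ h fh h∉ → ≢false⇒≡true λ q → none
          (e , h , e∈ , fe , h∉ , fh , trans (cong f (+v-comm e h)) q)
        x∉W : ¬ span S x
        x∉W x∈ = false≢true f0 (trans (cong f (sym (+v-self x))) (top x x∈))
        outside : ∀ {u v} → In L u → ¬ In L v → f v ≡ true → f (u +v v) ≡ true
        outside {u} {v} u∈ v∉ fv = trans (cong f (+v-comm u v)) (proj₂ u∈ v fv (λ v∈ → v∉ (E∩W⊆L v v∈ fv)))
        L-invariant : ∀ {u v} → In L u → ¬ In L v → f (u +v v) ≡ f v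
        L-invariant {u} {v} u∈ v∉ = go (f v) (f (u +v v)) refl refl
          where
          go : ∀ b c → f v ≡ b → f (u +v v) ≡ c → f (u +v v) ≡ f v
          go true _ fv _ = trans (outside u∈ v∉ fv) (sym fv)
          go false false fv fuv = trans fuv (sym fv)
          go false true fv fuv = false≢true fv (trans (cong f (sym (cancelˡ u v)))
            (outside u∈ (λ uv∈ → v∉ (subst (In L) (cancelˡ u v) (in-+ L u∈ uv∈))) fuv))

      grow-outcome : ∀ k {S x} → n ≤ length S + k → Indep S → Grown S → Top x S → Outcome k₀ f
      grow-outcome k {S} {x} fuel ind G top with linked? S
      ... | no none = unlinked-outcome G top none
      ... | yes (e , h , e∈ , fe , h∉ , fh , feh) with any? (λ w → span? S w ×-dec (f (x +v (e +v h) +v w) ≟b false))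
      -- Replacing x by x + w, which is still a top, makes e + h a pair of zeros, although e + h + e
      -- = h is a point.
      ... | yes (w , w∈ , fw) = ⊥-elim (Contradiction.contradiction′ no₄ no₅ G {x +v w}
              (λ u u∈ → trans (cong f (+v-assoc x w u)) (top (w +v u) (span-+ S w∈ u∈)))
              (feh , by (x ∷ e ∷ h ∷ w ∷ []) (v₀ ⊕ (v₁ ⊕ v₂) ⊕ v₃) (v₁ ⊕ v₂ ⊕ (v₀ ⊕ v₃)) refl fw)
              e∈ fe (by (e ∷ h ∷ []) v₁ (v₀ ⊕ v₁ ⊕ v₀) refl fh))
      ... | no full with any? (λ m → span? S (m +v (e +v h)) ×-dec (f m ≟b false) ×-dec
                                    Any.any? (λ s → f (m +v s) ≟b true) S)
      -- If no zero in the coset e + h + W had a point neighbour, zeros would spread from e + h over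
      -- the whole coset, which contains the point h.
      ... | no isolated = ⊥-elim (false≢true (zeros e e∈) (by (e ∷ h ∷ []) v₁ (v₀ ⊕ v₁ ⊕ v₀) refl fh))
        where
        zeros : ∀ w → span S w → f ((e +v h) +v w) ≡ false
        zeros w w∈ = proj₂ (span-induction (λ w → span S w × f ((e +v h) +v w) ≡ false) S
          (span-0 S , trans (cong f (+v-identityʳ (e +v h))) feh)
          (λ {s} {w} s∈ (w∈ , fw) → span-+ S w∈ (span-∈ S s∈) , false≢ λ q → isolated
            ((e +v h) +v w , subst (span S) (solve (e ∷ h ∷ w ∷ []) v₂ (v₀ ⊕ v₁ ⊕ v₂ ⊕ (v₀ ⊕ v₁)) refl) w∈ ,
             fw , lose s∈ (trans (cong f (+v-assoc (e +v h) w s)) q))) w w∈)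
      ... | yes (m , m∈ , fm , some) with find some | k
      ... | s , s∈ , fms | zero = ⊥-elim (1+n≰n (≤-trans (indep-length (m ∷ S) (m∉ ∷ ind))
                                            (≤-trans fuel (≤-reflexive (+-identityʳ (length S))))))
        where
        m∉ : ¬ span S m
        m∉ m∈S = h∉ (subst (span S) (solve (e ∷ h ∷ m ∷ []) (v₂ ⊕ (v₂ ⊕ (v₀ ⊕ v₁)) ⊕ v₀) v₁ refl)
          (span-+ S (span-+ S m∈S m∈) e∈))
      ... | s , s∈ , fms | suc k′ = grow-outcome k′ (≤-trans fuel (≤-reflexive (+-suc (length S) k′)))
              (m∉ ∷ ind) (grow G s∈ fm fms) top′
        where
        m∉ : ¬ span S m
        m∉ m∈S = h∉ (subst (span S) (solve (e ∷ h ∷ m ∷ []) (v₂ ⊕ (v₂ ⊕ (v₀ ⊕ v₁)) ⊕ v₀) v₁ refl)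
          (span-+ S (span-+ S m∈S m∈) e∈))
        top′ : Top x (m ∷ S)
        top′ w (inj₁ w∈) = top w w∈
        -- The vectors added to x lie in e + h + W, and x + e + h + W has no zero.
        top′ w (inj₂ w∈) = ≢false⇒≡true λ q → full (w +v (e +v h) ,
          subst (span S) (solve (w ∷ m ∷ e ∷ h ∷ []) ((v₀ ⊕ v₁) ⊕ (v₁ ⊕ (v₂ ⊕ v₃))) (v₀ ⊕ (v₂ ⊕ v₃)) refl)
            (span-+ S w∈ m∈) ,
          by (x ∷ w ∷ e ∷ h ∷ []) (v₀ ⊕ v₁) (v₀ ⊕ (v₂ ⊕ v₃) ⊕ (v₁ ⊕ (v₂ ⊕ v₃))) refl q)

  five-outcome : ∀ {s₀} → FlatBound f s₀ → ∀ x p q → f p ≡ false → f q ≡ false → f (p +v q) ≡ true →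
    f x ≡ true → f (x +v p) ≡ true → f (x +v q) ≡ true → f (x +v p +v q) ≡ true → Outcome (triangleBound s₀) f
  five-outcome bound x p q fp fq fpq fx fxp fxq fxpq
    with any? (λ r → any? λ s → any? λ x → any? λ m → holds? (λ d → f (⟦ d ⟧ (r ∷ s ∷ x ∷ m ∷ []))) lits₄)
       | any? (λ r → any? λ s → any? λ a → any? λ x → any? λ m →
           holds? (λ d → f (⟦ d ⟧ (r ∷ s ∷ a ∷ x ∷ m ∷ []))) lits₅)
  ... | yes (r , s , x′ , m , h) | _ = conf₄-outcome bound r s x′ m h
  ... | _ | yes (r , s , a , x′ , m , h) = conf₅-outcome bound r s a x′ m h
  ... | no no₄ | no no₅ = grow-outcome p q
    (λ r s x m h → no₄ (r , s , x , m , h)) (λ r s a x m h → no₅ (r , s , a , x , m , h))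
    n {S} {x} (m≤n+m n 2) (q∉ ∷ p∉ ∷ []) (pair fp fq fpq) top
    where
    S : List (Vector n)
    S = q ∷ p ∷ []
    p∉ : ¬ span [] p
    p∉ refl = false≢true fq (trans (cong f (sym (+v-identityˡ q))) fpq)
    q∉ : ¬ span (p ∷ []) q
    q∉ (inj₁ refl) = false≢true fp (trans (cong f (sym (+v-identityʳ p))) fpq)
    q∉ (inj₂ e) = false≢true f0 (trans (cong f (sym (trans (+v-comm p q) e))) fpq)
    top : Top p q x S
    top w (inj₁ (inj₁ refl)) = trans (cong f (+v-identityʳ x)) fx
    top w (inj₁ (inj₂ e)) = trans (cong (λ z → f (x +v z)) (+v≡0⇒≡ w p e)) fxp
    top w (inj₂ (inj₁ e)) = trans (cong (λ z → f (x +v z)) (+v≡0⇒≡ w q e)) fxq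
    top w (inj₂ (inj₂ e)) = trans (cong f (trans (cong (x +v_)
      (trans (+v≡0⇒≡ w (q +v p) (trans (sym (+v-assoc w q p)) e)) (+v-comm q p))) (sym (+v-assoc x p q)))) fxpq

-- The decomposition

outcome-≤ : ∀ {k k′ n} {f : Vector n → Bool} → k ≤ k′ → Outcome k f → Outcome k′ f
outcome-≤ le (joined K inv x fx x∈ y fy y∉) = joined K inv x fx x∈ y fy y∉
outcome-≤ le (even K ⊇ ev) = even K ⊇ ev
outcome-≤ le (extending K U ⊇ codim ext) =
  extending K U ⊇ (λ m φ L φ∈ ker → ≤-trans (codim m φ L φ∈ ker) le) ext

-- Covers both sources of `extending`: a template costs at most `triangleBound s`, a triple at most
-- 2.
lossAt : ℕ → ℕ
lossAt s = triangleBound s + 2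

outcome : ∀ {n s} (f : Vector n → Bool) → f 0v ≡ false → CF f → FlatBound f s → Outcome (lossAt s) f
outcome {n} {s} f f0 cf bound with any? (λ x → any? λ p → any? λ q → plane? x p q)
  where
  plane? : ∀ x p q → Dec (f p ≡ false × f q ≡ false × f (p +v q) ≡ true × f x ≡ true ×
                          f (x +v p) ≡ true × f (x +v q) ≡ true × f (x +v p +v q) ≡ true)
  plane? x p q = (f p ≟b false) ×-dec (f q ≟b false) ×-dec (f (p +v q) ≟b true) ×-dec (f x ≟b true) ×-dec
    (f (x +v p) ≟b true) ×-dec (f (x +v q) ≟b true) ×-dec (f (x +v p +v q) ≟b true)
... | yes (x , p , q , fp , fq , fpq , fx , fxp , fxq , fxpq) =
  outcome-≤ (m≤m+n (triangleBound s) 2) (FivePlane.five-outcome f f0 cf bound x p q fp fq fpq fx fxp fxq fxpq)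
... | no none = outcome-≤ (m≤n+m 2 (triangleBound s)) (NoFivePlane.no5-outcome f f0 cf
  λ x p q fp fq fpq fx fxp fxq → false≢ λ fxpq → none (x , p , q , fp , fq , fpq , fx , fxp , fxq , fxpq))

solid-[] : ∀ {n} (f : Vector n → Bool) {v} → f v ≡ true → Solid f (v ∷ [])
solid-[] f {v} fv (true ∷ []) _ = trans (cong f (+v-identityʳ v)) fv

lin-++ : ∀ {n a b} (us : Vec (Vector n) a) (vs : Vec (Vector n) b) c d →
         lin (us ++ vs) (c ++ d) ≡ lin us c +v lin vs d
lin-++ [] vs [] d = sym (+v-identityˡ _)
lin-++ (u ∷ us) vs (false ∷ c) d = lin-++ us vs c d
lin-++ (u ∷ us) vs (true ∷ c) d = trans (cong (u +v_) (lin-++ us vs c d)) (sym (+v-assoc u _ _))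

-- The lift-join case needs the exact ω of the lower factor with a witness, in order to subtract it
-- from the available bound.
maximalFlat : ∀ {n} (f : Vector n → Bool) s → FlatBound f s →
              ∃[ a ] (FlatBound f a × Σ (Vec (Vector n) a) (Solid f))
maximalFlat f zero bound = 0 , bound , [] , λ { [] () }
maximalFlat f (suc s) bound
  with anyVec? {d = suc s} (λ vs → all? λ c → (isZero c ≟b false) →-dec (f (lin vs c) ≟b true))
... | yes (vs , S) = suc s , bound , vs , S
... | no none = maximalFlat f s bound′
  where
  bound′ : FlatBound f s
  bound′ {d} vs S with m≤n⇒m<n∨m≡n (bound vs S)
  ... | inj₁ (s≤s d≤s) = d≤s
  ... | inj₂ refl = ⊥-elim (none (vs , S))

good-extend : ∀ {k k′ N n} {f : Vector n → Bool} (U : Subspace n) → Splitting.c (splitting U) ≤ k′ →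
              Good k N (Splitting.d (splitting U)) (f ∘ Splitting.ι (splitting U)) → Good (k + k′) N n f
good-extend {k} {k′} {n = n} U c≤k′ (good {d₁} φ Lφ kφ co ch) = good (ι ∘ φ) (∘-linear ι-linear Lφ)
  (λ v e → kφ v (trans (sym (π₁-ι (φ v))) (trans (cong π₁ e) (linear-0 π₁ π₁-linear))))
  (≤-trans (≤-reflexive (sym dims)) (≤-trans (+-mono-≤ co c≤k′) (≤-reflexive (+-assoc d₁ k k′)))) ch
  where
  open Splitting (splitting U)

module _ {n : ℕ} (f : Vector n → Bool) (f0 : f 0v ≡ false) (K : Subspace n) (E⊆K : ∀ v → f v ≡ true → In K v) where

  open Splitting (splitting K)

  outside-zero : ∀ v → ¬ In K v → f v ≡ false
  outside-zero v v∉ = false≢ (λ fv → v∉ (E⊆K v fv))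

  good-support : ∀ {k N} → Good k N d (f ∘ ι) → Good (k + 0) (N + 1) n f
  good-support g = good-⊗ f f0 K invariant g (good-∅ λ w → false≢ λ fw →
      false≢true (trans (cong f (trans (cong κ (κ-in⇒≡0 w (E⊆K _ fw))) (linear-0 κ κ-linear))) f0) fw)
    where
    invariant : ∀ {u v} → In K u → ¬ In K v → f (u +v v) ≡ f v
    invariant {u} {v} u∈ v∉ = trans
      (outside-zero (u +v v) (λ uv∈ → v∉ (subst (In K) (cancelˡ u v) (in-+ K u∈ uv∈))))
      (sym (outside-zero v v∉))

-- An even-plane part and an `extending` step each bring one empty factor for the space off K, while
-- doubling is additive under lift-joins. For ω = 0 the ground set is empty and one factor suffices.
count : ℕ → ℕ
count zero = 1
count (suc s) = 2 * suc s

-- Both parts of a lift-join may lose `loss s`; the last summand pays for passing to U.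
loss : ℕ → ℕ
loss zero = 0
loss (suc s) = (loss s + loss s) + lossAt (suc s)

loss-mono : ∀ {a s} → a ≤ s → loss a ≤ loss s
loss-mono {a} {zero} z≤n = ≤-refl
loss-mono {a} {suc s} a≤ with m≤n⇒m<n∨m≡n a≤
... | inj₁ (s≤s a≤s) = ≤-trans (loss-mono a≤s) (≤-trans (m≤m+n (loss s) (loss s)) (m≤m+n _ (lossAt (suc s))))
... | inj₂ refl = ≤-refl

count-suc : ∀ s → count s + 1 ≤ count (suc s)
count-suc zero = ≤-refl
count-suc (suc s) = ≤-trans (+-monoʳ-≤ (2 * suc s) (s≤s z≤n)) (≤-reflexive (trans (+-comm (2 * suc s) 2) (sym (*-suc 2 (suc s)))))

count-+ : ∀ a b → 1 ≤ a → 1 ≤ b → count a + count b ≡ count (a + b)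
count-+ (suc a) (suc b) _ _ = sym (*-distribˡ-+ 2 (suc a) (suc b))

Decomposes : ℕ → Set
Decomposes s = ∀ {n} (f : Vector n → Bool) → f 0v ≡ false → CF f → FlatBound f s → Good (loss s) (count s) n f

module Step (s : ℕ) (ih : ∀ {a} → a ≤ s → Decomposes a) {n : ℕ} (f : Vector n → Bool) (f0 : f 0v ≡ false)
            (cf : CF f) (bound : FlatBound f (suc s)) where

  Goal : Set
  Goal = Good (loss (suc s)) (count (suc s)) n f

  from-even : (K : Subspace n) → (∀ v → f v ≡ true → In K v) → EvenOn f (In K) → Goal
  from-even K E⊆K ev = good-≤ z≤n (m≤m*n 2 (suc s)) (good-support f f0 K E⊆K
      (good-even {f = f ∘ ι} fι0 (evenOn⇒evenPlane (f ∘ ι) fι0 λ a b c → trans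
        (cong f (trans (ι-linear (a +v b) c) (cong (_+v ι c) (ι-linear a b))))
        (trans (ev (ι a) (ι b) (ι c) (ι-in a) (ι-in b) (ι-in c))
          (cong (λ z → f (ι a) xor f (ι b) xor f (ι c) xor z)
            (cong₂ _xor_ (cong f (sym (ι-linear a b)))
              (cong₂ _xor_ (cong f (sym (ι-linear a c))) (cong f (sym (ι-linear b c))))))))))
    where
    open Splitting (splitting K)
    fι0 : f (ι 0v) ≡ false
    fι0 = trans (cong f (linear-0 ι ι-linear)) f0

  from-extending : (K U : Subspace n) → (∀ v → f v ≡ true → In K v) →
    (∀ m (φ : Vector m → Vector n) → Linear φ → (∀ w → In K (φ w)) →
       (∀ w → In U (φ w) → w ≡ 0v) → m ≤ lossAt (suc s)) →
    (∀ {d} (vs : Vec (Vector n) d) → Solid f vs → (∀ c → In U (lin vs c)) →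
       Σ (Vec (Vector n) (suc d)) (Solid f)) → Goal
  from-extending K U E⊆K codim extend =
    good-≤ (≤-trans (≤-reflexive (+-identityʳ _)) (+-monoˡ-≤ (lossAt (suc s)) (m≤m+n (loss s) (loss s))))
      (count-suc s)
      (good-support f f0 K E⊆K (good-extend U′
        (codim c (S.ι ∘ κ) (∘-linear S.ι-linear κ-linear) (λ w → S.ι-in (κ w)) (λ w → κ-in⇒≡0 w))
        (ih ≤-refl (f ∘ ψ) (trans (cong f (linear-0 ψ Lψ)) f0) (CF-∘ f ψ Lψ cf) flats)))
    where
    module S = Splitting (splitting K)
    U′ : Subspace S.d
    U′ = pullback U S.ι S.ι-linear
    open Splitting (splitting U′)
    ψ : Vector d → Vector n
    ψ = S.ι ∘ ι
    Lψ : Linear ψ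
    Lψ = ∘-linear S.ι-linear ι-linear
    -- A flat inside U extends by one dimension to a flat bounded by `suc s`.
    flats : FlatBound (f ∘ ψ) s
    flats vs S with extend (map ψ vs) (solid-map f ψ Lψ vs S)
                      (λ c → subst (In U) (linear-lin ψ Lψ vs c) (ι-in (lin vs c)))
    ... | ws , S′ with bound ws S′
    ... | s≤s d≤s = d≤s

  -- A maximal flat of the lower factor plus any flat of the upper one is again a flat in the ground
  -- set, so the two values of ω sum to at most `suc s`. The points x and y make both parts
  -- positive, hence both at most s.
  from-joined : (K : Subspace n) → (∀ {u v} → In K u → ¬ In K v → f (u +v v) ≡ f v) →
                ∀ x → f x ≡ true → In K x → ∀ y → f y ≡ true → ¬ In K y → Goal
  from-joined K invariant x fx x∈ y fy y∉ with maximalFlat (f ∘ ι) (suc s) boundι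
    where
    open Splitting (splitting K)
    boundι : FlatBound (f ∘ ι) (suc s)
    boundι vs S = bound (map ι vs) (solid-map f ι ι-linear vs S)
  ... | a , bound-a , us , us-solid = good-≤ loss-≤ (≤-reflexive (trans (count-+ a b 1≤a 1≤b) (cong count a+b)))
      (good-⊗ f f0 K invariant
        (ih a≤s (f ∘ ι) (trans (cong f (linear-0 ι ι-linear)) f0) (CF-∘ f ι ι-linear cf) bound-a)
        (ih b≤s (f ∘ κ) (trans (cong f (linear-0 κ κ-linear)) f0) (CF-∘ f κ κ-linear cf) bound-b))
    where
    open Splitting (splitting K)
    b : ℕ
    -- With a the exact ω of the lower factor, this is what remains for the upper one.
    b = suc s ∸ a
    sum-solid : ∀ {e} (vs : Vec (Vector c) e) → Solid (f ∘ κ) vs → Solid f (map ι us ++ map κ vs)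
    sum-solid vs S z nz = subst (λ z → isZero z ≡ false → f (lin (map ι us ++ map κ vs) z) ≡ true)
      (take++drop≡id a z) (core (take a z) (drop a z)) nz
      where
      core : ∀ u w → isZero (u ++ w) ≡ false → f (lin (map ι us ++ map κ vs) (u ++ w)) ≡ true
      core u w nz′ = trans (cong f (trans (lin-++ (map ι us) (map κ vs) u w)
          (cong₂ _+v_ (sym (linear-lin ι ι-linear us u)) (sym (linear-lin κ κ-linear vs w)))))
        (trans (split-join f f0 K invariant (lin us u) (lin vs w)) (value (isZero w) refl))
        where
        value : ∀ t → isZero w ≡ t → join (f ∘ ι) (f ∘ κ) (lin us u) (lin vs w) ≡ true
        value false w≢0 = trans (cong ((isZero (lin vs w) ∧ f (ι (lin us u))) ∨_) (S w w≢0)) (∨-zeroʳ _)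
        value true w≡0 = cong₂ (λ p q → (p ∧ q) ∨ f (κ (lin vs w)))
          (trans (cong isZero (trans (cong (lin vs) (isZero⇒≡ w w≡0)) (lin-0 vs))) (isZero-0v c))
          (us-solid u (trans (sym (∧-true (isZero u))) (trans (cong (isZero u ∧_) (sym w≡0))
            (trans (sym (isZero-++ u w)) nz′))))
          where
          ∧-true : ∀ t → t ∧ true ≡ t
          ∧-true false = refl
          ∧-true true = refl
    a≤ : a ≤ suc s
    a≤ = bound (map ι us) (solid-map f ι ι-linear us us-solid)
    a+b : a + b ≡ suc s
    a+b = m+[n∸m]≡n a≤
    bound-b : FlatBound (f ∘ κ) b
    bound-b {e} vs S = +-cancelˡ-≤ a e b (≤-trans (bound (map ι us ++ map κ vs) (sum-solid vs S)) (≤-reflexive (sym a+b)))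
    1≤a : 1 ≤ a
    1≤a = bound-a (π₁ x ∷ []) (solid-[] (f ∘ ι) (trans (cong f (in⇒ι x x∈)) fx))
    1≤b : 1 ≤ b
    1≤b = bound-b (π₂ y ∷ []) (solid-[] (f ∘ κ) (trans (sym (invariant (ι-in (π₁ y))
        (λ p → y∉ (π₂≡0⇒in y (κ-in⇒≡0 (π₂ y) p))))) (trans (cong f (recombine y)) fy)))
    a≤s : a ≤ s
    a≤s = +-cancelʳ-≤ 1 a s (≤-trans (+-monoʳ-≤ a 1≤b) (≤-reflexive (trans a+b (+-comm 1 s))))
    b≤s : b ≤ s
    b≤s = +-cancelˡ-≤ 1 b s (≤-trans (+-monoˡ-≤ b 1≤a) (≤-reflexive a+b))
    loss-≤ : loss a + loss b ≤ loss (suc s)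
    loss-≤ = ≤-trans (+-mono-≤ (loss-mono a≤s) (loss-mono b≤s)) (m≤m+n _ (lossAt (suc s)))

  step : Goal
  step with outcome f f0 cf bound
  ... | even K E⊆K ev = from-even K E⊆K ev
  ... | extending K U E⊆K codim extend = from-extending K U E⊆K codim extend
  ... | joined K invariant x fx x∈ y fy y∉ = from-joined K invariant x fx x∈ y fy y∉

-- Strong induction by recursion on an upper bound for a, since the parts of a lift-join can have
-- any smaller ω.
decomposes-upTo : ∀ s {a} → a ≤ s → Decomposes a
decomposes-upTo s {zero} _ f f0 cf bound = good-∅ λ v → false≢ λ fv → 1+n≰n (bound (v ∷ []) (solid-[] f fv))
decomposes-upTo (suc s) {suc a} (s≤s a≤s) f f0 cf bound =
  Step.step a (λ b≤a → decomposes-upTo s (≤-trans b≤a a≤s)) f f0 cf bound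

-- Translation between matroids and indicator functions

clawFree⇒CF : (M : Matroid) → WF M → ClawFree M → CF (E M)
clawFree⇒CF M wf cfree x y z fx fy fz fxy fyz fxz = ≢false⇒≡true λ fxyz → cfree (F fxyz)
  -- With a zero at x + y + z the parametrised plane has exactly the values of the claw, so the
  -- identity is an isomorphism.
  (id , (λ _ _ → refl) , (id , λ v → v , id) , λ v → sym (values fxyz v))
  where
  f = E M
  xyz : Vec (Vector (dim M)) 3
  xyz = x ∷ y ∷ z ∷ []
  values : f (x +v y +v z) ≡ false → ∀ v → f (lin xyz v) ≡ E claw v
  values e (false ∷ false ∷ false ∷ []) = wf
  values e (false ∷ false ∷ true ∷ []) = trans (cong f (+v-identityʳ z)) fz
  values e (false ∷ true ∷ false ∷ []) = trans (cong f (+v-identityʳ y)) fy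
  values e (false ∷ true ∷ true ∷ []) = trans (cong f (cong (y +v_) (+v-identityʳ z))) fyz
  values e (true ∷ false ∷ false ∷ []) = trans (cong f (+v-identityʳ x)) fx
  values e (true ∷ false ∷ true ∷ []) = trans (cong f (cong (x +v_) (+v-identityʳ z))) fxz
  values e (true ∷ true ∷ false ∷ []) = trans (cong f (cong (x +v_) (+v-identityʳ y))) fxy
  values e (true ∷ true ∷ true ∷ []) =
    trans (cong f (solve xyz (v₀ ⊕ (v₁ ⊕ (v₂ ⊕ 𝟘))) (v₀ ⊕ v₁ ⊕ v₂) refl)) e
  -- A nontrivial relation between x, y, z moves one of them to a combination
  -- at which f vanishes.
  kernel : f (x +v y +v z) ≡ false → ∀ v → lin xyz v ≡ 0v → v ≡ 0v
  kernel e v eq = ker v eq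
    where
    move : ∀ u v → f (lin xyz u) ≡ true → f (lin xyz (u +v v)) ≡ false → lin xyz v ≡ 0v → ⊥
    move u v fu fuv eq = false≢true fuv (trans (cong f (trans (lin-linear xyz u v)
      (trans (cong (lin xyz u +v_) eq) (+v-identityʳ _)))) fu)
    a b c : Vector 3
    a = true ∷ false ∷ false ∷ []
    b = false ∷ true ∷ false ∷ []
    c = false ∷ false ∷ true ∷ []
    val : ∀ v → f (lin xyz v) ≡ E claw v
    val = values e
    ker : ∀ v → lin xyz v ≡ 0v → v ≡ 0v
    ker v@(false ∷ false ∷ false ∷ []) _ = refl
    ker v@(false ∷ false ∷ true ∷ []) eq = ⊥-elim (move c v (val c) (val (c +v v)) eq)
    ker v@(false ∷ true ∷ false ∷ []) eq = ⊥-elim (move b v (val b) (val (b +v v)) eq)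
    ker v@(false ∷ true ∷ true ∷ []) eq = ⊥-elim (move a v (val a) (val (a +v v)) eq)
    ker v@(true ∷ false ∷ false ∷ []) eq = ⊥-elim (move a v (val a) (val (a +v v)) eq)
    ker v@(true ∷ false ∷ true ∷ []) eq = ⊥-elim (move b v (val b) (val (b +v v)) eq)
    ker v@(true ∷ true ∷ false ∷ []) eq = ⊥-elim (move c v (val c) (val (c +v v)) eq)
    ker v@(true ∷ true ∷ true ∷ []) eq = ⊥-elim (move a v (val a) (val (a +v v)) eq)
  F : f (x +v y +v z) ≡ false → Flat 3 (dim M)
  F e = flat (lin xyz) (lin-linear xyz) λ {u} {v} eq → +v≡0⇒≡ u v (kernel e (u +v v)
    (trans (lin-linear xyz u v) (trans (cong (_+v lin xyz v) eq) (+v-self _))))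

-- Solidity alone makes `vs` independent, because a nontrivial relation would make `0v` a point.
omegaLe⇒flatBound : (M : Matroid) → WF M → ∀ {s} → OmegaLe M s → FlatBound (E M) s
omegaLe⇒flatBound M wf ω {d} vs S = ω d (flat (lin vs) (lin-linear vs) injective) S
  where
  injective : ∀ {u v} → lin vs u ≡ lin vs v → u ≡ v
  injective {u} {v} eq with isZero (u +v v) in e
  ... | true = +v≡0⇒≡ u v (isZero⇒≡ _ e)
  ... | false = false≢true (trans (cong (E M) (trans (lin-linear vs u v)
    (trans (cong (_+v lin vs v) eq) (+v-self _)))) wf) (S (u +v v) e)

theorem1p6 : (s : ℕ) → 1 ≤ s →
    ∃[ k ] (2 ≤ k ×
    ((M : Matroid) → WF M → ClawFree M → OmegaLe M s →
    ∃[ d ] Σ (Flat d (dim M)) λ F →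
    dim M ≤ d + k ×
    Σ (Vec Matroid (suc (2 * s))) λ Ms →
    All WF Ms × All EvenPlane Ms × (restrict M F ≅ iterLiftJoin Ms)))
-- The summand 2 secures 2 ≤ k for every s.
theorem1p6 s@(suc _) _ = loss s + 2 , m≤n+m 2 (loss s) , λ M wf cfree ω → conclude M
    (decomposes-upTo s ≤-refl (E M) wf (clawFree⇒CF M wf cfree) (omegaLe⇒flatBound M wf ω))
  where
  conclude : (M : Matroid) → Good (loss s) (count s) (dim M) (E M) →
    ∃[ d ] Σ (Flat d (dim M)) λ F →
    dim M ≤ d + (loss s + 2) ×
    Σ (Vec Matroid (suc (2 * s))) λ Ms →
    All WF Ms × All EvenPlane Ms × (restrict M F ≅ iterLiftJoin Ms)
  conclude M (good {d} φ L ker co ch) = d ,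
    flat φ L (λ {u} {v} eq → +v≡0⇒≡ u v (ker (u +v v)
      (trans (L u v) (trans (cong (_+v φ v) eq) (+v-self (φ v)))))) ,
    ≤-trans co (+-monoʳ-≤ d (m≤m+n (loss s) 2)) ,
    -- For s ≥ 1 the count is 2s, and padding raises the number of factors to 2s + 1.
    chain-exact (chain-≤ (n≤1+n (2 * s)) ch)
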